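{- The randomized online algorithm $\mathrm{Rand}$ (defined in the context) is $4\ln n$-competitive for online MinLA when all revealed graphs are collections of cliques. That is, for every node set $V$ with $|V|=n$ and every clique instance $\sigma=(\pi_0;G_0,\dots,G_k)$ on $V$, $$\mathbb{E}[\mathrm{Rand}(\sigma)]\le 4\ln n\cdot \mathrm{Opt}(\sigma).$$
   Context: Let $V$ be a set of $n$ nodes. A permutation is a bijection $\pi:V\to\{1,\dots,n\}$ ($\pi(x)$ is the position of $x$; smaller positions are further left). A MinLA of a graph $G=(V,E)$ is a permutation $\pi$ minimizing $\sum_{\{x,y\}\in E}|\pi(x)-\pi(y)|$ among all permutations. $d(\pi,\pi')$ is the Kendall tau distance: the minimum number of swaps of adjacent elements transforming $\pi$ into $\pi'$. Clique instance: an arbitrary initial permutation $\pi_0$ and a sequence $G_0,\dots,G_k$ of graphs on $V$, where $G_0$ has no edges, every $G_i$ is a disjoint union of cliques (isolated nodes count as cliques of size one), and $G_{i+1}$ is obtained from $G_i$ by merging exactly two cliques into one clique. Let $X_i,Z_i$ be the node sets of the two cliques of $G_i$ that merge in $G_{i+1}$. Feasible solution: permutations $\pi_1,\dots,\pi_k$ such that $\pi_i$ is a MinLA of $G_i$ for each $i$; its cost is $\sum_{i=0}^{k-1}d(\pi_i,\pi_{i+1})$. An online algorithm must choose $\pi_i$ knowing only $\pi_0,G_0,\dots,G_i$. $\mathrm{Opt}(\sigma)$ is the minimum cost of a feasible solution of the instance $\sigma$ (full knowledge of $\sigma$). A randomized algorithm is $c$-competitive (against the oblivious adversary) if on every fixed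 instance $\sigma$ its expected cost is at most $c\cdot\mathrm{Opt}(\sigma)$. Algorithm $\mathrm{Rand}$ (cliques): when $G_{i+1}$ is revealed, starting from $\pi_i$, flip a fresh independent biased coin. With probability $|Z_i|/(|X_i|+|Z_i|)$, move the block $X_i$ (keeping its internal order) towards $Z_i$ past all nodes lying between them until $X_i$ is adjacent to $Z_i$; with the remaining probability $|X_i|/(|X_i|+|Z_i|)$, move the block $Z_i$ (keeping its internal order) towards $X_i$ until it is adjacent to $X_i$. All other relative orders are unchanged. The result is $\pi_{i+1}$. $\mathrm{Rand}(\sigma)$ is its (random) cost on $\sigma$. -}

module Defs where

open import Data.Bool.Base using (if_then_else_; true)
import Data.Empty as Empty
open import Data.Fin.Base using (Fin; zero; suc; toℕ; fromℕ<; combine; punchOut; _<_)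
open import Data.Fin.Patterns using (0F; 1F; 2F)
open import Data.Fin.Permutation
  using (Permutation′; permutation; _⟨$⟩ʳ_; _⟨$⟩ˡ_; _≈_; _∘ₚ_; transpose; flip; inverseˡ)
open import Data.Fin.Permutation.Transposition.List using (TranspositionList; eval; decompose; eval-decompose)
open import Data.Fin.Properties
  using (_≟_; _<?_; any?; all?; toℕ<n; fromℕ<-injective; toℕ-fromℕ<;
         combine-injectiveʳ; punchOut-injective; injective⇒≤; <-cmp)
open import Data.Fin.Subset using (Subset; ∣_∣; _∈_; _∉_; _∪_; ⁅_⁆; Nonempty)
open import Data.Fin.Subset.Properties
  using (_∈?_; x∈p∪q⁺; x∈p∪q⁻; x∈⁅x⁆; x∈⁅y⁆⇒x≡y; ∈⊤; ∣⊤∣≡n; x∈p⇒∣p-x∣<∣p∣; p⊂q⇒∣p∣<∣q∣)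
open import Data.Integer.Base as ℤ using (+_)
import Data.Integer.Properties as ℤ
open import Data.List.Base as List using (List; []; _∷_)
import Data.Nat.Base as ℕ
open import Data.Nat.Base using (ℕ; zero; suc; NonZero; ∣_-_∣; z≤n; s≤s)
import Data.Nat.Properties as ℕ
open import Data.Product.Base using (∃; ∃₂; _×_; _,_; proj₁; proj₂)
import Data.Rational.Base as ℚ
open import Data.Rational.Base using (ℚ; 0ℚ; 1ℚ)
import Data.Rational.Properties as ℚ
import Data.Rational.Unnormalised.Base as ℚᵘ
import Data.Rational.Unnormalised.Properties as ℚᵘ
open import Data.Sum.Base using (_⊎_; inj₁; inj₂)
import Data.Unit.Base as Unit
open import Data.Vec.Base using (Vec; []; _∷_; tabulate)
open import Data.Vec.Properties using (lookup∘tabulate; []=⇒lookup; lookup⇒[]=)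
open import Function.Base using (_∘_)
open import Function.Definitions using (Injective)
open import Level using (0ℓ)
open import Relation.Binary.Core using (Rel)
open import Relation.Binary.Definitions using (Symmetric; Decidable; tri<; tri≈; tri>)
open import Relation.Binary.PropositionalEquality
  using (_≡_; _≢_; refl; sym; trans; cong; cong₂; subst; subst₂; module ≡-Reasoning)
open import Relation.Nullary.Decidable
  using (Dec; does; yes; no; ¬?; _×-dec_; _⊎-dec_; _→-dec_; dec-true; dec-false)
open import Relation.Nullary.Negation using (¬_; contradiction)
import Relation.Unary as Unary

open import Algebra.Properties.CommutativeMonoid.Sum ℕ.+-0-commutativeMonoid using (sum)
open import Algebra.Properties.Group ℚ.+-0-group using (⁻¹-anti-homo-//)

private variable
  n k : ℕ

IsLeast : (ℕ → Set) → ℕ → Set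
IsLeast P m = P m × (∀ j → P j → m ℕ.≤ j)

least : {P : ℕ → Set} → Unary.Decidable P → ∀ m → P m → ∃ (IsLeast P)
least P? zero    p = zero , p , λ _ _ → z≤n
least P? (suc m) p with P? zero
... | yes p₀ = zero , p₀ , λ _ _ → z≤n
... | no ¬p₀ with least (P? ∘ suc) m p
...   | l , pl , min = suc l , pl , λ where
          zero    p₀ → contradiction p₀ ¬p₀
          (suc j) pj → s≤s (min j pj)

-- A permutation π maps nodes to positions, both numbered from 0; so
-- π ∘ₚ transpose i j swaps the nodes at positions i and j.

SwapPath : ℕ → Permutation′ n → Permutation′ n → Set
SwapPath zero    π ρ = π ≈ ρ
SwapPath (suc k) π ρ =
  ∃₂ λ i j → toℕ j ≡ suc (toℕ i) × SwapPath k (π ∘ₚ transpose i j) ρ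

swapPath? : ∀ k (π ρ : Permutation′ n) → Dec (SwapPath k π ρ)
swapPath? zero    π ρ = all? λ x → (π ⟨$⟩ʳ x) ≟ (ρ ⟨$⟩ʳ x)
swapPath? (suc k) π ρ = any? λ i → any? λ j →
  (toℕ j ℕ.≟ suc (toℕ i)) ×-dec swapPath? k (π ∘ₚ transpose i j) ρ

transpose-left : ∀ (i j : Fin n) → transpose i j ⟨$⟩ʳ i ≡ j
transpose-left i j rewrite dec-true (i ≟ i) refl = refl

transpose-right : ∀ (i j : Fin n) → transpose i j ⟨$⟩ʳ j ≡ i
transpose-right i j with j ≟ i
... | yes j≡i = j≡i
... | no _ rewrite dec-true (j ≟ j) refl = refl

transpose-other : ∀ (i j : Fin n) {x} → x ≢ i → x ≢ j → transpose i j ⟨$⟩ʳ x ≡ x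
transpose-other i j {x} x≢i x≢j
  rewrite dec-false (x ≟ i) x≢i | dec-false (x ≟ j) x≢j = refl

Reachable : Rel (Permutation′ n) 0ℓ
Reachable π ρ = ∃ λ k → SwapPath k π ρ

SwapPath-respˡ : ∀ k {π π′ ρ : Permutation′ n} → π ≈ π′ → SwapPath k π′ ρ → SwapPath k π ρ
SwapPath-respˡ zero    e p = λ x → trans (e x) (p x)
SwapPath-respˡ (suc k) e (i , j , a , p) =
  i , j , a , SwapPath-respˡ k (λ x → cong (transpose i j ⟨$⟩ʳ_) (e x)) p

Reachable-trans : ∀ {π ρ τ : Permutation′ n} → Reachable π ρ → Reachable ρ τ → Reachable π τ
Reachable-trans (zero  , e) (l , q) = l , SwapPath-respˡ l e q
Reachable-trans (suc k , i , j , a , p) r with Reachable-trans (k , p) r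
... | l , q = suc l , i , j , a , q

reach-adjacent : ∀ (π : Permutation′ n) i j → toℕ j ≡ suc (toℕ i) → Reachable π (π ∘ₚ transpose i j)
reach-adjacent π i j a = 1 , i , j , a , λ _ → refl

conjugate : ∀ (i h j : Fin n) → i ≢ h → h ≢ j → i ≢ j →
            (transpose h j ∘ₚ transpose i h ∘ₚ transpose h j) ≈ transpose i j
conjugate i h j i≢h h≢j i≢j x = go (x ≟ i) (x ≟ h) (x ≟ j)
  where
  T : Fin _ → Fin _ → Fin _ → Fin _
  T a b y = transpose a b ⟨$⟩ʳ y
  go : Dec (x ≡ i) → Dec (x ≡ h) → Dec (x ≡ j) → T h j (T i h (T h j x)) ≡ T i j x
  go (yes refl) _ _
    rewrite transpose-other h j {i} i≢h i≢j | transpose-left i h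
          | transpose-left h j | transpose-left i j = refl
  go (no x≢i) (yes refl) _
    rewrite transpose-left h j | transpose-other i h {j} (i≢j ∘ sym) (h≢j ∘ sym)
          | transpose-right h j | transpose-other i j {h} (i≢h ∘ sym) h≢j = refl
  go (no x≢i) (no x≢h) (yes refl)
    rewrite transpose-right h j | transpose-right i h
          | transpose-other h j {i} i≢h i≢j | transpose-right i j = refl
  go (no x≢i) (no x≢h) (no x≢j)
    rewrite transpose-other h j x≢h x≢j | transpose-other i h x≢i x≢h
          | transpose-other h j x≢h x≢j | transpose-other i j x≢i x≢j = refl

reach-upward : ∀ d (π : Permutation′ n) (i j : Fin n) → toℕ j ≡ suc d ℕ.+ toℕ i →
               Reachable π (π ∘ₚ transpose i j)
reach-upward zero    π i j e = reach-adjacent π i j e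
reach-upward {n} (suc d) π i j e =
  Reachable-trans (reach-adjacent π h j h-adj)
    (Reachable-trans (reach-upward d (π ∘ₚ transpose h j) i h h-eq)
      (Reachable-trans (reach-adjacent _ h j h-adj)
        (0 , λ x → conjugate i h j i≢h h≢j i≢j (π ⟨$⟩ʳ x))))
  where
  h<n : suc d ℕ.+ toℕ i ℕ.< n
  h<n = ℕ.<-trans (ℕ.n<1+n _) (subst (ℕ._< n) e (toℕ<n j))
  h : Fin n
  h = fromℕ< h<n
  h-eq : toℕ h ≡ suc d ℕ.+ toℕ i
  h-eq = toℕ-fromℕ< h<n
  h-adj : toℕ j ≡ suc (toℕ h)
  h-adj = trans e (cong suc (sym h-eq))
  i≢h : i ≢ h
  i≢h p = ℕ.m≢1+n+m (toℕ i) (trans (cong toℕ p) h-eq)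
  h≢j : h ≢ j
  h≢j p = ℕ.1+n≢n (sym (trans (cong toℕ p) h-adj))
  i≢j : i ≢ j
  i≢j p = ℕ.m≢1+n+m (toℕ i) (trans (cong toℕ p) e)

transpose-comm : ∀ (i j : Fin n) → transpose i j ≈ transpose j i
transpose-comm i j x = go (x ≟ i) (x ≟ j)
  where
  go : Dec (x ≡ i) → Dec (x ≡ j) → transpose i j ⟨$⟩ʳ x ≡ transpose j i ⟨$⟩ʳ x
  go (yes refl) _          = trans (transpose-left i j) (sym (transpose-right j i))
  go (no _)     (yes refl) = trans (transpose-right i j) (sym (transpose-left j i))
  go (no x≢i)   (no x≢j)   = trans (transpose-other i j x≢i x≢j) (sym (transpose-other j i x≢j x≢i))

gap : ∀ {i j : Fin n} → i < j → toℕ j ≡ suc (toℕ j ℕ.∸ suc (toℕ i)) ℕ.+ toℕ i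
gap {i = i} i<j = trans (sym (ℕ.m∸n+n≡m i<j)) (ℕ.+-suc _ (toℕ i))

reach-transpose : ∀ (π : Permutation′ n) i j → Reachable π (π ∘ₚ transpose i j)
reach-transpose π i j with <-cmp i j
... | tri< i<j _ _ = reach-upward _ π i j (gap i<j)
... | tri> _ _ j<i = Reachable-trans (reach-upward _ π j i (gap j<i))
                       (0 , λ x → transpose-comm j i (π ⟨$⟩ʳ x))
... | tri≈ _ refl _ = 0 , λ x → sym (transpose-self (π ⟨$⟩ʳ x))
  where
  transpose-self : ∀ x → transpose i i ⟨$⟩ʳ x ≡ x
  transpose-self x with x ≟ i
  ... | yes x≡i = sym x≡i
  ... | no x≢i with x ≟ i
  ...   | yes x≡i = contradiction x≡i x≢i
  ...   | no _    = refl

reach-eval : ∀ (π : Permutation′ n) (ts : TranspositionList n) → Reachable π (π ∘ₚ eval ts)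
reach-eval π []             = 0 , λ _ → refl
reach-eval π ((i , j) ∷ ts) =
  Reachable-trans (reach-transpose π i j)
    (Reachable-trans (reach-eval (π ∘ₚ transpose i j) ts) (0 , λ _ → refl))

reachable : ∀ (π ρ : Permutation′ n) → Reachable π ρ
reachable π ρ = Reachable-trans (reach-eval π (decompose (flip π ∘ₚ ρ)))
  (0 , λ x → trans (eval-decompose (flip π ∘ₚ ρ) (π ⟨$⟩ʳ x)) (cong (ρ ⟨$⟩ʳ_) (inverseˡ π)))

leastSwaps : ∀ (π ρ : Permutation′ n) → ∃ (IsLeast λ k → SwapPath k π ρ)
leastSwaps π ρ = let k , p = reachable π ρ in least (λ l → swapPath? l π ρ) k p

kendallTau : Permutation′ n → Permutation′ n → ℕ
kendallTau π ρ = proj₁ (leastSwaps π ρ)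

record Graph (n : ℕ) : Set₁ where
  field
    Edge   : Rel (Fin n) 0ℓ
    edge?  : Decidable Edge
    sym-E  : Symmetric Edge
    irrefl : ∀ {x} → ¬ Edge x x

open Graph

emptyGraph : Graph n
emptyGraph .Edge _ _  = Empty.⊥
emptyGraph .edge? _ _ = no λ ()
emptyGraph .sym-E ()
emptyGraph .irrefl ()

-- Only pairs x < y are summed, so that each edge counts once.
arrangementCost : Graph n → Permutation′ n → ℕ
arrangementCost G π = sum λ x → sum λ y →
  if does ((x <? y) ×-dec edge? G x y)
  then ∣ toℕ (π ⟨$⟩ʳ x) - toℕ (π ⟨$⟩ʳ y) ∣
  else 0

IsMinLA : Graph n → Permutation′ n → Set
IsMinLA G π = ∀ ρ → arrangementCost G π ℕ.≤ arrangementCost G ρ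

-- X is the node set of one of the cliques whose disjoint union is G: a
-- connected component that is complete.
record IsCliqueOf (G : Graph n) (X : Subset n) : Set where
  field
    nonempty : Nonempty X
    complete : ∀ {x y} → x ∈ X → y ∈ X → x ≢ y → Edge G x y
    isolated : ∀ {x y} → x ∈ X → y ∉ X → ¬ Edge G x y

open IsCliqueOf

IsDisjointUnionOfCliques : Graph n → Set
IsDisjointUnionOfCliques G = ∀ x → ∃ λ X → x ∈ X × IsCliqueOf G X

mergeCliques : Graph n → Subset n → Subset n → Graph n
mergeCliques G X Z .Edge x y = Edge G x y ⊎ (x ≢ y × x ∈ X ∪ Z × y ∈ X ∪ Z)
mergeCliques G X Z .edge? x y =
  edge? G x y ⊎-dec (¬? (x ≟ y) ×-dec (x ∈? X ∪ Z) ×-dec (y ∈? X ∪ Z))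
mergeCliques G X Z .sym-E (inj₁ e)               = inj₁ (sym-E G e)
mergeCliques G X Z .sym-E (inj₂ (x≢y , x∈ , y∈)) = inj₂ (x≢y ∘ sym , y∈ , x∈)
mergeCliques G X Z .irrefl (inj₁ e)        = irrefl G e
mergeCliques G X Z .irrefl (inj₂ (x≢x , _)) = x≢x refl

-- Sequences G = G₀, …, Gₖ in which each graph arises from the previous
-- one by merging two of its cliques.
data Merges {n} : Graph n → ℕ → Set₁ where
  []     : ∀ {G} → Merges G 0
  reveal : ∀ {G} (X Z : Subset n) → IsCliqueOf G X → IsCliqueOf G Z → X ≢ Z →
           Merges (mergeCliques G X Z) k → Merges G (suc k)

-- Merging keeps the graph a disjoint union of cliques, so this holds of
-- all graphs of a sequence that starts with the edgeless graph.
emptyGraph-isDisjointUnionOfCliques : IsDisjointUnionOfCliques (emptyGraph {n})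
emptyGraph-isDisjointUnionOfCliques x = ⁅ x ⁆ , x∈⁅x⁆ x , record
  { nonempty = x , x∈⁅x⁆ x
  ; complete = λ y∈ z∈ y≢z → y≢z (trans (x∈⁅y⁆⇒x≡y x y∈) (sym (x∈⁅y⁆⇒x≡y x z∈)))
  ; isolated = λ _ _ ()
  }

mergeCliques-isDisjointUnionOfCliques :
  ∀ {G : Graph n} {X Z} → IsCliqueOf G X → IsCliqueOf G Z →
  IsDisjointUnionOfCliques G → IsDisjointUnionOfCliques (mergeCliques G X Z)
mergeCliques-isDisjointUnionOfCliques {G = G} {X} {Z} cX cZ cliques x with x ∈? X ∪ Z
... | yes x∈ = X ∪ Z , x∈ , record
  { nonempty = x , x∈
  ; complete = λ y∈ z∈ y≢z → inj₂ (y≢z , y∈ , z∈)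
  ; isolated = λ where
      y∈ z∉ (inj₁ e)            → outsideEdge y∈ z∉ e
      y∈ z∉ (inj₂ (_ , _ , z∈)) → z∉ z∈
  }
  where
  outsideEdge : ∀ {y z} → y ∈ X ∪ Z → z ∉ X ∪ Z → ¬ Edge G y z
  outsideEdge y∈ z∉ e with x∈p∪q⁻ X Z y∈
  ... | inj₁ y∈X = isolated cX y∈X (z∉ ∘ x∈p∪q⁺ ∘ inj₁) e
  ... | inj₂ y∈Z = isolated cZ y∈Z (z∉ ∘ x∈p∪q⁺ ∘ inj₂) e
... | no x∉ with cliques x
...   | Y , x∈Y , cY = Y , x∈Y , record
  { nonempty = x , x∈Y
  ; complete = λ y∈ z∈ y≢z → inj₁ (complete cY y∈ z∈ y≢z)
  ; isolated = λ where
      y∈ z∉ (inj₁ e)              → isolated cY y∈ z∉ e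
      y∈ z∉ (inj₂ (_ , y∈XZ , _)) → disjoint y∈ y∈XZ
  }
  where
  joins : ∀ {W} → IsCliqueOf G W → ∀ {y} → y ∈ Y → y ∈ W → x ∈ W
  joins {W} cW {y} y∈Y y∈W with x ∈? W
  ... | yes x∈W = x∈W
  ... | no x∉W = contradiction (complete cY y∈Y x∈Y λ { refl → x∉W y∈W }) (isolated cW y∈W x∉W)
  disjoint : ∀ {y} → y ∈ Y → ¬ (y ∈ X ∪ Z)
  disjoint y∈Y y∈XZ with x∈p∪q⁻ X Z y∈XZ
  ... | inj₁ y∈X = x∉ (x∈p∪q⁺ (inj₁ (joins cX y∈Y y∈X)))
  ... | inj₂ y∈Z = x∉ (x∈p∪q⁺ (inj₂ (joins cZ y∈Y y∈Z)))

record CliqueInstance (n : ℕ) : Set₁ where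
  field
    π₀     : Permutation′ n
    steps  : ℕ
    merges : Merges (emptyGraph {n}) steps

open CliqueInstance

Feasible : ∀ {G : Graph n} → Merges G k → Vec (Permutation′ n) k → Set
Feasible []                           []       = Unit.⊤
Feasible (reveal {G = G} X Z _ _ _ σ) (π ∷ πs) = IsMinLA (mergeCliques G X Z) π × Feasible σ πs

cost : Permutation′ n → Vec (Permutation′ n) k → ℕ
cost π []        = 0
cost π (π′ ∷ πs) = kendallTau π π′ ℕ.+ cost π′ πs

IsOpt : CliqueInstance n → ℕ → Set
IsOpt σ = IsLeast λ c → ∃ λ πs → Feasible (merges σ) πs × cost (π₀ σ) πs ≡ c

below : ∀ {m} → (Fin n → Fin m) → Fin n → Subset n
below key x = tabulate λ y → does (key y <? key x)

∈below⁺ : ∀ {m} (key : Fin n → Fin m) {x y} → key y < key x → y ∈ below key x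
∈below⁺ key {x} {y} lt = lookup⇒[]= y _ (trans (lookup∘tabulate _ y) (dec-true (key y <? key x) lt))

∈below⁻ : ∀ {m} (key : Fin n → Fin m) {x y} → y ∈ below key x → key y < key x
∈below⁻ key {x} {y} y∈ = go (key y <? key x) (trans (sym (lookup∘tabulate _ y)) ([]=⇒lookup y∈))
  where
  go : ∀ {P : Set} (P? : Dec P) → does P? ≡ true → P
  go (yes p) _ = p

below-mono : ∀ {m} (key : Fin n → Fin m) {x y} → key x < key y → ∣ below key x ∣ ℕ.< ∣ below key y ∣
below-mono key {x} {y} lt = p⊂q⇒∣p∣<∣q∣
  ( (λ z∈ → ∈below⁺ key (ℕ.<-trans (∈below⁻ key z∈) lt))
  , x , ∈below⁺ key lt , λ x∈ → ℕ.<-irrefl refl (∈below⁻ key x∈))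

∣below∣<n : ∀ {m} (key : Fin n → Fin m) x → ∣ below key x ∣ ℕ.< n
∣below∣<n {n} key x = subst (∣ below key x ∣ ℕ.<_) (∣⊤∣≡n n) (p⊂q⇒∣p∣<∣q∣
  ((λ _ → ∈⊤) , x , ∈⊤ , λ x∈ → ℕ.<-irrefl refl (∈below⁻ key x∈)))

rank : ∀ {m} → (Fin n → Fin m) → Fin n → Fin n
rank key x = fromℕ< (∣below∣<n key x)

rank-injective : ∀ {m} (key : Fin n → Fin m) → Injective _≡_ _≡_ key → Injective _≡_ _≡_ (rank key)
rank-injective key inj {x} {y} eq with <-cmp (key x) (key y)
... | tri≈ _ e _ = inj e
... | tri< lt _ _ = contradiction (fromℕ<-injective _ _ _ _ eq) (ℕ.<⇒≢ (below-mono key lt))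
... | tri> _ _ gt = contradiction (sym (fromℕ<-injective _ _ _ _ eq)) (ℕ.<⇒≢ (below-mono key gt))

preimage : (f : Fin n → Fin n) → Injective _≡_ _≡_ f → ∀ y → ∃ λ x → f x ≡ y
preimage {suc n} f inj y with any? (λ x → f x ≟ y)
... | yes found = found
... | no ¬found = contradiction
  (injective⇒≤ {f = λ x → punchOut (avoid x)} λ e → inj (punchOut-injective (avoid _) (avoid _) e))
  ℕ.1+n≰n
  where
  avoid : ∀ x → y ≢ f x
  avoid x e = ¬found (x , sym e)

sortBy : ∀ {m} (key : Fin n → Fin m) → Injective _≡_ _≡_ key → Permutation′ n
sortBy key inj = permutation (rank key) (proj₁ ∘ pre) (proj₂ ∘ pre)
  (λ x → rank-injective key inj (proj₂ (pre (rank key x))))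
  where pre = preimage (rank key) (rank-injective key inj)

Precedes : Permutation′ n → Fin n → Subset n → Set
Precedes π x A = ∀ y → y ∈ A → π ⟨$⟩ʳ x < π ⟨$⟩ʳ y

Follows : Permutation′ n → Fin n → Subset n → Set
Follows π x A = ∀ y → y ∈ A → π ⟨$⟩ʳ y < π ⟨$⟩ʳ x

precedes? : ∀ (π : Permutation′ n) x A → Dec (Precedes π x A)
precedes? π x A = all? λ y → (y ∈? A) →-dec ((π ⟨$⟩ʳ x) <? (π ⟨$⟩ʳ y))

follows? : ∀ (π : Permutation′ n) x A → Dec (Follows π x A)
follows? π x A = all? λ y → (y ∈? A) →-dec ((π ⟨$⟩ʳ y) <? (π ⟨$⟩ʳ x))

IsLeftOf : Permutation′ n → Subset n → Subset n → Set
IsLeftOf π X Z = ∀ x → x ∈ X → Precedes π x Z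

isLeftOf? : ∀ (π : Permutation′ n) X Z → Dec (IsLeftOf π X Z)
isLeftOf? π X Z = all? λ x → (x ∈? X) →-dec precedes? π x Z

-- After the move, X stands next to Z on the side of Z that X comes from.
-- So every node outside X ends up left of X (slot 0) or right of X
-- (slot 2): if X comes from the left, slot 0 holds the nodes left of Z;
-- otherwise slot 2 holds the nodes right of Z.
slot : Permutation′ n → Subset n → Subset n → Fin n → Fin 3
slot π X Z y =
  if does (y ∈? X) then 1F
  else if does (isLeftOf? π X Z)
    then (if does (precedes? π y Z) then 0F else 2F)
    else (if does (follows? π y Z) then 2F else 0F)

-- combine is lexicographic: nodes are sorted by slot and, within a slot,
-- keep the order they have in π.
moveTowards : Subset n → Subset n → Permutation′ n → Permutation′ n
moveTowards X Z π =
  sortBy (λ y → combine (slot π X Z y) (π ⟨$⟩ʳ y)) λ {x} {y} e →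
    trans (sym (inverseˡ π))
      (trans (cong (π ⟨$⟩ˡ_) (combine-injectiveʳ (slot π X Z x) _ (slot π X Z y) _ e)) (inverseˡ π))

-- Finitely supported probability distributions, as lists of outcomes
-- with their probabilities; an outcome may be listed repeatedly.
Dist : Set → Set
Dist A = List (ℚ × A)

return : ∀ {A} → A → Dist A
return a = (1ℚ , a) ∷ []

infixl 1 _>>=_
_>>=_ : ∀ {A B} → Dist A → (A → Dist B) → Dist B
μ >>= f = List.concatMap (λ (p , a) → List.map (λ (q , b) → p ℚ.* q , b) (f a)) μ

𝔼 : ∀ {A} → Dist A → (A → ℚ) → ℚ
𝔼 μ f = List.foldr (λ (p , a) e → p ℚ.* f a ℚ.+ e) 0ℚ μ

fromℕ : ℕ → ℚ
fromℕ m = + m ℚ./ 1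

nonempty⇒nonZero : ∀ {X : Subset n} → Nonempty X → NonZero ∣ X ∣
nonempty⇒nonZero (_ , x∈X) = ℕ.>-nonZero (ℕ.≤-<-trans z≤n (x∈p⇒∣p-x∣<∣p∣ x∈X))

Rand : Permutation′ n → ∀ {G : Graph n} → Merges G k → Dist (Vec (Permutation′ n) k)
Rand π []                     = return []
Rand π (reveal X Z cX cZ _ σ) = do
  π′ ← (+ ∣ Z ∣ ℚ./ (∣ X ∣ ℕ.+ ∣ Z ∣) , moveTowards X Z π)
     ∷ (+ ∣ X ∣ ℚ./ (∣ X ∣ ℕ.+ ∣ Z ∣) , moveTowards Z X π)
     ∷ []
  πs ← Rand π′ σ
  return (π′ ∷ πs)
  where instance
    total : NonZero (∣ X ∣ ℕ.+ ∣ Z ∣)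
    total = ℕ.>-nonZero (ℕ.<-≤-trans (ℕ.>-nonZero⁻¹ ∣ X ∣ {{nonempty⇒nonZero (nonempty cX)}}) (ℕ.m≤m+n ∣ X ∣ ∣ Z ∣))

expectedCost : CliqueInstance n → ℚ
expectedCost σ = 𝔼 (Rand (π₀ σ) (merges σ)) (λ πs → fromℕ (cost (π₀ σ) πs))

-- Reals as Cauchy sequences of rationals.
record ℝ : Set where
  field
    approx : ℕ → ℚ
    cauchy : ∀ ε → 0ℚ ℚ.< ε → ∃ λ N → ∀ i j → N ℕ.≤ i → N ℕ.≤ j →
             ℚ.∣ approx i ℚ.- approx j ∣ ℚ.≤ ε

open ℝ

infix 4 _≤ᴿ_
_≤ᴿ_ : ℝ → ℝ → Set
x ≤ᴿ y = ∀ ε → 0ℚ ℚ.< ε → ∃ λ N → ∀ i → N ℕ.≤ i → approx x i ℚ.≤ approx y i ℚ.+ ε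

fromℚ : ℚ → ℝ
fromℚ q .approx _ = q
fromℚ q .cauchy ε 0<ε = 0 , λ _ _ _ _ →
  subst (λ z → ℚ.∣ z ∣ ℚ.≤ ε) (sym (ℚ.+-inverseʳ q)) (ℚ.<⇒≤ 0<ε)

infixl 7 _·_
_·_ : ℕ → ℝ → ℝ
(c · x) .approx i = fromℕ c ℚ.* approx x i
(c · x) .cauchy ε 0<ε = N , λ i j N≤i N≤j → begin
    ℚ.∣ C ℚ.* approx x i ℚ.- C ℚ.* approx x j ∣   ≡⟨ cong ℚ.∣_∣ (factor (approx x i) (approx x j)) ⟩
    ℚ.∣ C ℚ.* (approx x i ℚ.- approx x j) ∣       ≡⟨ ℚ.∣p*q∣≡∣p∣*∣q∣ C _ ⟩
    ℚ.∣ C ∣ ℚ.* ℚ.∣ approx x i ℚ.- approx x j ∣   ≡⟨ cong (ℚ._* _) (ℚ.0≤p⇒∣p∣≡p (ℚ.nonNegative⁻¹ C)) ⟩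
    C ℚ.* ℚ.∣ approx x i ℚ.- approx x j ∣         ≤⟨ ℚ.*-monoˡ-≤-nonNeg C (close i j N≤i N≤j) ⟩
    C ℚ.* (δ ℚ.* ε)                               ≡⟨ ℚ.*-assoc C δ ε ⟨
    (C ℚ.* δ) ℚ.* ε                               ≤⟨ ℚ.*-monoʳ-≤-nonNeg ε Cδ≤1 ⟩
    1ℚ ℚ.* ε                                      ≡⟨ ℚ.*-identityˡ ε ⟩
    ε                                             ∎
  where
  open ℚ.≤-Reasoning
  C δ : ℚ
  C = fromℕ c
  δ = + 1 ℚ./ suc c
  instance
    C≥0 : ℚ.NonNegative C
    C≥0 = ℚ.normalize-nonNeg c 1
    ε>0 : ℚ.Positive ε
    ε>0 = ℚ.positive 0<ε
    ε≥0 : ℚ.NonNegative ε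
    ε≥0 = ℚ.pos⇒nonNeg ε
    δ>0 : ℚ.Positive δ
    δ>0 = ℚ.normalize-pos 1 (suc c)
  0<δε : 0ℚ ℚ.< δ ℚ.* ε
  0<δε = ℚ.positive⁻¹ (δ ℚ.* ε) {{ℚ.pos*pos⇒pos δ ε}}
  N = proj₁ (cauchy x (δ ℚ.* ε) 0<δε)
  close = proj₂ (cauchy x (δ ℚ.* ε) 0<δε)
  factor : ∀ p q → C ℚ.* p ℚ.- C ℚ.* q ≡ C ℚ.* (p ℚ.- q)
  factor p q = trans (cong (C ℚ.* p ℚ.+_) (ℚ.neg-distribʳ-* C q)) (sym (ℚ.*-distribˡ-+ C p (ℚ.- q)))
  Cδ≤1 : C ℚ.* δ ℚ.≤ 1ℚ
  Cδ≤1 = ℚ.toℚᵘ-cancel-≤ (ℚᵘ.≤-respˡ-≃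
    (ℚᵘ.≃-sym (ℚᵘ.≃-trans (ℚ.toℚᵘ-homo-* C δ)
      (ℚᵘ.*-cong (ℚ.toℚᵘ-fromℚᵘ (ℚᵘ.mkℚᵘ (+ c) 0)) (ℚ.toℚᵘ-fromℚᵘ (ℚᵘ.mkℚᵘ (+ 1) c)))))
    (ℚᵘ.*≤* (subst₂ ℤ._≤_ (sym (trans (ℤ.*-identityʳ _) (ℤ.*-identityʳ (+ c))))
                           (sym (trans (ℤ.*-identityˡ _) (cong +_ (ℕ.*-identityˡ (suc c)))))
                           (ℤ.+≤+ (ℕ.n≤1+n c)))))

∑< : ℕ → (ℕ → ℚ) → ℚ
∑< zero    f = 0ℚ
∑< (suc N) f = ∑< N f ℚ.+ f N

-- With M = m + 1, this is the lower Riemann sum of ∫₁ⁿ dx/x for mesh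
-- 1/M: the i-th term is (1/M) · 1/(1 + (i+1)/M) = 1/(M + i + 1).
lnApprox : ℕ → ℕ → ℚ
lnApprox n m = ∑< ((n ℕ.∸ 1) ℕ.* suc m) λ i → + 1 ℚ./ (suc m ℕ.+ suc i)

fromℚᵘ-homo-+ : ∀ u v → ℚ.fromℚᵘ u ℚ.+ ℚ.fromℚᵘ v ≡ ℚ.fromℚᵘ (u ℚᵘ.+ v)
fromℚᵘ-homo-+ u v = ℚ.toℚᵘ-injective (ℚᵘ.≃-trans (ℚ.toℚᵘ-homo-+ (ℚ.fromℚᵘ u) (ℚ.fromℚᵘ v))
  (ℚᵘ.≃-trans (ℚᵘ.+-cong (ℚ.toℚᵘ-fromℚᵘ u) (ℚ.toℚᵘ-fromℚᵘ v)) (ℚᵘ.≃-sym (ℚ.toℚᵘ-fromℚᵘ (u ℚᵘ.+ v)))))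

fromℚᵘ-homo-* : ∀ u v → ℚ.fromℚᵘ u ℚ.* ℚ.fromℚᵘ v ≡ ℚ.fromℚᵘ (u ℚᵘ.* v)
fromℚᵘ-homo-* u v = ℚ.toℚᵘ-injective (ℚᵘ.≃-trans (ℚ.toℚᵘ-homo-* (ℚ.fromℚᵘ u) (ℚ.fromℚᵘ v))
  (ℚᵘ.≃-trans (ℚᵘ.*-cong (ℚ.toℚᵘ-fromℚᵘ u) (ℚ.toℚᵘ-fromℚᵘ v)) (ℚᵘ.≃-sym (ℚ.toℚᵘ-fromℚᵘ (u ℚᵘ.* v)))))

∑<-cong : ∀ N {f g : ℕ → ℚ} → (∀ i → f i ≡ g i) → ∑< N f ≡ ∑< N g
∑<-cong zero    e = refl
∑<-cong (suc N) e = cong₂ ℚ._+_ (∑<-cong N e) (e N)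

∑<-mono : ∀ N {f g : ℕ → ℚ} → (∀ i → i ℕ.< N → f i ℚ.≤ g i) → ∑< N f ℚ.≤ ∑< N g
∑<-mono zero    le = ℚ.≤-refl
∑<-mono (suc N) le = ℚ.+-mono-≤ (∑<-mono N λ i i<N → le i (ℕ.m<n⇒m<1+n i<N)) (le N ℕ.≤-refl)

∑<-shift : ∀ N f → ∑< (suc N) f ≡ f 0 ℚ.+ ∑< N (λ i → f (suc i))
∑<-shift zero    f = ℚ.+-comm 0ℚ (f 0)
∑<-shift (suc N) f = trans (cong (ℚ._+ f (suc N)) (∑<-shift N f)) (ℚ.+-assoc (f 0) _ _)

∑<-+ : ∀ M N f → ∑< (N ℕ.+ M) f ≡ ∑< M f ℚ.+ ∑< N (λ i → f (i ℕ.+ M))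
∑<-+ M zero    f = sym (ℚ.+-identityʳ _)
∑<-+ M (suc N) f = trans (cong (ℚ._+ f (N ℕ.+ M)) (∑<-+ M N f)) (ℚ.+-assoc (∑< M f) _ _)

∑<-* : ∀ M N f → ∑< (M ℕ.* N) f ≡ ∑< M (λ i → ∑< N (λ r → f (r ℕ.+ i ℕ.* N)))
∑<-* zero    N f = refl
∑<-* (suc M) N f = trans (∑<-+ (M ℕ.* N) N f) (cong (ℚ._+ ∑< N (λ r → f (r ℕ.+ M ℕ.* N))) (∑<-* M N f))

∑<-const : ∀ N q → ∑< N (λ _ → q) ≡ fromℕ N ℚ.* q
∑<-const zero    q = sym (ℚ.*-zeroˡ q)
∑<-const (suc N) q = begin
  ∑< N (λ _ → q) ℚ.+ q          ≡⟨ cong (ℚ._+ q) (∑<-const N q) ⟩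
  fromℕ N ℚ.* q ℚ.+ q           ≡⟨ cong (fromℕ N ℚ.* q ℚ.+_) (ℚ.*-identityˡ q) ⟨
  fromℕ N ℚ.* q ℚ.+ 1ℚ ℚ.* q    ≡⟨ ℚ.*-distribʳ-+ q (fromℕ N) 1ℚ ⟨
  (fromℕ N ℚ.+ 1ℚ) ℚ.* q        ≡⟨ cong (ℚ._* q) fromℕ-suc ⟩
  fromℕ (suc N) ℚ.* q           ∎
  where
  open ≡-Reasoning
  fromℕ-suc : fromℕ N ℚ.+ 1ℚ ≡ fromℕ (suc N)
  fromℕ-suc = trans (fromℚᵘ-homo-+ (ℚᵘ.mkℚᵘ (+ N) 0) (ℚᵘ.mkℚᵘ (+ 1) 0))
    (ℚ.fromℚᵘ-cong {ℚᵘ.mkℚᵘ (+ N) 0 ℚᵘ.+ ℚᵘ.mkℚᵘ (+ 1) 0} {ℚᵘ.mkℚᵘ (+ suc N) 0}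
      (ℚᵘ.*≡* (cong (ℤ._* + 1) (trans (cong (ℤ._+ + 1) (ℤ.*-identityʳ (+ N)))
                                      (cong +_ (ℕ.+-comm N 1))))))

1/-anti : ∀ a b .{{_ : NonZero a}} .{{_ : NonZero b}} → a ℕ.≤ b → + 1 ℚ./ b ℚ.≤ + 1 ℚ./ a
1/-anti (suc a) (suc b) a≤b = ℚ.toℚᵘ-cancel-≤
  (ℚᵘ.≤-respˡ-≃ (ℚᵘ.≃-sym (ℚ.toℚᵘ-fromℚᵘ (ℚᵘ.mkℚᵘ (+ 1) b)))
  (ℚᵘ.≤-respʳ-≃ (ℚᵘ.≃-sym (ℚ.toℚᵘ-fromℚᵘ (ℚᵘ.mkℚᵘ (+ 1) a)))
  (ℚᵘ.*≤* (subst₂ ℤ._≤_ (sym (ℤ.*-identityˡ _)) (sym (ℤ.*-identityˡ _)) (ℤ.+≤+ a≤b)))))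

1/-scale : ∀ N a .{{_ : NonZero N}} .{{_ : NonZero a}} .{{_ : NonZero (a ℕ.* N)}} →
           fromℕ N ℚ.* (+ 1 ℚ./ (a ℕ.* N)) ≡ + 1 ℚ./ a
1/-scale N@(suc N-1) a@(suc a-1) = trans
  (fromℚᵘ-homo-* (ℚᵘ.mkℚᵘ (+ N) 0) (ℚᵘ.mkℚᵘ (+ 1) (N-1 ℕ.+ a-1 ℕ.* N)))
  (ℚ.fromℚᵘ-cong {ℚᵘ.mkℚᵘ (+ N) 0 ℚᵘ.* ℚᵘ.mkℚᵘ (+ 1) (N-1 ℕ.+ a-1 ℕ.* N)} {ℚᵘ.mkℚᵘ (+ 1) a-1}
    (ℚᵘ.*≡* (begin
      + N ℤ.* + 1 ℤ.* + a          ≡⟨ cong (ℤ._* + a) (ℤ.*-identityʳ (+ N)) ⟩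
      + N ℤ.* + a                  ≡⟨ ℤ.pos-* N a ⟨
      + (N ℕ.* a)                  ≡⟨ cong +_ (trans (ℕ.*-comm N a) (sym (ℕ.*-identityˡ (a ℕ.* N)))) ⟩
      + (1 ℕ.* (a ℕ.* N))          ≡⟨ ℤ.*-identityˡ _ ⟨
      + 1 ℤ.* + (1 ℕ.* (a ℕ.* N))  ∎)))
  where open ≡-Reasoning

lnApprox-refineˡ : ∀ n m k → lnApprox n m ℚ.≤
  ∑< ((n ℕ.∸ 1) ℕ.* suc m ℕ.* suc k) (λ j → + 1 ℚ./ (suc m ℕ.* suc k ℕ.+ suc j))
lnApprox-refineˡ n m k = ℚ.≤-trans
  (∑<-mono N λ i _ → ℚ.≤-trans
    (ℚ.≤-reflexive (trans (sym (1/-scale K (M ℕ.+ suc i))) (sym (∑<-const K _))))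
    (∑<-mono K λ r r<K → 1/-anti (M ℕ.* K ℕ.+ suc (r ℕ.+ i ℕ.* K)) ((M ℕ.+ suc i) ℕ.* K) (bound i r r<K)))
  (ℚ.≤-reflexive (sym (∑<-* N K (λ j → + 1 ℚ./ (M ℕ.* K ℕ.+ suc j)))))
  where
  M = suc m
  K = suc k
  N = (n ℕ.∸ 1) ℕ.* M
  bound : ∀ i r → r ℕ.< K → M ℕ.* K ℕ.+ suc (r ℕ.+ i ℕ.* K) ℕ.≤ (M ℕ.+ suc i) ℕ.* K
  bound i r r<K = ℕ.≤-trans (ℕ.+-monoʳ-≤ (M ℕ.* K) (ℕ.+-monoˡ-≤ (i ℕ.* K) r<K))
    (ℕ.≤-reflexive (sym (ℕ.*-distribʳ-+ K M (suc i))))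

lnApprox-refineʳ : ∀ n m k →
  ∑< ((n ℕ.∸ 1) ℕ.* suc m ℕ.* suc k) (λ j → + 1 ℚ./ (suc m ℕ.* suc k ℕ.+ suc j)) ℚ.≤
  + 1 ℚ./ suc k ℚ.+ lnApprox n k
lnApprox-refineʳ n m k = begin
  ∑< (p ℕ.* M ℕ.* K) g                            ≡⟨ cong (λ J → ∑< J g) reorder ⟩
  ∑< (N ℕ.* M) g                                  ≡⟨ ∑<-* N M g ⟩
  ∑< N (λ i → ∑< M (λ r → g (r ℕ.+ i ℕ.* M)))     ≤⟨ ∑<-mono N (λ i _ → block i) ⟩
  ∑< N h                                          ≡⟨ ℚ.+-identityʳ _ ⟨
  ∑< N h ℚ.+ 0ℚ                                   ≤⟨ ℚ.+-monoʳ-≤ (∑< N h) (ℚ.nonNegative⁻¹ (h N) {{ℚ.normalize-nonNeg 1 (K ℕ.+ N)}}) ⟩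
  ∑< N h ℚ.+ h N                                  ≡⟨ ∑<-shift N h ⟩
  h 0 ℚ.+ lnApprox n k                            ≡⟨ cong (λ d → + 1 ℚ./ suc d ℚ.+ lnApprox n k) (ℕ.+-identityʳ k) ⟩
  + 1 ℚ./ K ℚ.+ lnApprox n k                      ∎
  where
  open ℚ.≤-Reasoning
  p = n ℕ.∸ 1
  M = suc m
  K = suc k
  N = p ℕ.* K
  g h : ℕ → ℚ
  g j = + 1 ℚ./ (M ℕ.* K ℕ.+ suc j)
  h i = + 1 ℚ./ (K ℕ.+ i)
  reorder : p ℕ.* M ℕ.* K ≡ p ℕ.* K ℕ.* M
  reorder = trans (ℕ.*-assoc p M K) (trans (cong (p ℕ.*_) (ℕ.*-comm M K)) (sym (ℕ.*-assoc p K M)))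
  bound : ∀ i r → (K ℕ.+ i) ℕ.* M ℕ.≤ M ℕ.* K ℕ.+ suc (r ℕ.+ i ℕ.* M)
  bound i r = ℕ.≤-trans
    (ℕ.≤-reflexive (trans (ℕ.*-distribʳ-+ M K i) (cong (ℕ._+ i ℕ.* M) (ℕ.*-comm K M))))
    (ℕ.+-monoʳ-≤ (M ℕ.* K) (ℕ.m≤n+m (i ℕ.* M) (suc r)))
  block : ∀ i → ∑< M (λ r → g (r ℕ.+ i ℕ.* M)) ℚ.≤ h i
  block i = ℚ.≤-trans
    (∑<-mono M λ r _ → 1/-anti ((K ℕ.+ i) ℕ.* M) (M ℕ.* K ℕ.+ suc (r ℕ.+ i ℕ.* M)) (bound i r))
    (ℚ.≤-reflexive (trans (∑<-const M _) (1/-scale M (K ℕ.+ i))))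

lnApprox-close : ∀ n m k → lnApprox n m ℚ.≤ + 1 ℚ./ suc k ℚ.+ lnApprox n k
lnApprox-close n m k = ℚ.≤-trans (lnApprox-refineˡ n m k) (lnApprox-refineʳ n m k)

1/-archimedean : ∀ ε → 0ℚ ℚ.< ε → ∃ λ N → ∀ k → N ℕ.≤ k → + 1 ℚ./ suc k ℚ.≤ ε
1/-archimedean ε 0<ε = ℚ.↧ₙ ε , λ k N≤k →
  ℚ.≤-trans (1/-anti (ℚ.↧ₙ ε) (suc k) (ℕ.m≤n⇒m≤1+n N≤k)) (unit ε (ℚ.positive 0<ε))
  where
  unit : ∀ q → ℚ.Positive q → + 1 ℚ./ ℚ.↧ₙ q ℚ.≤ q
  unit (ℚ.mkℚ (+ suc a) d _) _ = ℚ.toℚᵘ-cancel-≤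
    (ℚᵘ.≤-respˡ-≃ (ℚᵘ.≃-sym (ℚ.toℚᵘ-fromℚᵘ (ℚᵘ.mkℚᵘ (+ 1) d)))
      (ℚᵘ.*≤* (ℤ.*-monoʳ-≤-nonNeg (+ suc d) {+ 1} {+ suc a} (ℤ.+≤+ (s≤s z≤n)))))

subtract : ∀ {x y ε} → x ℚ.≤ ε ℚ.+ y → x ℚ.- y ℚ.≤ ε
subtract {x} {y} {ε} le = ℚ.≤-trans (ℚ.+-monoˡ-≤ (ℚ.- y) le) (ℚ.≤-reflexive
  (trans (ℚ.+-assoc ε y _) (trans (cong (ε ℚ.+_) (ℚ.+-inverseʳ y)) (ℚ.+-identityʳ ε))))

∣-∣-bound : ∀ {p q ε} → p ℚ.≤ ε ℚ.+ q → q ℚ.≤ ε ℚ.+ p → ℚ.∣ p ℚ.- q ∣ ℚ.≤ ε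
∣-∣-bound {p} {q} p≤ q≤ with ℚ.∣p∣≡p∨∣p∣≡-p (p ℚ.- q)
... | inj₁ e = ℚ.≤-trans (ℚ.≤-reflexive e) (subtract p≤)
... | inj₂ e = ℚ.≤-trans (ℚ.≤-reflexive (trans e (⁻¹-anti-homo-// p q))) (subtract q≤)

ln : (n : ℕ) .{{_ : NonZero n}} → ℝ
ln n .approx = lnApprox n
ln n .cauchy ε 0<ε = let N , small = 1/-archimedean ε 0<ε in
  N , λ i j N≤i N≤j → ∣-∣-bound
    (ℚ.≤-trans (lnApprox-close n i j) (ℚ.+-monoˡ-≤ (lnApprox n j) (small j N≤j)))
    (ℚ.≤-trans (lnApprox-close n j i) (ℚ.+-monoˡ-≤ (lnApprox n i) (small i N≤i)))

{-# OPTIONS --safe #-}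

-- Call (u, x, z) a separation if x ∈ X, z ∈ Z and u ∉ X ∪ Z lies between
-- x and z. When X and Z merge, |Z| times the cost of moving X, and |X|
-- times the cost of moving Z, are at most the number T of separations, so
-- the expected cost is at most 2T / (|X| + |Z|). To a node outside, the
-- merged block looks like the block that did not move; with the biased
-- coin this preserves in expectation the number of separations of every
-- later merge. So T may be counted in π₀ throughout.
--
-- In a feasible solution X ∪ Z becomes contiguous, so in each separation u
-- has been flipped, relative to π₀, with x or with z. A pair {a, u} flipped
-- at all is thus charged 2|Z| / (|X| + |Z|) when the block X of a merges
-- with some Z, and likewise for u. As the block of a grows from |X| to
-- |X| + |Z|, the terms |Z| / (|X| + |Z|) sum to at most 1/2 + ⋯ + 1/n ≤ ln n,
-- so each flip pays at most 4 ln n.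

module Submission where

open import Data.Bool.Base using (Bool; if_then_else_)
open import Data.Fin.Base using (Fin; zero; suc; toℕ; fromℕ<; _<_; combine)
open import Data.Fin.Patterns using (0F; 1F; 2F)
open import Data.Fin.Permutation
  using (Permutation′; _⟨$⟩ʳ_; _⟨$⟩ˡ_; _≈_; _∘ₚ_; transpose; inverseˡ; inverseʳ)
open import Data.Fin.Properties
  using (_≟_; _<?_; any?; <-cmp; suc-injective; toℕ-injective; toℕ<n; toℕ-fromℕ<;
         toℕ-combine; combine-monoˡ-<; combine-injectiveʳ)
open import Data.Fin.Subset using (Subset; ∣_∣; _∈_; _∉_; _∪_; _⊆_; inside; outside)
open import Data.Fin.Subset.Properties using (_∈?_; x∈p∪q⁺; x∈p∪q⁻; ⊆-antisym; ∣p∣≤n)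
import Data.Integer.Base as ℤ
open import Data.Integer.Base using (+_)
import Data.Integer.Properties as ℤ
open import Data.List.Base as List using ([]; _∷_; _++_)
import Data.Nat.Base as ℕ
open import Data.Nat.Base using (ℕ; zero; suc; z≤n; s≤s; NonZero; ∣_-_∣)
import Data.Nat.Properties as ℕ
import Data.Nat.Tactic.RingSolver as ℕ-Solver
open import Data.Product.Base using (∃; ∃₂; _×_; _,_; proj₁; proj₂)
import Data.Rational.Base as ℚ
open import Data.Rational.Base using (ℚ; 0ℚ; 1ℚ)
import Data.Rational.Properties as ℚ
import Data.Rational.Unnormalised.Base as ℚᵘ
open import Data.Sum.Base using (_⊎_; inj₁; inj₂; [_,_]′; swap)
open import Data.Vec.Base using (Vec; []; _∷_)
open import Function.Base using (_∘_; id)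
open import Function.Definitions using (Injective)
open import Level using (0ℓ)
open import Relation.Binary.Definitions using (tri<; tri≈; tri>)
open import Relation.Binary.PropositionalEquality
  using (_≡_; _≢_; refl; sym; trans; cong; cong₂; subst; subst₂; module ≡-Reasoning)
open import Relation.Nullary.Decidable
  using (Dec; does; yes; no; ¬?; _×-dec_; _⊎-dec_; dec-true; dec-false; dec⇒maybe)
open import Relation.Nullary.Negation using (¬_; contradiction)
open import Tactic.RingSolver using (solve-∀)
open import Tactic.RingSolver.Core.AlmostCommutativeRing using (AlmostCommutativeRing; fromCommutativeRing)

open import Algebra.Bundles using (CommutativeRing)
open import Algebra.Properties.CommutativeMonoid.Sum ℕ.+-0-commutativeMonoid
  using (sum; sum-cong-≗; ∑-distrib-+; ∑-comm; sum-permute; sum-replicate-zero)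
import Algebra.Properties.CommutativeMonoid.Sum ℚ.+-0-commutativeMonoid as ∑ℚ
open import Algebra.Properties.Semiring.Sum ℕ.+-*-semiring using (*-distribˡ-sum; *-distribʳ-sum)
import Algebra.Properties.Semiring.Sum (CommutativeRing.semiring ℚ.+-*-commutativeRing) as *∑ℚ

open import Defs

open Graph
open IsCliqueOf
open CliqueInstance

-- The bias of the coin is what linearity asks for. After `X` has moved, all |X| + |Z| nodes of the
-- merged block look from outside like nodes of `Z`. This has probability |Z| / (|X| + |Z|), so in
-- expectation this outcome restores what `Z` contributed before, and the other outcome restores
-- what `X` contributed. A count of separations is linear in this sense because a later clique
-- contains `X ∪ Z` or avoids it, so that at most one of the three nodes of a separation lies in
-- `X ∪ Z`. Hence the later cliques may still be scattered over the current permutation, while `X`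
-- and `Z` have to be contiguous. Counting in π₀ gives `Rand` and the feasible solution one common
-- reference that no coin affects.

private variable
  n k m : ℕ
  P Q O O′ : Set

-- Indicators, inversions and the Kendall tau distance

𝟙 : Dec P → ℕ
𝟙 d = if does d then 1 else 0

𝟙-yes : (d : Dec P) → P → 𝟙 d ≡ 1
𝟙-yes (yes _) _ = refl
𝟙-yes (no ¬p) p = contradiction p ¬p

𝟙-no : (d : Dec P) → ¬ P → 𝟙 d ≡ 0
𝟙-no (yes p) ¬p = contradiction p ¬p
𝟙-no (no _)  _  = refl

𝟙-≤ : ∀ {m} (d : Dec P) → (P → 1 ℕ.≤ m) → 𝟙 d ℕ.≤ m
𝟙-≤ (yes p) le = le p
𝟙-≤ (no _)  _  = z≤n

𝟙-mono : (d : Dec P) (e : Dec Q) → (P → Q) → 𝟙 d ℕ.≤ 𝟙 e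
𝟙-mono d e f = 𝟙-≤ d λ p → ℕ.≤-reflexive (sym (𝟙-yes e (f p)))

𝟙-cong : (d : Dec P) (e : Dec Q) → (P → Q) → (Q → P) → 𝟙 d ≡ 𝟙 e
𝟙-cong d e f g = ℕ.≤-antisym (𝟙-mono d e f) (𝟙-mono e d g)

sum-mono : {f g : Fin n → ℕ} → (∀ i → f i ℕ.≤ g i) → sum f ℕ.≤ sum g
sum-mono {zero}  le = z≤n
sum-mono {suc n} le = ℕ.+-mono-≤ (le zero) (sum-mono (le ∘ suc))

sum-mono-< : {f g : Fin n → ℕ} → (∀ i → f i ℕ.≤ g i) → ∀ i → f i ℕ.< g i → sum f ℕ.< sum g
sum-mono-< le zero    lt = ℕ.+-mono-<-≤ lt (sum-mono (le ∘ suc))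
sum-mono-< le (suc i) lt = ℕ.+-mono-≤-< (le zero) (sum-mono-< (le ∘ suc) i lt)

sum-zero : {f : Fin n → ℕ} → (∀ i → f i ≡ 0) → sum f ≡ 0
sum-zero {n} e = trans (sum-cong-≗ e) (sum-replicate-zero n)

sum-single : {f : Fin n → ℕ} → ∀ i → (∀ j → j ≢ i → f j ≡ 0) → sum f ≡ f i
sum-single {f = f} zero    off =
  trans (cong (f zero ℕ.+_) (sum-zero λ j → off (suc j) λ ())) (ℕ.+-identityʳ _)
sum-single {f = f} (suc i) off =
  cong₂ ℕ._+_ (off zero λ ()) (sum-single i λ j j≢i → off (suc j) (j≢i ∘ suc-injective))

infix 4 _≺[_]_ _≺[_]?_

_≺[_]_ : Fin n → Permutation′ n → Fin n → Set
a ≺[ π ] b = π ⟨$⟩ʳ a < π ⟨$⟩ʳ b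

_≺[_]?_ : ∀ (a : Fin n) π b → Dec (a ≺[ π ] b)
a ≺[ π ]? b = (π ⟨$⟩ʳ a) <? (π ⟨$⟩ʳ b)

⟨$⟩ʳ-injective : ∀ (π : Permutation′ n) {a b} → π ⟨$⟩ʳ a ≡ π ⟨$⟩ʳ b → a ≡ b
⟨$⟩ʳ-injective π e = trans (sym (inverseˡ π)) (trans (cong (π ⟨$⟩ˡ_) e) (inverseˡ π))

≺-connex : ∀ (π : Permutation′ n) {a b} → a ≢ b → a ≺[ π ] b ⊎ b ≺[ π ] a
≺-connex π {a} {b} a≢b with <-cmp (π ⟨$⟩ʳ a) (π ⟨$⟩ʳ b)
... | tri< lt _ _ = inj₁ lt
... | tri≈ _ e _  = contradiction (⟨$⟩ʳ-injective π e) a≢b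
... | tri> _ _ gt = inj₂ gt

toℕ≡sum : ∀ (i : Fin n) → toℕ i ≡ sum λ (j : Fin n) → 𝟙 (j <? i)
toℕ≡sum {suc n} zero    = sym (sum-zero λ (j : Fin (suc n)) → 𝟙-no (j <? zero {n}) λ ())
toℕ≡sum {suc n} (suc i) = cong suc (trans (toℕ≡sum i)
  (sum-cong-≗ λ (j : Fin n) → 𝟙-cong (j <? i) (suc j <? suc i) s≤s ℕ.≤-pred))

position : ∀ (π : Permutation′ n) a → toℕ (π ⟨$⟩ʳ a) ≡ sum λ b → 𝟙 (b ≺[ π ]? a)
position π a = trans (toℕ≡sum (π ⟨$⟩ʳ a)) (sum-permute (λ j → 𝟙 (j <? (π ⟨$⟩ʳ a))) π)

-- Both orders are total, so an inclusion of one in the other is an equality, and counting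
-- predecessors recovers the positions.
≺-determines : ∀ (π ρ : Permutation′ n) → (∀ {a b} → a ≺[ π ] b → a ≺[ ρ ] b) → π ≈ ρ
≺-determines π ρ mono a = toℕ-injective (trans (position π a) (trans
  (sum-cong-≗ λ b → 𝟙-cong (b ≺[ π ]? a) (b ≺[ ρ ]? a) mono (reflect b)) (sym (position ρ a))))
  where
  reflect : ∀ b → b ≺[ ρ ] a → b ≺[ π ] a
  reflect b lt with ≺-connex π {b} {a} (λ { refl → ℕ.<-irrefl refl lt })
  ... | inj₁ b≺a = b≺a
  ... | inj₂ a≺b = contradiction (mono a≺b) (ℕ.<-asym lt)

-- Oriented by the order in π, so that the double sum `inversions` counts each inverted pair once.
Flipped : Permutation′ n → Permutation′ n → Fin n → Fin n → Set
Flipped π ρ a b = a ≺[ π ] b × b ≺[ ρ ] a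

flipped? : ∀ (π ρ : Permutation′ n) a b → Dec (Flipped π ρ a b)
flipped? π ρ a b = (a ≺[ π ]? b) ×-dec (b ≺[ ρ ]? a)

flips : Permutation′ n → Permutation′ n → Fin n → Fin n → ℕ
flips π ρ a b = 𝟙 (flipped? π ρ a b)

flips-self : ∀ (π ρ : Permutation′ n) → π ≈ ρ → ∀ a b → flips π ρ a b ≡ 0
flips-self π ρ e a b = 𝟙-no (flipped? π ρ a b) λ (lt , gt) →
  ℕ.<-asym lt (subst₂ _<_ (sym (e b)) (sym (e a)) gt)

flips-triangle : ∀ (π ρ τ : Permutation′ n) a b → flips π τ a b ℕ.≤ flips π ρ a b ℕ.+ flips ρ τ a b
flips-triangle π ρ τ a b = 𝟙-≤ (flipped? π τ a b) λ (a≺b , b≺a) → via a≺b b≺a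
  where
  via : a ≺[ π ] b → b ≺[ τ ] a → 1 ℕ.≤ flips π ρ a b ℕ.+ flips ρ τ a b
  via lt gt with ≺-connex ρ {a} {b} (λ { refl → ℕ.<-irrefl refl lt })
  ... | inj₁ a≺b = ℕ.≤-trans (ℕ.≤-reflexive (sym (𝟙-yes (flipped? ρ τ a b) (a≺b , gt)))) (ℕ.m≤n+m _ _)
  ... | inj₂ b≺a = ℕ.≤-trans (ℕ.≤-reflexive (sym (𝟙-yes (flipped? π ρ a b) (lt , b≺a)))) (ℕ.m≤m+n _ _)

inversions : Permutation′ n → Permutation′ n → ℕ
inversions π ρ = sum λ a → sum λ b → flips π ρ a b

inversions-triangle : ∀ (π ρ τ : Permutation′ n) → inversions π τ ℕ.≤ inversions π ρ ℕ.+ inversions ρ τ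
inversions-triangle π ρ τ = ℕ.≤-trans
  (sum-mono λ a → ℕ.≤-trans (sum-mono (flips-triangle π ρ τ a))
    (ℕ.≤-reflexive (∑-distrib-+ (flips π ρ a) (flips ρ τ a))))
  (ℕ.≤-reflexive (∑-distrib-+ (λ a → sum (flips π ρ a)) (λ a → sum (flips ρ τ a))))

-- No position lies strictly between `i` and `j`, so every other position is on the same side of
-- both.
transpose-flips : ∀ {i j a b : Fin n} → toℕ j ≡ suc (toℕ i) → a < b →
                  transpose i j ⟨$⟩ʳ b < transpose i j ⟨$⟩ʳ a → a ≡ i × b ≡ j
transpose-flips {i = i} {j} {a} {b} adj a<b = go (a ≟ i) (a ≟ j) (b ≟ i) (b ≟ j)
  where
  i<j : i < j
  i<j = ℕ.≤-reflexive (sym adj)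
  between : ∀ {c : Fin _} → i < c → ¬ (c < j)
  between i<c c<j = ℕ.<-irrefl refl (ℕ.<-≤-trans i<c (ℕ.≤-pred (subst (_ ℕ.≤_) adj c<j)))
  go : Dec (a ≡ i) → Dec (a ≡ j) → Dec (b ≡ i) → Dec (b ≡ j) →
       transpose i j ⟨$⟩ʳ b < transpose i j ⟨$⟩ʳ a → a ≡ i × b ≡ j
  go (yes refl) _ _ (yes refl) _ = refl , refl
  go (yes refl) _ (yes refl) _ _ = contradiction a<b (ℕ.<-irrefl refl)
  go (yes refl) _ (no b≢i) (no b≢j) lt
    rewrite transpose-left i j | transpose-other i j b≢i b≢j = contradiction lt (between a<b)
  go (no _) (yes refl) (yes refl) _ _ = contradiction a<b (ℕ.<-asym i<j)
  go (no _) (yes refl) _ (yes refl) _ = contradiction a<b (ℕ.<-irrefl refl)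
  go (no _) (yes refl) (no b≢i) (no b≢j) lt
    rewrite transpose-right i j | transpose-other i j b≢i b≢j =
      contradiction (ℕ.<-trans a<b lt) (ℕ.<-asym i<j)
  go (no a≢i) (no a≢j) (yes refl) _ lt
    rewrite transpose-left i j | transpose-other i j a≢i a≢j =
      contradiction (ℕ.<-trans lt a<b) (ℕ.<-asym i<j)
  go (no a≢i) (no a≢j) (no _) (yes refl) lt
    rewrite transpose-right i j | transpose-other i j a≢i a≢j = contradiction a<b (between lt)
  go (no a≢i) (no a≢j) (no b≢i) (no b≢j) lt
    rewrite transpose-other i j a≢i a≢j | transpose-other i j b≢i b≢j = contradiction lt (ℕ.<-asym a<b)

inversions-transpose : ∀ (π : Permutation′ n) {i j} → toℕ j ≡ suc (toℕ i) →
                       inversions π (π ∘ₚ transpose i j) ℕ.≤ 1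
inversions-transpose π {i} {j} adj = begin
  inversions π π′               ≡⟨ sum-single x (λ a a≢x → sum-zero λ b →
                                     𝟙-no (flipped? π π′ a b) λ f → a≢x (proj₁ (only f))) ⟩
  (sum λ b → flips π π′ x b)    ≡⟨ sum-single y (λ b b≢y →
                                     𝟙-no (flipped? π π′ x b) λ f → b≢y (proj₂ (only f))) ⟩
  flips π π′ x y                ≤⟨ 𝟙-≤ (flipped? π π′ x y) (λ _ → ℕ.≤-refl) ⟩
  1                             ∎
  where
  open ℕ.≤-Reasoning
  π′ = π ∘ₚ transpose i j
  x = π ⟨$⟩ˡ i
  y = π ⟨$⟩ˡ j
  only : ∀ {a b} → Flipped π π′ a b → a ≡ x × b ≡ y
  only (lt , gt) with transpose-flips adj lt gt
  ... | refl , refl = sym (inverseˡ π) , sym (inverseˡ π)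

inversions≤swaps : ∀ k {π ρ : Permutation′ n} → SwapPath k π ρ → inversions π ρ ℕ.≤ k
inversions≤swaps zero    {π} {ρ} e = ℕ.≤-reflexive (sum-zero λ a → sum-zero λ b → flips-self π ρ e a b)
inversions≤swaps (suc k) {π} {ρ} (i , j , adj , p) = ℕ.≤-trans (inversions-triangle π (π ∘ₚ transpose i j) ρ)
  (ℕ.+-mono-≤ (inversions-transpose π adj) (inversions≤swaps k {π ∘ₚ transpose i j} {ρ} p))

inversions≤kendallTau : ∀ (π ρ : Permutation′ n) → inversions π ρ ℕ.≤ kendallTau π ρ
inversions≤kendallTau π ρ = inversions≤swaps _ (proj₁ (proj₂ (leastSwaps π ρ)))

-- A descent, in the usual sense, of the permutation that sends a node's position in π to its
-- position in ρ.
Descent : Permutation′ n → Permutation′ n → Fin n → Fin n → Set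
Descent π ρ i j = toℕ j ≡ suc (toℕ i) × (π ⟨$⟩ˡ j) ≺[ ρ ] (π ⟨$⟩ˡ i)

descent? : ∀ (π ρ : Permutation′ n) → Dec (∃₂ (Descent π ρ))
descent? π ρ = any? λ i → any? λ j → (toℕ j ℕ.≟ suc (toℕ i)) ×-dec ((π ⟨$⟩ˡ j) ≺[ ρ ]? (π ⟨$⟩ˡ i))

-- Then ρ increases along consecutive positions of π, and by transitivity along all of them.
noDescent⇒≈ : ∀ (π ρ : Permutation′ n) → ¬ ∃₂ (Descent π ρ) → π ≈ ρ
noDescent⇒≈ {n} π ρ none = ≺-determines π ρ λ {a} {b} lt →
  subst₂ (_≺[ ρ ]_) (inverseˡ π) (inverseˡ π) (ascending _ _ _ (gap lt))
  where
  ascending : ∀ d (i j : Fin n) → toℕ j ≡ suc d ℕ.+ toℕ i → (π ⟨$⟩ˡ i) ≺[ ρ ] (π ⟨$⟩ˡ j)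
  ascending zero i j adj with ≺-connex ρ {π ⟨$⟩ˡ i} {π ⟨$⟩ˡ j} (λ e → ℕ.1+n≢n (sym (trans
      (cong toℕ (trans (sym (inverseʳ π)) (trans (cong (π ⟨$⟩ʳ_) e) (inverseʳ π)))) adj)))
  ... | inj₁ lt = lt
  ... | inj₂ gt = contradiction (i , j , adj , gt) none
  ascending (suc d) i j eq = ℕ.<-trans
    (ascending d i h (toℕ-fromℕ< h<n))
    (ascending zero h j (trans eq (cong suc (sym (toℕ-fromℕ< h<n)))))
    where
    h<n : suc d ℕ.+ toℕ i ℕ.< n
    h<n = ℕ.<-trans (ℕ.n<1+n _) (subst (ℕ._< n) eq (toℕ<n j))
    h = fromℕ< h<n

-- The swap changes the order of a single pair, by `transpose-flips`, and that pair was inverted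
-- before and is not afterwards.
inversions-descent : ∀ (π ρ : Permutation′ n) {i j} → Descent π ρ i j →
                     inversions (π ∘ₚ transpose i j) ρ ℕ.< inversions π ρ
inversions-descent π ρ {i} {j} (adj , desc) =
  sum-mono-< (λ a → sum-mono λ b → le a b) (π ⟨$⟩ˡ i)
    (sum-mono-< (le _) (π ⟨$⟩ˡ j) strict)
  where
  π′ = π ∘ₚ transpose i j
  i<j : i < j
  i<j = ℕ.≤-reflexive (sym adj)
  keep : ∀ {a b} → Flipped π′ ρ a b → Flipped π ρ a b
  keep {a} {b} (lt , gt) with ≺-connex π {a} {b} (λ { refl → ℕ.<-irrefl refl gt })
  ... | inj₁ a≺b = a≺b , gt
  ... | inj₂ b≺a with transpose-flips adj b≺a lt
  ...   | refl , refl = contradiction gt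
            (ℕ.<-asym (subst₂ (_≺[ ρ ]_) (inverseˡ π) (inverseˡ π) desc))
  le : ∀ a b → flips π′ ρ a b ℕ.≤ flips π ρ a b
  le a b = 𝟙-mono (flipped? π′ ρ a b) (flipped? π ρ a b) keep
  strict : flips π′ ρ (π ⟨$⟩ˡ i) (π ⟨$⟩ˡ j) ℕ.< flips π ρ (π ⟨$⟩ˡ i) (π ⟨$⟩ˡ j)
  strict = ℕ.≤-trans
    (ℕ.≤-reflexive (cong suc (𝟙-no (flipped? π′ ρ _ _) λ (lt , _) → ℕ.<-asym i<j
      (subst₂ _<_ (trans (cong (transpose i j ⟨$⟩ʳ_) (inverseʳ π)) (transpose-left i j))
                  (trans (cong (transpose i j ⟨$⟩ʳ_) (inverseʳ π)) (transpose-right i j)) lt))))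
    (ℕ.≤-reflexive (sym (𝟙-yes (flipped? π ρ _ _)
      (subst₂ _<_ (sym (inverseʳ π)) (sym (inverseʳ π)) i<j , desc))))

-- The recursion is on the bound `m`: each swap at a descent lowers the number of inversions, so the
-- bound can drop by one.
bubbleSort : ∀ m (π ρ : Permutation′ n) → inversions π ρ ℕ.≤ m → ∃ λ k → SwapPath k π ρ × k ℕ.≤ m
bubbleSort m π ρ le with descent? π ρ
bubbleSort m       π ρ le | no none = 0 , noDescent⇒≈ π ρ none , z≤n
bubbleSort zero    π ρ le | yes (i , j , desc) =
  contradiction (ℕ.<-≤-trans (inversions-descent π ρ desc) le) λ ()
bubbleSort (suc m) π ρ le | yes (i , j , desc)
  with k , p , k≤m ← bubbleSort m (π ∘ₚ transpose i j) ρ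
                       (ℕ.≤-pred (ℕ.<-≤-trans (inversions-descent π ρ desc) le)) =
  suc k , (i , j , proj₁ desc , p) , s≤s k≤m

-- The two comparisons serve opposite ends: this one bounds the moves of `Rand` from above, and
-- `inversions≤kendallTau` bounds a feasible solution from below.
kendallTau≤inversions : ∀ (π ρ : Permutation′ n) → kendallTau π ρ ℕ.≤ inversions π ρ
kendallTau≤inversions π ρ with k , p , k≤ ← bubbleSort _ π ρ ℕ.≤-refl =
  ℕ.≤-trans (proj₂ (proj₂ (leastSwaps π ρ)) k p) k≤

-- Moving a block

≺-irrefl : ∀ (π : Permutation′ n) {a b} → a ≡ b → ¬ (a ≺[ π ] b)
≺-irrefl π refl = ℕ.<-irrefl refl

≺-asym : ∀ (π : Permutation′ n) {a b} → a ≺[ π ] b → ¬ (b ≺[ π ] a)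
≺-asym π = ℕ.<-asym

sortBy-mono : ∀ (key : Fin n → Fin m) (inj : Injective _≡_ _≡_ key) {a b} →
              key a < key b → a ≺[ sortBy key inj ] b
sortBy-mono key inj {a} {b} lt = subst₂ ℕ._<_
  (sym (toℕ-fromℕ< (∣below∣<n key a))) (sym (toℕ-fromℕ< (∣below∣<n key b))) (below-mono key lt)

module Lexicographic (π : Permutation′ n) (s : Fin n → Fin m) where

  private
    inj : Injective _≡_ _≡_ λ y → combine (s y) (π ⟨$⟩ʳ y)
    inj {x} {y} e = ⟨$⟩ʳ-injective π (combine-injectiveʳ (s x) (π ⟨$⟩ʳ x) (s y) (π ⟨$⟩ʳ y) e)

  sorted : Permutation′ n
  sorted = sortBy (λ y → combine (s y) (π ⟨$⟩ʳ y)) inj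

  lex-< : ∀ {a b} → s a < s b → a ≺[ sorted ] b
  lex-< lt = sortBy-mono _ inj (combine-monoˡ-< _ _ lt)

  lex-≡ : ∀ {a b} → s a ≡ s b → a ≺[ π ] b → a ≺[ sorted ] b
  lex-≡ {a} {b} e lt = sortBy-mono _ inj (subst₂ ℕ._<_
    (sym (toℕ-combine (s a) (π ⟨$⟩ʳ a))) (sym (toℕ-combine (s b) (π ⟨$⟩ʳ b)))
    (subst (λ c → n ℕ.* toℕ (s a) ℕ.+ toℕ (π ⟨$⟩ʳ a) ℕ.< n ℕ.* toℕ c ℕ.+ toℕ (π ⟨$⟩ʳ b)) e
      (ℕ.+-monoʳ-< (n ℕ.* toℕ (s a)) lt)))

Contiguous : Permutation′ n → Subset n → Set
Contiguous π C = ∀ {x y z} → x ∈ C → z ∈ C → x ≺[ π ] y → y ≺[ π ] z → y ∈ C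

∈∉⇒≢ : ∀ {C : Subset n} {x y} → x ∈ C → y ∉ C → x ≢ y
∈∉⇒≢ x∈ y∉ refl = y∉ x∈

module _ (π : Permutation′ n) {C : Subset n} (contig : Contiguous π C) where

  contiguous-≺ˡ : ∀ {c c′ u} → c ∈ C → c′ ∈ C → u ∉ C → u ≺[ π ] c → u ≺[ π ] c′
  contiguous-≺ˡ c∈ c′∈ u∉ u≺c with ≺-connex π (∈∉⇒≢ c′∈ u∉)
  ... | inj₁ c′≺u = contradiction (contig c′∈ c∈ c′≺u u≺c) u∉
  ... | inj₂ u≺c′ = u≺c′

  contiguous-≺ʳ : ∀ {c c′ u} → c ∈ C → c′ ∈ C → u ∉ C → c ≺[ π ] u → c′ ≺[ π ] u
  contiguous-≺ʳ c∈ c′∈ u∉ c≺u with ≺-connex π (∈∉⇒≢ c′∈ u∉)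
  ... | inj₁ c′≺u = c′≺u
  ... | inj₂ u≺c′ = contradiction (contig c∈ c′∈ c≺u u≺c′) u∉

Disjoint : Subset n → Subset n → Set
Disjoint X Z = ∀ {v} → v ∈ X → v ∉ Z

-- To the nodes outside `X ∪ Z`, `a` is in π′ what `b` is in π. Both directions are recorded, so
-- that counts over the two permutations agree exactly.
record Represents (X Z : Subset n) (π π′ : Permutation′ n) (a b : Fin n) : Set where
  field
    left   : ∀ {c} → c ∉ X → c ∉ Z → a ≺[ π′ ] c → b ≺[ π ] c
    left⁻  : ∀ {c} → c ∉ X → c ∉ Z → b ≺[ π ] c → a ≺[ π′ ] c
    right  : ∀ {c} → c ∉ X → c ∉ Z → c ≺[ π′ ] a → c ≺[ π ] b
    right⁻ : ∀ {c} → c ∉ X → c ∉ Z → c ≺[ π ] b → c ≺[ π′ ] a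

open Represents

-- The four ways in which `slot` can place a node outside `X`, each with the tests that led there.
-- `s` stands for the slot function.
data Side (π : Permutation′ n) (X Z : Subset n) (s : Fin n → Fin 3) (y : Fin n) : Set where
  l-precedes : IsLeftOf π X Z → s y ≡ 0F → Precedes π y Z → Side π X Z s y
  l-other    : IsLeftOf π X Z → s y ≡ 2F → ¬ Precedes π y Z → Side π X Z s y
  r-follows  : ¬ IsLeftOf π X Z → s y ≡ 2F → Follows π y Z → Side π X Z s y
  r-other    : ¬ IsLeftOf π X Z → s y ≡ 0F → ¬ Follows π y Z → Side π X Z s y

module _ (π : Permutation′ n) (X Z : Subset n) where

  private
    -- The decision tree of `slot` on bare truth values, into which the known outcomes of the tests
    -- are substituted.
    choose : Bool → Bool → Bool → Bool → Fin 3
    choose i l p f = if i then 1F else if l then (if p then 0F else 2F) else (if f then 2F else 0F)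

    slot≡choose : ∀ y {i l p f} → does (y ∈? X) ≡ i → does (isLeftOf? π X Z) ≡ l →
      does (precedes? π y Z) ≡ p → does (follows? π y Z) ≡ f → slot π X Z y ≡ choose i l p f
    slot≡choose _ refl refl refl refl = refl

  slot-∈ : ∀ {y} → y ∈ X → slot π X Z y ≡ 1F
  slot-∈ {y} y∈ = slot≡choose y (dec-true (y ∈? X) y∈) refl refl refl

  side : ∀ {y} → y ∉ X → Side π X Z (slot π X Z) y
  side {y} y∉ = go (isLeftOf? π X Z) (precedes? π y Z) (follows? π y Z)
    where
    out = dec-false (y ∈? X) y∉
    go : Dec (IsLeftOf π X Z) → Dec (Precedes π y Z) → Dec (Follows π y Z) → Side π X Z (slot π X Z) y
    go (yes l) (yes p) _ = l-precedes l
      (slot≡choose y out (dec-true (isLeftOf? π X Z) l) (dec-true (precedes? π y Z) p) refl) p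
    go (yes l) (no ¬p) _ = l-other l
      (slot≡choose y out (dec-true (isLeftOf? π X Z) l) (dec-false (precedes? π y Z) ¬p) refl) ¬p
    go (no ¬l) _ (yes f) = r-follows ¬l
      (slot≡choose y out (dec-false (isLeftOf? π X Z) ¬l) refl (dec-true (follows? π y Z) f)) f
    go (no ¬l) _ (no ¬f) = r-other ¬l
      (slot≡choose y out (dec-false (isLeftOf? π X Z) ¬l) refl (dec-false (follows? π y Z) ¬f)) ¬f

-- The interface through which the rest of the proof sees a move: no order changes within `X` or
-- within its complement, outside nodes come to see `X` where they saw `Z`, and `X` does not cross
-- `Z`.
record Moved (X Z : Subset n) (π π′ : Permutation′ n) : Set where
  field
    keep        : ∀ {a b} → a ∉ X → b ∉ X → a ≺[ π ] b → a ≺[ π′ ] b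
    keep-∈      : ∀ {a b} → a ∈ X → b ∈ X → a ≺[ π ] b → a ≺[ π′ ] b
    moved-left  : ∀ {x u z} → x ∈ X → z ∈ Z → u ∉ X → u ∉ Z → u ≺[ π ] z → u ≺[ π′ ] x
    moved-right : ∀ {x u z} → x ∈ X → z ∈ Z → u ∉ X → u ∉ Z → z ≺[ π ] u → x ≺[ π′ ] u
    moved-∈     : ∀ {x z} → x ∈ X → z ∈ Z → (x ≺[ π ] z → x ≺[ π′ ] z) × (z ≺[ π ] x → z ≺[ π′ ] x)

  keep⁻ : ∀ {a b} → a ∉ X → b ∉ X → a ≺[ π′ ] b → a ≺[ π ] b
  keep⁻ a∉ b∉ lt with ≺-connex π (λ a≡b → ≺-irrefl π′ a≡b lt)
  ... | inj₁ a≺b = a≺b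
  ... | inj₂ b≺a = contradiction (keep b∉ a∉ b≺a) (≺-asym π′ lt)

module BySlots (π π′ : Permutation′ n) (X Z : Subset n) (s : Fin n → Fin 3)
  (lex-< : ∀ {a b} → s a < s b → a ≺[ π′ ] b)
  (lex-≡ : ∀ {a b} → s a ≡ s b → a ≺[ π ] b → a ≺[ π′ ] b)
  (slot-∈ : ∀ {y} → y ∈ X → s y ≡ 1F)
  (side : ∀ {y} → y ∉ X → Side π X Z s y)
  (disj : Disjoint X Z) (contigX : Contiguous π X) (contigZ : Contiguous π Z) where

  lex-<′ : ∀ {a b i j} → s a ≡ i → s b ≡ j → i < j → a ≺[ π′ ] b
  lex-<′ refl refl = lex-<

  keep : ∀ {a b} → a ∉ X → b ∉ X → a ≺[ π ] b → a ≺[ π′ ] b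
  keep a∉ b∉ lt with side a∉ | side b∉
  ... | l-precedes _ ea _  | l-precedes _ eb _  = lex-≡ (trans ea (sym eb)) lt
  ... | l-precedes _ ea _  | l-other _ eb _     = lex-<′ ea eb (s≤s z≤n)
  ... | l-precedes l _ _   | r-follows ¬l _ _   = contradiction l ¬l
  ... | l-precedes l _ _   | r-other ¬l _ _     = contradiction l ¬l
  ... | l-other _ _ ¬p     | l-precedes _ _ p   = contradiction (λ y y∈ → ℕ.<-trans lt (p y y∈)) ¬p
  ... | l-other _ ea _     | l-other _ eb _     = lex-≡ (trans ea (sym eb)) lt
  ... | l-other l _ _      | r-follows ¬l _ _   = contradiction l ¬l
  ... | l-other l _ _      | r-other ¬l _ _     = contradiction l ¬l
  ... | r-follows ¬l _ _   | l-precedes l _ _   = contradiction l ¬l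
  ... | r-follows ¬l _ _   | l-other l _ _      = contradiction l ¬l
  ... | r-follows _ ea _   | r-follows _ eb _   = lex-≡ (trans ea (sym eb)) lt
  ... | r-follows _ _ f    | r-other _ _ ¬f     = contradiction (λ y y∈ → ℕ.<-trans (f y y∈) lt) ¬f
  ... | r-other ¬l _ _     | l-precedes l _ _   = contradiction l ¬l
  ... | r-other ¬l _ _     | l-other l _ _      = contradiction l ¬l
  ... | r-other _ ea _     | r-follows _ eb _   = lex-<′ ea eb (s≤s z≤n)
  ... | r-other _ ea _     | r-other _ eb _     = lex-≡ (trans ea (sym eb)) lt

  keep-∈ : ∀ {a b} → a ∈ X → b ∈ X → a ≺[ π ] b → a ≺[ π′ ] b
  keep-∈ a∈ b∈ = lex-≡ (trans (slot-∈ a∈) (sym (slot-∈ b∈)))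

  private
    before : ∀ {x u} → x ∈ X → s u ≡ 0F → u ≺[ π′ ] x
    before x∈ e = lex-<′ e (slot-∈ x∈) (s≤s z≤n)

    after : ∀ {x u} → x ∈ X → s u ≡ 2F → x ≺[ π′ ] u
    after x∈ e = lex-<′ (slot-∈ x∈) e (s≤s (s≤s z≤n))

  moved-left : ∀ {x u z} → x ∈ X → z ∈ Z → u ∉ X → u ∉ Z → u ≺[ π ] z → u ≺[ π′ ] x
  moved-left {x} {u} {z} x∈ z∈ u∉X u∉Z u≺z with side u∉X
  ... | l-precedes _ e _ = before x∈ e
  ... | l-other _ _ ¬p   = contradiction (λ y y∈ → contiguous-≺ˡ π contigZ z∈ y∈ u∉Z u≺z) ¬p
  ... | r-follows _ _ f  = contradiction (f z z∈) (≺-asym π u≺z)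
  ... | r-other _ e _    = before x∈ e

  moved-right : ∀ {x u z} → x ∈ X → z ∈ Z → u ∉ X → u ∉ Z → z ≺[ π ] u → x ≺[ π′ ] u
  moved-right {x} {u} {z} x∈ z∈ u∉X u∉Z z≺u with side u∉X
  ... | l-precedes _ _ p = contradiction (p z z∈) (≺-asym π z≺u)
  ... | l-other _ e _    = after x∈ e
  ... | r-follows _ e _  = after x∈ e
  ... | r-other _ _ ¬f   = contradiction (λ y y∈ → contiguous-≺ʳ π contigZ z∈ y∈ u∉Z z≺u) ¬f

  moved-∈ : ∀ {x z} → x ∈ X → z ∈ Z → (x ≺[ π ] z → x ≺[ π′ ] z) × (z ≺[ π ] x → z ≺[ π′ ] x)
  -- The slot of `z` itself decides. Since `z` neither precedes nor follows all of its own block, it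
  -- gets the slot beyond `X`: 2 if `X` comes from the left, 0 otherwise.
  moved-∈ {x} {z} x∈ z∈ with side (λ z∈X → disj z∈X z∈)
  ... | l-precedes _ _ p = contradiction (p z z∈) (≺-irrefl π refl)
  ... | l-other l e _    = (λ _ → after x∈ e) , λ z≺x → contradiction (l x x∈ z z∈) (≺-asym π z≺x)
  ... | r-follows _ _ f  = contradiction (f z z∈) (≺-irrefl π refl)
  ... | r-other ¬l e _   = (λ x≺z → contradiction (isLeft x≺z) ¬l) , λ _ → before x∈ e
    where
    -- Disjoint contiguous blocks are ordered as any one pair of their nodes is.
    isLeft : x ≺[ π ] z → IsLeftOf π X Z
    isLeft x≺z x′ x′∈ z′ z′∈ = contiguous-≺ʳ π contigX x∈ x′∈ (λ z′∈X → disj z′∈X z′∈)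
      (contiguous-≺ˡ π contigZ z∈ z′∈ (disj x∈) x≺z)

  moved : Moved X Z π π′
  moved = record { keep = keep ; keep-∈ = keep-∈ ; moved-left = moved-left ; moved-right = moved-right ; moved-∈ = moved-∈ }

moveTowards-moved : ∀ (π : Permutation′ n) X Z → Disjoint X Z → Contiguous π X → Contiguous π Z →
                    Moved X Z π (moveTowards X Z π)
-- A position in `sortBy` depends on the key alone, and `L.sorted` has the key of `moveTowards`, so
-- its order facts apply as they stand.
moveTowards-moved π X Z = BySlots.moved π (moveTowards X Z π) X Z (slot π X Z)
  (λ {a} {b} → L.lex-< {a} {b}) (λ {a} {b} → L.lex-≡ {a} {b}) (λ {y} → slot-∈ π X Z {y}) (λ {y} → side π X Z {y})
  where module L = Lexicographic π (slot π X Z)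

module Representatives {X Z : Subset n} {π π′ : Permutation′ n} (moved : Moved X Z π π′)
                       (disj : Disjoint X Z) (contigZ : Contiguous π Z) where
  open Moved moved

  represents-self : ∀ {a} → a ∉ X → Represents X Z π π′ a a
  represents-self a∉ = record
    { left   = λ c∉ _ → keep⁻ a∉ c∉
    ; left⁻  = λ c∉ _ → keep a∉ c∉
    ; right  = λ c∉ _ → keep⁻ c∉ a∉
    ; right⁻ = λ c∉ _ → keep c∉ a∉
    }

  -- For `w` in `X` this is the effect of the move; for `w` in `Z` it is contiguity, as an outside
  -- node sees all of `Z` on one side. That every `z` serves every `w` makes the merged block
  -- uniform.
  represents : ∀ {w z} → w ∈ X ⊎ w ∈ Z → z ∈ Z → Represents X Z π π′ w z
  represents {w} {z} (inj₁ w∈X) z∈ = record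
    { left   = λ c∉X c∉Z w≺c → [ (λ z≺c → z≺c)
                                , (λ c≺z → contradiction (moved-left w∈X z∈ c∉X c∉Z c≺z) (≺-asym π′ w≺c))
                                ]′ (≺-connex π (∈∉⇒≢ z∈ c∉Z))
    ; left⁻  = moved-right w∈X z∈
    ; right  = λ c∉X c∉Z c≺w → [ (λ z≺c → contradiction (moved-right w∈X z∈ c∉X c∉Z z≺c) (≺-asym π′ c≺w))
                                , (λ c≺z → c≺z)
                                ]′ (≺-connex π (∈∉⇒≢ z∈ c∉Z))
    ; right⁻ = moved-left w∈X z∈
    }
  represents {w} {z} (inj₂ w∈Z) z∈ = record
    { left   = λ c∉X c∉Z w≺c → contiguous-≺ʳ π contigZ w∈Z z∈ c∉Z (keep⁻ w∉X c∉X w≺c)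
    ; left⁻  = λ c∉X c∉Z z≺c → keep w∉X c∉X (contiguous-≺ʳ π contigZ z∈ w∈Z c∉Z z≺c)
    ; right  = λ c∉X c∉Z c≺w → contiguous-≺ˡ π contigZ w∈Z z∈ c∉Z (keep⁻ c∉X w∉X c≺w)
    ; right⁻ = λ c∉X c∉Z c≺z → keep c∉X w∉X (contiguous-≺ˡ π contigZ z∈ w∈Z c∉Z c≺z)
    }
    where
    w∉X : w ∉ X
    w∉X w∈X = disj w∈X w∈Z

-- Separations and the cost of a move

Between : Permutation′ n → Fin n → Fin n → Fin n → Set
Between π x u z = (x ≺[ π ] u × u ≺[ π ] z) ⊎ (z ≺[ π ] u × u ≺[ π ] x)

between? : ∀ (π : Permutation′ n) x u z → Dec (Between π x u z)
between? π x u z = ((x ≺[ π ]? u) ×-dec (u ≺[ π ]? z)) ⊎-dec ((z ≺[ π ]? u) ×-dec (u ≺[ π ]? x))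

Separates : Permutation′ n → Subset n → Subset n → Fin n → Fin n → Fin n → Set
Separates π X Z u x z = x ∈ X × z ∈ Z × u ∉ X × u ∉ Z × Between π x u z

separates? : ∀ (π : Permutation′ n) X Z u x z → Dec (Separates π X Z u x z)
separates? π X Z u x z =
  (x ∈? X) ×-dec (z ∈? Z) ×-dec (¬? (u ∈? X)) ×-dec (¬? (u ∈? Z)) ×-dec between? π x u z

separations : Permutation′ n → Subset n → Subset n → ℕ
separations π X Z = sum λ u → sum λ x → sum λ z → 𝟙 (separates? π X Z u x z)

separations-sym : ∀ (π : Permutation′ n) X Z → separations π X Z ≡ separations π Z X
separations-sym π X Z = sum-cong-≗ λ u → trans (∑-comm (λ x z → 𝟙 (separates? π X Z u x z)))
  (sum-cong-≗ λ z → sum-cong-≗ λ x → 𝟙-cong (separates? π X Z u x z) (separates? π Z X u z x)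
    (λ (x∈ , z∈ , u∉X , u∉Z , b) → z∈ , x∈ , u∉Z , u∉X , swap b)
    (λ (z∈ , x∈ , u∉Z , u∉X , b) → x∈ , z∈ , u∉X , u∉Z , swap b))

card≡sum : ∀ (X : Subset n) → ∣ X ∣ ≡ sum λ x → 𝟙 (x ∈? X)
card≡sum []            = refl
card≡sum (inside  ∷ X) = cong suc (card≡sum X)
card≡sum (outside ∷ X) = card≡sum X

card*-≤ : ∀ (X : Subset n) c {f : Fin n → ℕ} → (∀ {x} → x ∈ X → c ℕ.≤ f x) → ∣ X ∣ ℕ.* c ℕ.≤ sum f
card*-≤ X c {f} le = begin
  ∣ X ∣ ℕ.* c                      ≡⟨ cong (ℕ._* c) (card≡sum X) ⟩
  (sum λ x → 𝟙 (x ∈? X)) ℕ.* c     ≡⟨ *-distribʳ-sum c (λ x → 𝟙 (x ∈? X)) ⟩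
  (sum λ x → 𝟙 (x ∈? X) ℕ.* c)     ≤⟨ sum-mono pointwise ⟩
  sum f                            ∎
  where
  open ℕ.≤-Reasoning
  pointwise : ∀ x → 𝟙 (x ∈? X) ℕ.* c ℕ.≤ f x
  pointwise x with x ∈? X
  ... | yes x∈ = ℕ.≤-trans (ℕ.≤-reflexive (ℕ.*-identityˡ c)) (le x∈)
  ... | no _   = z≤n

module _ {X Z : Subset n} {π π′ : Permutation′ n} (moved : Moved X Z π π′)
         (disj : Disjoint X Z) (contigZ : Contiguous π Z) where
  open Moved moved
  open Representatives moved disj contigZ

  -- A pair is flipped only if X moves over one of its nodes; given z ∈ Z,
  -- that node then separates z from the node in X.
  inversions-moveTowards : ∣ Z ∣ ℕ.* inversions π π′ ℕ.≤ separations π X Z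
  inversions-moveTowards = ℕ.≤-trans
    (card*-≤ Z _ {λ z → sum λ u → sum λ x → S u x z} bound)
    (ℕ.≤-reflexive (trans (∑-comm λ z u → sum λ x → S u x z)
      (sum-cong-≗ λ u → ∑-comm λ z x → S u x z)))
    where
    S : Fin n → Fin n → Fin n → ℕ
    S u x z = 𝟙 (separates? π X Z u x z)
    -- A flip is oriented by π, so the node of `X` in it comes first (`up?`) or second (`down?`).
    -- The two exclude each other, so that both together use each separation at most once.
    up? : ∀ z x u → Dec (Separates π X Z u x z × x ≺[ π ] u)
    up? z x u = separates? π X Z u x z ×-dec (x ≺[ π ]? u)
    down? : ∀ z x u → Dec (Separates π X Z u x z × u ≺[ π ] x)
    down? z x u = separates? π X Z u x z ×-dec (u ≺[ π ]? x)

    flipped⇒ : ∀ {z a b} → z ∈ Z → Flipped π π′ a b →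
               (Separates π X Z b a z × a ≺[ π ] b) ⊎ (Separates π X Z a b z × a ≺[ π ] b)
    flipped⇒ {z} {a} {b} z∈ (lt , gt) with a ∈? X | b ∈? X
    ... | yes a∈ | yes b∈ = contradiction (keep-∈ a∈ b∈ lt) (≺-asym π′ gt)
    ... | no a∉  | no b∉  = contradiction (keep a∉ b∉ lt) (≺-asym π′ gt)
    ... | yes a∈ | no b∉ = inj₁ ((a∈ , z∈ , b∉ , b∉Z ,
          inj₁ (lt , right (represents (inj₁ a∈) z∈) b∉ b∉Z gt)) , lt)
      where
      b∉Z : b ∉ Z
      b∉Z b∈Z = ≺-asym π′ gt (proj₁ (moved-∈ a∈ b∈Z) lt)
    ... | no a∉ | yes b∈ = inj₂ ((b∈ , z∈ , a∉ , a∉Z ,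
          inj₂ (left (represents (inj₁ b∈) z∈) a∉ a∉Z gt , lt)) , lt)
      where
      a∉Z : a ∉ Z
      a∉Z a∈Z = ≺-asym π′ gt (proj₂ (moved-∈ b∈ a∈Z) lt)

    flips≤ : ∀ {z} → z ∈ Z → ∀ a b → flips π π′ a b ℕ.≤ 𝟙 (up? z a b) ℕ.+ 𝟙 (down? z b a)
    flips≤ {z} z∈ a b = 𝟙-≤ (flipped? π π′ a b) λ f → [
      (λ s → ℕ.≤-trans (ℕ.≤-reflexive (sym (𝟙-yes (up? z a b) s))) (ℕ.m≤m+n _ _)) ,
      (λ s → ℕ.≤-trans (ℕ.≤-reflexive (sym (𝟙-yes (down? z b a) s))) (ℕ.m≤n+m _ _)) ]′ (flipped⇒ z∈ f)

    up+down≤ : ∀ z x u → 𝟙 (up? z x u) ℕ.+ 𝟙 (down? z x u) ℕ.≤ S u x z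
    up+down≤ z x u with x ≺[ π ]? u
    ... | yes lt = ℕ.≤-trans (ℕ.≤-reflexive (trans (cong (𝟙 (up? z x u) ℕ.+_)
                     (𝟙-no (down? z x u) λ (_ , gt) → ≺-asym π lt gt)) (ℕ.+-identityʳ _)))
                   (𝟙-mono (up? z x u) (separates? π X Z u x z) proj₁)
    ... | no ≮   = ℕ.≤-trans (ℕ.≤-reflexive (cong (ℕ._+ 𝟙 (down? z x u))
                     (𝟙-no (up? z x u) λ (_ , lt) → ≮ lt)))
                   (𝟙-mono (down? z x u) (separates? π X Z u x z) proj₁)

    bound : ∀ {z} → z ∈ Z → inversions π π′ ℕ.≤ sum λ u → sum λ x → S u x z
    bound {z} z∈ = begin
      inversions π π′
        ≤⟨ (sum-mono λ a → sum-mono λ b → flips≤ z∈ a b) ⟩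
      (sum λ a → sum λ b → 𝟙 (up? z a b) ℕ.+ 𝟙 (down? z b a))
        ≡⟨ (sum-cong-≗ λ a → ∑-distrib-+ (λ b → 𝟙 (up? z a b)) (λ b → 𝟙 (down? z b a))) ⟩
      (sum λ a → (sum λ b → 𝟙 (up? z a b)) ℕ.+ (sum λ b → 𝟙 (down? z b a)))
        ≡⟨ ∑-distrib-+ (λ a → sum λ b → 𝟙 (up? z a b)) (λ a → sum λ b → 𝟙 (down? z b a)) ⟩
      (sum λ a → sum λ b → 𝟙 (up? z a b)) ℕ.+ (sum λ a → sum λ b → 𝟙 (down? z b a))
        ≡⟨ cong (ℕ._+ (sum λ a → sum λ b → 𝟙 (down? z b a))) (∑-comm λ a b → 𝟙 (up? z a b)) ⟩
      (sum λ u → sum λ x → 𝟙 (up? z x u)) ℕ.+ (sum λ u → sum λ x → 𝟙 (down? z x u))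
        ≡⟨ ∑-distrib-+ (λ u → sum λ x → 𝟙 (up? z x u)) (λ u → sum λ x → 𝟙 (down? z x u)) ⟨
      (sum λ u → (sum λ x → 𝟙 (up? z x u)) ℕ.+ (sum λ x → 𝟙 (down? z x u)))
        ≡⟨ (sum-cong-≗ λ u → ∑-distrib-+ (λ x → 𝟙 (up? z x u)) (λ x → 𝟙 (down? z x u))) ⟨
      (sum λ u → sum λ x → 𝟙 (up? z x u) ℕ.+ 𝟙 (down? z x u))
        ≤⟨ (sum-mono λ u → sum-mono λ x → up+down≤ z x u) ⟩
      (sum λ u → sum λ x → S u x z) ∎
      where open ℕ.≤-Reasoning

-- Averaging over the two moves

module _ {X Z : Subset n} (disj : Disjoint X Z) where

  sum-split : ∀ {g : Fin n → ℕ} {c d} r → (∀ a → g a ≡ 𝟙 (a ∈? X) ℕ.* c ℕ.+ 𝟙 (a ∈? Z) ℕ.* d ℕ.+ r a) →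
              sum g ≡ ∣ X ∣ ℕ.* c ℕ.+ ∣ Z ∣ ℕ.* d ℕ.+ sum r
  sum-split {g} {c} {d} r e = begin
    sum g
      ≡⟨ sum-cong-≗ e ⟩
    (sum λ a → 𝟙 (a ∈? X) ℕ.* c ℕ.+ 𝟙 (a ∈? Z) ℕ.* d ℕ.+ r a)
      ≡⟨ ∑-distrib-+ (λ a → 𝟙 (a ∈? X) ℕ.* c ℕ.+ 𝟙 (a ∈? Z) ℕ.* d) r ⟩
    (sum λ a → 𝟙 (a ∈? X) ℕ.* c ℕ.+ 𝟙 (a ∈? Z) ℕ.* d) ℕ.+ sum r
      ≡⟨ cong (ℕ._+ sum r) (∑-distrib-+ (λ a → 𝟙 (a ∈? X) ℕ.* c) (λ a → 𝟙 (a ∈? Z) ℕ.* d)) ⟩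
    (sum λ a → 𝟙 (a ∈? X) ℕ.* c) ℕ.+ (sum λ a → 𝟙 (a ∈? Z) ℕ.* d) ℕ.+ sum r
      ≡⟨ cong (ℕ._+ sum r) (cong₂ ℕ._+_ (block X c) (block Z d)) ⟩
    ∣ X ∣ ℕ.* c ℕ.+ ∣ Z ∣ ℕ.* d ℕ.+ sum r ∎
    where
    open ≡-Reasoning
    block : ∀ Y b → (sum λ a → 𝟙 (a ∈? Y) ℕ.* b) ≡ ∣ Y ∣ ℕ.* b
    block Y b = trans (sym (*-distribʳ-sum b (λ a → 𝟙 (a ∈? Y)))) (cong (ℕ._* b) (sym (card≡sum Y)))

  -- On the whole of `X ∪ Z`, `f′` has the value p of `f` on `Z`, and `f″` the value q of `f` on
  -- `X`. The weighted sum there is |Z| (|X| + |Z|) p + |X| (|X| + |Z|) q, which is |X| + |Z| times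
  -- the share |X| q + |Z| p of the block in the sum of `f`.
  weighted-average : ∀ {x₀ z₀} → x₀ ∈ X → z₀ ∈ Z → (f f′ f″ : Fin n → ℕ) →
    (∀ {a} → a ∉ X → a ∉ Z → f′ a ≡ f a) → (∀ {a} → a ∉ X → a ∉ Z → f″ a ≡ f a) →
    (∀ {w z} → w ∈ X ⊎ w ∈ Z → z ∈ Z → f′ w ≡ f z) → (∀ {w x} → w ∈ Z ⊎ w ∈ X → x ∈ X → f″ w ≡ f x) →
    ∣ Z ∣ ℕ.* sum f′ ℕ.+ ∣ X ∣ ℕ.* sum f″ ≡ (∣ X ∣ ℕ.+ ∣ Z ∣) ℕ.* sum f
  weighted-average {x₀} {z₀} x₀∈ z₀∈ f f′ f″ out′ out″ in′ in″ = begin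
    ∣ Z ∣ ℕ.* sum f′ ℕ.+ ∣ X ∣ ℕ.* sum f″
      ≡⟨ cong₂ (λ s t → ∣ Z ∣ ℕ.* s ℕ.+ ∣ X ∣ ℕ.* t) (sum-split r split′) (sum-split r split″) ⟩
    ∣ Z ∣ ℕ.* (∣ X ∣ ℕ.* p ℕ.+ ∣ Z ∣ ℕ.* p ℕ.+ sum r) ℕ.+ ∣ X ∣ ℕ.* (∣ X ∣ ℕ.* q ℕ.+ ∣ Z ∣ ℕ.* q ℕ.+ sum r)
      ≡⟨ identity ∣ X ∣ ∣ Z ∣ p q (sum r) ⟩
    (∣ X ∣ ℕ.+ ∣ Z ∣) ℕ.* (∣ X ∣ ℕ.* q ℕ.+ ∣ Z ∣ ℕ.* p ℕ.+ sum r)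
      ≡⟨ cong ((∣ X ∣ ℕ.+ ∣ Z ∣) ℕ.*_) (sum-split r split) ⟨
    (∣ X ∣ ℕ.+ ∣ Z ∣) ℕ.* sum f ∎
    where
    open ≡-Reasoning
    p = f z₀
    q = f x₀
    r : Fin n → ℕ
    r a = if does (a ∈? X) then 0 else if does (a ∈? Z) then 0 else f a
    identity : ∀ x z p q r → z ℕ.* (x ℕ.* p ℕ.+ z ℕ.* p ℕ.+ r) ℕ.+ x ℕ.* (x ℕ.* q ℕ.+ z ℕ.* q ℕ.+ r)
                           ≡ (x ℕ.+ z) ℕ.* (x ℕ.* q ℕ.+ z ℕ.* p ℕ.+ r)
    identity = ℕ-Solver.solve-∀
    on-X : ∀ b → b ≡ 1 ℕ.* b ℕ.+ 0 ℕ.+ 0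
    on-X = ℕ-Solver.solve-∀
    on-Z : ∀ b → b ≡ 1 ℕ.* b ℕ.+ 0
    on-Z = ℕ-Solver.solve-∀
    -- `f` is constant on `X` because `f″ x₀` equals its value at every node of `X`, and constant on
    -- `Z` likewise through `f′ z₀`.
    split : ∀ a → f a ≡ 𝟙 (a ∈? X) ℕ.* q ℕ.+ 𝟙 (a ∈? Z) ℕ.* p ℕ.+ r a
    split a with a ∈? X | a ∈? Z
    ... | yes a∈X | yes a∈Z = contradiction a∈Z (disj a∈X)
    ... | yes a∈X | no _    = trans (trans (sym (in″ (inj₂ x₀∈) a∈X)) (in″ (inj₂ x₀∈) x₀∈)) (on-X q)
    ... | no _    | yes a∈Z = trans (trans (sym (in′ (inj₂ z₀∈) a∈Z)) (in′ (inj₂ z₀∈) z₀∈)) (on-Z p)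
    ... | no _    | no _    = refl
    split′ : ∀ a → f′ a ≡ 𝟙 (a ∈? X) ℕ.* p ℕ.+ 𝟙 (a ∈? Z) ℕ.* p ℕ.+ r a
    split′ a with a ∈? X | a ∈? Z
    ... | yes a∈X | yes a∈Z = contradiction a∈Z (disj a∈X)
    ... | yes a∈X | no _    = trans (in′ (inj₁ a∈X) z₀∈) (on-X p)
    ... | no _    | yes a∈Z = trans (in′ (inj₂ a∈Z) z₀∈) (on-Z p)
    ... | no a∉X  | no a∉Z  = out′ a∉X a∉Z
    split″ : ∀ a → f″ a ≡ 𝟙 (a ∈? X) ℕ.* q ℕ.+ 𝟙 (a ∈? Z) ℕ.* q ℕ.+ r a
    split″ a with a ∈? X | a ∈? Z
    ... | yes a∈X | yes a∈Z = contradiction a∈Z (disj a∈X)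
    ... | yes a∈X | no _    = trans (in″ (inj₂ a∈X) x₀∈) (on-X q)
    ... | no _    | yes a∈Z = trans (in″ (inj₁ a∈Z) x₀∈) (on-Z q)
    ... | no a∉X  | no a∉Z  = out″ a∉X a∉Z

Disjoint-sym : {X Z : Subset n} → Disjoint X Z → Disjoint Z X
Disjoint-sym disj v∈Z v∈X = disj v∈X v∈Z

SameSide : Subset n → Fin n → Fin n → Set
SameSide A a b = (a ∈ A → b ∈ A) × (b ∈ A → a ∈ A)

module _ {X Z A C : Subset n} {π π′ : Permutation′ n} where

  -- Both ends lie outside `X ∪ Z`, so every comparison involved is one with `u`, and in π it is
  -- answered by `v`.
  separates-middle : Disjoint A X → Disjoint A Z → Disjoint C X → Disjoint C Z →
    ∀ {u v} → Represents X Z π π′ u v → SameSide A u v → SameSide C u v → ∀ x z →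
    𝟙 (separates? π′ A C u x z) ≡ 𝟙 (separates? π A C v x z)
  separates-middle AX AZ CX CZ {u} {v} rep (uA , vA) (uC , vC) x z =
    𝟙-cong (separates? π′ A C u x z) (separates? π A C v x z)
      (λ (x∈ , z∈ , u∉A , u∉C , b) → x∈ , z∈ , u∉A ∘ vA , u∉C ∘ vC , to x∈ z∈ b)
      (λ (x∈ , z∈ , v∉A , v∉C , b) → x∈ , z∈ , v∉A ∘ uA , v∉C ∘ uC , from x∈ z∈ b)
    where
    to : x ∈ A → z ∈ C → Between π′ x u z → Between π x v z
    to x∈ z∈ (inj₁ (x≺u , u≺z)) = inj₁ (right rep (AX x∈) (AZ x∈) x≺u , left rep (CX z∈) (CZ z∈) u≺z)
    to x∈ z∈ (inj₂ (z≺u , u≺x)) = inj₂ (right rep (CX z∈) (CZ z∈) z≺u , left rep (AX x∈) (AZ x∈) u≺x)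
    from : x ∈ A → z ∈ C → Between π x v z → Between π′ x u z
    from x∈ z∈ (inj₁ (x≺u , u≺z)) = inj₁ (right⁻ rep (AX x∈) (AZ x∈) x≺u , left⁻ rep (CX z∈) (CZ z∈) u≺z)
    from x∈ z∈ (inj₂ (z≺u , u≺x)) = inj₂ (right⁻ rep (CX z∈) (CZ z∈) z≺u , left⁻ rep (AX x∈) (AZ x∈) u≺x)

  -- `u` and `z` lie outside the moving block and keep their order; `u` also avoids `X ∪ Z`, so `y`
  -- answers for `x` in the other comparison.
  separates-end : Moved X Z π π′ → X ⊆ A → Z ⊆ A → Disjoint C X →
    ∀ {x y} → Represents X Z π π′ x y → SameSide A x y → ∀ u z →
    𝟙 (separates? π′ A C u x z) ≡ 𝟙 (separates? π A C u y z)
  separates-end moved X⊆A Z⊆A CX {x} {y} rep (xA , yA) u z =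
    𝟙-cong (separates? π′ A C u x z) (separates? π A C u y z)
      (λ (x∈ , z∈ , u∉A , u∉C , b) → xA x∈ , z∈ , u∉A , u∉C , to (u∉A ∘ X⊆A) (u∉A ∘ Z⊆A) (CX z∈) b)
      (λ (y∈ , z∈ , u∉A , u∉C , b) → yA y∈ , z∈ , u∉A , u∉C , from (u∉A ∘ X⊆A) (u∉A ∘ Z⊆A) (CX z∈) b)
    where
    open Moved moved
    to : u ∉ X → u ∉ Z → z ∉ X → Between π′ x u z → Between π y u z
    to u∉X u∉Z z∉X (inj₁ (x≺u , u≺z)) = inj₁ (left rep u∉X u∉Z x≺u , keep⁻ u∉X z∉X u≺z)
    to u∉X u∉Z z∉X (inj₂ (z≺u , u≺x)) = inj₂ (keep⁻ z∉X u∉X z≺u , right rep u∉X u∉Z u≺x)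
    from : u ∉ X → u ∉ Z → z ∉ X → Between π y u z → Between π′ x u z
    from u∉X u∉Z z∉X (inj₁ (x≺u , u≺z)) = inj₁ (left⁻ rep u∉X u∉Z x≺u , keep u∉X z∉X u≺z)
    from u∉X u∉Z z∉X (inj₂ (z≺u , u≺x)) = inj₂ (keep z∉X u∉X z≺u , right⁻ rep u∉X u∉Z u≺x)

Unsplit : Subset n → Subset n → Subset n → Set
Unsplit X Z A = ∀ {v w} → v ∈ X ⊎ v ∈ Z → w ∈ X ⊎ w ∈ Z → v ∈ A → w ∈ A

module Averaging {X Z : Subset n} {π π′ π″ : Permutation′ n}
  (disj : Disjoint X Z) (contigX : Contiguous π X) (contigZ : Contiguous π Z)
  (moved′ : Moved X Z π π′) (moved″ : Moved Z X π π″)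
  {x₀ z₀} (x₀∈ : x₀ ∈ X) (z₀∈ : z₀ ∈ Z) where

  private
    module M′ = Representatives moved′ disj contigZ
    module M″ = Representatives moved″ (Disjoint-sym disj) contigX

    same : ∀ {A} → Unsplit X Z A → ∀ {v w} → v ∈ X ⊎ v ∈ Z → w ∈ X ⊎ w ∈ Z → SameSide A v w
    same un v∈ w∈ = un v∈ w∈ , un w∈ v∈

    avoid : ∀ {A v} → Unsplit X Z A → v ∈ X ⊎ v ∈ Z → v ∉ A → Disjoint A X × Disjoint A Z
    avoid un v∈ v∉ = (λ w∈A w∈X → v∉ (un (inj₁ w∈X) v∈ w∈A)) , (λ w∈A w∈Z → v∉ (un (inj₂ w∈Z) v∈ w∈A))

    average-end : ∀ {A C} → Unsplit X Z A → Unsplit X Z C → Disjoint A C → x₀ ∈ A →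
      ∣ Z ∣ ℕ.* separations π′ A C ℕ.+ ∣ X ∣ ℕ.* separations π″ A C ≡ (∣ X ∣ ℕ.+ ∣ Z ∣) ℕ.* separations π A C
    average-end {A} {C} unA unC AC x₀∈A = begin
      ∣ Z ∣ ℕ.* separations π′ A C ℕ.+ ∣ X ∣ ℕ.* separations π″ A C
        ≡⟨ cong₂ (λ s t → ∣ Z ∣ ℕ.* s ℕ.+ ∣ X ∣ ℕ.* t) (reorder π′) (reorder π″) ⟩
      ∣ Z ∣ ℕ.* sum (f π′) ℕ.+ ∣ X ∣ ℕ.* sum (f π″)
        ≡⟨ weighted-average disj x₀∈ z₀∈ (f π) (f π′) (f π″)
             (λ a∉X a∉Z → end′ (M′.represents-self a∉X) (id , id))
             (λ a∉X a∉Z → end″ (M″.represents-self a∉Z) (id , id))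
             (λ w∈ z∈ → end′ (M′.represents w∈ z∈) (same {A} unA w∈ (inj₂ z∈)))
             (λ w∈ x∈ → end″ (M″.represents w∈ x∈) (same {A} unA (swap w∈) (inj₁ x∈))) ⟩
      (∣ X ∣ ℕ.+ ∣ Z ∣) ℕ.* sum (f π)
        ≡⟨ cong ((∣ X ∣ ℕ.+ ∣ Z ∣) ℕ.*_) (reorder π) ⟨
      (∣ X ∣ ℕ.+ ∣ Z ∣) ℕ.* separations π A C ∎
      where
      open ≡-Reasoning
      f : Permutation′ n → Fin n → ℕ
      f ρ x = sum λ u → sum λ z → 𝟙 (separates? ρ A C u x z)
      reorder : ∀ ρ → separations ρ A C ≡ sum (f ρ)
      reorder ρ = ∑-comm λ u x → sum λ z → 𝟙 (separates? ρ A C u x z)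
      X⊆A : X ⊆ A
      X⊆A x∈ = unA (inj₁ x₀∈) (inj₁ x∈) x₀∈A
      Z⊆A : Z ⊆ A
      Z⊆A z∈ = unA (inj₁ x₀∈) (inj₂ z∈) x₀∈A
      end′ : ∀ {x y} → Represents X Z π π′ x y → SameSide A x y → f π′ x ≡ f π y
      end′ rep s = sum-cong-≗ λ u → sum-cong-≗ λ z →
        separates-end {A = A} {C} moved′ X⊆A Z⊆A (λ v∈C v∈X → AC (X⊆A v∈X) v∈C) rep s u z
      end″ : ∀ {x y} → Represents Z X π π″ x y → SameSide A x y → f π″ x ≡ f π y
      end″ rep s = sum-cong-≗ λ u → sum-cong-≗ λ z →
        separates-end {A = A} {C} moved″ Z⊆A X⊆A (λ v∈C v∈Z → AC (Z⊆A v∈Z) v∈C) rep s u z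

    average-middle : ∀ {A C} → Unsplit X Z A → Unsplit X Z C → x₀ ∉ A → x₀ ∉ C →
      ∣ Z ∣ ℕ.* separations π′ A C ℕ.+ ∣ X ∣ ℕ.* separations π″ A C ≡ (∣ X ∣ ℕ.+ ∣ Z ∣) ℕ.* separations π A C
    average-middle {A} {C} unA unC x₀∉A x₀∉C = weighted-average disj x₀∈ z₀∈ (f π) (f π′) (f π″)
      (λ a∉X a∉Z → mid′ (M′.represents-self a∉X) (id , id) (id , id))
      (λ a∉X a∉Z → mid″ (M″.represents-self a∉Z) (id , id) (id , id))
      (λ w∈ z∈ → mid′ (M′.represents w∈ z∈) (same {A} unA w∈ (inj₂ z∈)) (same {C} unC w∈ (inj₂ z∈)))
      (λ w∈ x∈ → mid″ (M″.represents w∈ x∈) (same {A} unA (swap w∈) (inj₁ x∈)) (same {C} unC (swap w∈) (inj₁ x∈)))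
      where
      f : Permutation′ n → Fin n → ℕ
      f ρ u = sum λ x → sum λ z → 𝟙 (separates? ρ A C u x z)
      A∩ = avoid {A} unA (inj₁ x₀∈) x₀∉A
      C∩ = avoid {C} unC (inj₁ x₀∈) x₀∉C
      mid′ : ∀ {u v} → Represents X Z π π′ u v → SameSide A u v → SameSide C u v → f π′ u ≡ f π v
      mid′ rep sA sC = sum-cong-≗ λ x → sum-cong-≗ λ z →
        separates-middle {A = A} {C} (proj₁ A∩) (proj₂ A∩) (proj₁ C∩) (proj₂ C∩) rep sA sC x z
      mid″ : ∀ {u v} → Represents Z X π π″ u v → SameSide A u v → SameSide C u v → f π″ u ≡ f π v
      mid″ rep sA sC = sum-cong-≗ λ x → sum-cong-≗ λ z →
        separates-middle {A = A} {C} (proj₂ A∩) (proj₁ A∩) (proj₂ C∩) (proj₁ C∩) rep sA sC x z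

  -- The cases are the roles that a node of `X ∪ Z` can have in a separation of `A` and `C`: an end
  -- in `A`, an end in `C`, or the middle. The sum over that one role is put outermost and averaged;
  -- as `A` and `C` are unsplit, `x₀` speaks for the whole block.
  average-separations : ∀ {A C} → Unsplit X Z A → Unsplit X Z C → Disjoint A C →
    ∣ Z ∣ ℕ.* separations π′ A C ℕ.+ ∣ X ∣ ℕ.* separations π″ A C ≡ (∣ X ∣ ℕ.+ ∣ Z ∣) ℕ.* separations π A C
  average-separations {A} {C} unA unC AC with x₀ ∈? A | x₀ ∈? C
  ... | yes x₀∈A | _        = average-end {A} {C} unA unC AC x₀∈A
  ... | no x₀∉A  | no x₀∉C  = average-middle {A} {C} unA unC x₀∉A x₀∉C
  ... | no _     | yes x₀∈C = begin
      ∣ Z ∣ ℕ.* separations π′ A C ℕ.+ ∣ X ∣ ℕ.* separations π″ A C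
        ≡⟨ cong₂ (λ s t → ∣ Z ∣ ℕ.* s ℕ.+ ∣ X ∣ ℕ.* t) (separations-sym π′ A C) (separations-sym π″ A C) ⟩
      ∣ Z ∣ ℕ.* separations π′ C A ℕ.+ ∣ X ∣ ℕ.* separations π″ C A
        ≡⟨ average-end {C} {A} unC unA (Disjoint-sym AC) x₀∈C ⟩
      (∣ X ∣ ℕ.+ ∣ Z ∣) ℕ.* separations π C A
        ≡⟨ cong ((∣ X ∣ ℕ.+ ∣ Z ∣) ℕ.*_) (separations-sym π A C) ⟨
      (∣ X ∣ ℕ.+ ∣ Z ∣) ℕ.* separations π A C ∎
    where open ≡-Reasoning

-- Contiguity of cliques, under the moves of `Rand` and in MinLAs

clique-closed : ∀ {G : Graph n} {C a b} → IsCliqueOf G C → Edge G a b → a ∈ C → b ∈ C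
clique-closed {C = C} {b = b} cC e a∈ with b ∈? C
... | yes b∈ = b∈
... | no b∉  = contradiction e (isolated cC a∈ b∉)

clique-⊆ : ∀ {G : Graph n} {X Y v} → IsCliqueOf G X → IsCliqueOf G Y → v ∈ X → v ∈ Y → X ⊆ Y
clique-⊆ {Y = Y} {v} cX cY v∈X v∈Y {w} w∈X with w ∈? Y
... | yes w∈Y = w∈Y
... | no w∉Y  = contradiction (complete cX v∈X w∈X (∈∉⇒≢ v∈Y w∉Y)) (isolated cY v∈Y w∉Y)

cliques-disjoint : ∀ {G : Graph n} {X Z} → IsCliqueOf G X → IsCliqueOf G Z → X ≢ Z → Disjoint X Z
cliques-disjoint cX cZ X≢Z v∈X v∈Z = X≢Z (⊆-antisym (clique-⊆ cX cZ v∈X v∈Z) (clique-⊆ cZ cX v∈Z v∈X))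

-- The invariant of `Rand`: every clique is contiguous. Phrased through edges, it is vacuous for the
-- edgeless graph at the start.
EdgesContiguous : Permutation′ n → Graph n → Set
EdgesContiguous π G = ∀ {x u w} → Edge G x w → x ≺[ π ] u → u ≺[ π ] w → Edge G x u

clique-contiguous : ∀ {π : Permutation′ n} {G C} → EdgesContiguous π G → IsCliqueOf G C → Contiguous π C
clique-contiguous {π = π} {G} {C} contig cC {x} {y} {z} x∈ z∈ x≺y y≺z with y ∈? C
... | yes y∈ = y∈
... | no y∉  = contradiction
  (contig (complete cC x∈ z∈ λ x≡z → ≺-irrefl π x≡z (ℕ.<-trans x≺y y≺z)) x≺y y≺z) (isolated cC x∈ y∉)

-- A node `z₀` of `Z` stands for the merged block in π. An outside node within the block would lie
-- on both sides of `z₀`; a node of `X` between two nodes of a third clique would put `z₀` between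
-- them in π.
merged-contiguous : ∀ {π π′ : Permutation′ n} {G X Z} → IsCliqueOf G X → IsCliqueOf G Z → X ≢ Z →
                    EdgesContiguous π G → Moved X Z π π′ → EdgesContiguous π′ (mergeCliques G X Z)
merged-contiguous {n = n} {π} {π′} {G} {X} {Z} cX cZ X≢Z contig moved {x} {u} {w} edge x≺u u≺w = go edge
  where
  open Moved moved
  disj : Disjoint X Z
  disj = cliques-disjoint cX cZ X≢Z
  open Representatives moved disj (clique-contiguous {π = π} contig cZ)
  z₀ = proj₁ (nonempty cZ)
  z₀∈ = proj₂ (nonempty cZ)
  inside-merged : x ∈ X ∪ Z → w ∈ X ∪ Z → Edge (mergeCliques G X Z) x u
  inside-merged x∈ w∈ = inj₂ ((λ x≡u → ≺-irrefl π′ x≡u x≺u) , x∈ , u∈)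
    where
    u∈ : u ∈ X ∪ Z
    u∈ with u ∈? X | u ∈? Z
    ... | yes u∈X | _       = x∈p∪q⁺ (inj₁ u∈X)
    ... | no _    | yes u∈Z = x∈p∪q⁺ (inj₂ u∈Z)
    ... | no u∉X  | no u∉Z  = contradiction
      (left (represents (x∈p∪q⁻ X Z x∈) z₀∈) u∉X u∉Z x≺u)
      (≺-asym π (right (represents (x∈p∪q⁻ X Z w∈) z₀∈) u∉X u∉Z u≺w))
  go : Edge (mergeCliques G X Z) x w → Edge (mergeCliques G X Z) x u
  go (inj₂ (_ , x∈ , w∈)) = inside-merged x∈ w∈
  go (inj₁ e) with x ∈? X | x ∈? Z
  ... | yes x∈X | _ = inside-merged (x∈p∪q⁺ (inj₁ x∈X)) (x∈p∪q⁺ (inj₁ (clique-closed cX e x∈X)))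
  ... | no _ | yes x∈Z = inside-merged (x∈p∪q⁺ (inj₂ x∈Z)) (x∈p∪q⁺ (inj₂ (clique-closed cZ e x∈Z)))
  ... | no x∉X | no x∉Z = inj₁ (outside-merged (u ∈? X))
    where
    w∉X : w ∉ X
    w∉X = x∉X ∘ clique-closed cX (sym-E G e)
    w∉Z : w ∉ Z
    w∉Z = x∉Z ∘ clique-closed cZ (sym-E G e)
    outside-merged : Dec (u ∈ X) → Edge G x u
    outside-merged (no u∉X)  = contig e (keep⁻ x∉X u∉X x≺u) (keep⁻ u∉X w∉X u≺w)
    outside-merged (yes u∈X) = contradiction
      (clique-closed cZ (sym-E G (contig e (right (represents (inj₁ u∈X) z₀∈) x∉X x∉Z x≺u)
                                   (left (represents (inj₁ u∈X) z₀∈) w∉X w∉Z u≺w))) z₀∈) x∉Z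

merge-comm : ∀ {G : Graph n} {X Z x y} → Edge (mergeCliques G X Z) x y → Edge (mergeCliques G Z X) x y
merge-comm (inj₁ e) = inj₁ e
merge-comm {X = X} {Z} (inj₂ (x≢y , x∈ , y∈)) =
  inj₂ (x≢y , x∈p∪q⁺ (swap (x∈p∪q⁻ X Z x∈)) , x∈p∪q⁺ (swap (x∈p∪q⁻ X Z y∈)))

-- Half-open, so that the number of such w is exactly the distance of x
-- and y.
Spans : Permutation′ n → Fin n → Fin n → Fin n → Set
Spans π x y w = (¬ w ≺[ π ] x × w ≺[ π ] y) ⊎ (¬ w ≺[ π ] y × w ≺[ π ] x)

spans? : ∀ (π : Permutation′ n) x y w → Dec (Spans π x y w)
spans? π x y w = (¬? (w ≺[ π ]? x) ×-dec (w ≺[ π ]? y)) ⊎-dec (¬? (w ≺[ π ]? y) ×-dec (w ≺[ π ]? x))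

-- Positions count predecessors: if `x` comes first, the predecessors of `y` are those of `x`
-- together with the spanning nodes.
distance≡spans : ∀ (π : Permutation′ n) x y →
                 ∣ toℕ (π ⟨$⟩ʳ x) - toℕ (π ⟨$⟩ʳ y) ∣ ≡ sum λ w → 𝟙 (spans? π x y w)
distance≡spans π x y with x ≟ y
... | yes refl = trans (ℕ.∣n-n∣≡0 (toℕ (π ⟨$⟩ʳ x))) (sym (sum-zero λ w → 𝟙-no (spans? π x x w)
    [ (λ (w⊀x , w≺x) → w⊀x w≺x) , (λ (w⊀x , w≺x) → w⊀x w≺x) ]′))
... | no x≢y = [ ordered , (λ y≺x → trans (ℕ.∣-∣-comm (toℕ (π ⟨$⟩ʳ x)) (toℕ (π ⟨$⟩ʳ y))) (trans (ordered y≺x)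
    (sum-cong-≗ λ w → 𝟙-cong (spans? π y x w) (spans? π x y w) swap swap))) ]′ (≺-connex π x≢y)
  where
  ordered : ∀ {x y} → x ≺[ π ] y → ∣ toℕ (π ⟨$⟩ʳ x) - toℕ (π ⟨$⟩ʳ y) ∣ ≡ sum λ w → 𝟙 (spans? π x y w)
  ordered {x} {y} x≺y = trans (cong ∣ toℕ (π ⟨$⟩ʳ x) -_∣ upper) (ℕ.∣m-m+n∣≡n (toℕ (π ⟨$⟩ʳ x)) _)
    where
    pointwise : ∀ w → 𝟙 (w ≺[ π ]? y) ≡ 𝟙 (w ≺[ π ]? x) ℕ.+ 𝟙 (spans? π x y w)
    pointwise w = go (w ≺[ π ]? x)
      where
      go : Dec (w ≺[ π ] x) → 𝟙 (w ≺[ π ]? y) ≡ 𝟙 (w ≺[ π ]? x) ℕ.+ 𝟙 (spans? π x y w)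
      go (yes w≺x) = trans (𝟙-yes (w ≺[ π ]? y) (ℕ.<-trans w≺x x≺y)) (sym (cong₂ ℕ._+_
        (𝟙-yes (w ≺[ π ]? x) w≺x)
        (𝟙-no (spans? π x y w) [ (λ (w⊀x , _) → w⊀x w≺x) , (λ (w⊀y , _) → w⊀y (ℕ.<-trans w≺x x≺y)) ]′)))
      go (no w⊀x) = sym (cong₂ ℕ._+_ (𝟙-no (w ≺[ π ]? x) w⊀x)
        (𝟙-cong (spans? π x y w) (w ≺[ π ]? y)
          [ proj₂ , (λ (_ , w≺x) → contradiction w≺x w⊀x) ]′ (λ w≺y → inj₁ (w⊀x , w≺y))))
    upper : toℕ (π ⟨$⟩ʳ y) ≡ toℕ (π ⟨$⟩ʳ x) ℕ.+ sum λ w → 𝟙 (spans? π x y w)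
    upper = trans (position π y) (trans (sum-cong-≗ pointwise) (trans
      (∑-distrib-+ (λ w → 𝟙 (w ≺[ π ]? x)) (λ w → 𝟙 (spans? π x y w)))
      (cong (ℕ._+ sum λ w → 𝟙 (spans? π x y w)) (sym (position π x)))))

if-mono : ∀ {a b} (d : Dec P) → (P → a ℕ.≤ b) → (if does d then a else 0) ℕ.≤ (if does d then b else 0)
if-mono (yes p) le = le p
if-mono (no _)  _  = z≤n

if-mono-< : ∀ {a b} (d : Dec P) → P → a ℕ.< b → (if does d then a else 0) ℕ.< (if does d then b else 0)
if-mono-< (yes _) _ lt = lt
if-mono-< (no ¬p) p _  = contradiction p ¬p

arrangementCost-< : ∀ (G : Graph n) (π ρ : Permutation′ n) →
  let dist = λ τ a b → ∣ toℕ (τ ⟨$⟩ʳ a) - toℕ (τ ⟨$⟩ʳ b) ∣ in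
  (∀ {a b} → Edge G a b → dist ρ a b ℕ.≤ dist π a b) →
  ∀ {a b} → Edge G a b → dist ρ a b ℕ.< dist π a b → arrangementCost G ρ ℕ.< arrangementCost G π
arrangementCost-< G π ρ le {a} {b} e lt with <-cmp a b
... | tri< a<b _ _ = sum-mono-< (λ x → sum-mono λ y → if-mono ((x <? y) ×-dec edge? G x y) (le ∘ proj₂)) a
      (sum-mono-< (λ y → if-mono ((a <? y) ×-dec edge? G a y) (le ∘ proj₂)) b
        (if-mono-< ((a <? b) ×-dec edge? G a b) (a<b , e) lt))
... | tri≈ _ refl _ = contradiction e (irrefl G)
... | tri> _ _ b<a = sum-mono-< (λ x → sum-mono λ y → if-mono ((x <? y) ×-dec edge? G x y) (le ∘ proj₂)) b
      (sum-mono-< (λ y → if-mono ((b <? y) ×-dec edge? G b y) (le ∘ proj₂)) a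
        (if-mono-< ((b <? a) ×-dec edge? G b a) (b<a , sym-E G e)
          (subst₂ ℕ._<_ (ℕ.∣-∣-comm (toℕ (ρ ⟨$⟩ʳ a)) (toℕ (ρ ⟨$⟩ʳ b)))
                        (ℕ.∣-∣-comm (toℕ (π ⟨$⟩ʳ a)) (toℕ (π ⟨$⟩ʳ b))) lt)))

gather : ∀ (π : Permutation′ n) C → ∃ λ ρ → (∀ {a b} → a ∈ C → b ∉ C → a ≺[ ρ ] b) ×
         (∀ {a b} → SameSide C a b → a ≺[ π ] b → a ≺[ ρ ] b)
gather {n} π C = sorted ,
  (λ {a} {b} a∈ b∉ → lex-< {a} {b} (subst₂ _<_ (sym (s-∈ a∈)) (sym (s-∉ b∉)) (s≤s z≤n))) ,
  (λ {a} {b} same → lex-≡ {a} {b} (s-same same))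
  where
  s : Fin n → Fin 2
  s v = if does (v ∈? C) then 0F else 1F
  s-∈ : ∀ {v} → v ∈ C → s v ≡ 0F
  s-∈ {v} v∈ rewrite dec-true (v ∈? C) v∈ = refl
  s-∉ : ∀ {v} → v ∉ C → s v ≡ 1F
  s-∉ {v} v∉ rewrite dec-false (v ∈? C) v∉ = refl
  s-same : ∀ {a b} → SameSide C a b → s a ≡ s b
  s-same {a} (aC , bC) with a ∈? C
  ... | yes a∈ = sym (s-∈ (aC a∈))
  ... | no a∉  = sym (s-∉ (a∉ ∘ bC))
  open Lexicographic π s

module _ {G : Graph n} {π C} (minLA : IsMinLA G π) (cC : IsCliqueOf G C) (ρ : Permutation′ n)
  (apart : ∀ {a b} → a ∈ C → b ∉ C → a ≺[ ρ ] b)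
  (alike : ∀ {a b} → SameSide C a b → a ≺[ π ] b → a ≺[ ρ ] b) where

  alike⁻ : ∀ {a b} → SameSide C a b → a ≺[ ρ ] b → a ≺[ π ] b
  alike⁻ (aC , bC) lt = [ id , (λ b≺a → contradiction (alike (bC , aC) b≺a) (≺-asym ρ lt)) ]′
    (≺-connex π λ a≡b → ≺-irrefl ρ a≡b lt)

  -- In ρ all of `C` precedes all the rest, so what lies between two nodes on the same side of `C`
  -- is on that side too, where ρ keeps the order of π. Every edge joins such nodes, since none
  -- leaves a clique.
  spans-half : ∀ {a b w} → SameSide C a b → ¬ w ≺[ ρ ] a → w ≺[ ρ ] b → ¬ w ≺[ π ] a × w ≺[ π ] b
  spans-half {a} {b} {w} (aC , bC) w⊀a w≺b = go (w ∈? C) (b ∈? C)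
    where
    go : Dec (w ∈ C) → Dec (b ∈ C) → ¬ w ≺[ π ] a × w ≺[ π ] b
    go (yes w∈) (yes b∈) = w⊀a ∘ alike ((λ _ → bC b∈) , (λ _ → w∈)) , alike⁻ ((λ _ → b∈) , (λ _ → w∈)) w≺b
    go (yes w∈) (no b∉)  = contradiction (apart w∈ (b∉ ∘ aC)) w⊀a
    go (no w∉)  (yes b∈) = contradiction (apart b∈ w∉) (≺-asym ρ w≺b)
    go (no w∉)  (no b∉)  =
      w⊀a ∘ alike ((λ w∈ → contradiction w∈ w∉) , (λ a∈ → contradiction (aC a∈) b∉)) ,
      alike⁻ ((λ w∈ → contradiction w∈ w∉) , (λ b∈ → contradiction b∈ b∉)) w≺b

  spans : ∀ {a b} → SameSide C a b → ∀ w → 𝟙 (spans? ρ a b w) ℕ.≤ 𝟙 (spans? π a b w)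
  spans {a} {b} (aC , bC) w = 𝟙-mono (spans? ρ a b w) (spans? π a b w)
    [ (λ (w⊀a , w≺b) → inj₁ (spans-half (aC , bC) w⊀a w≺b))
    , (λ (w⊀b , w≺a) → inj₂ (spans-half (bC , aC) w⊀b w≺a)) ]′

  contiguous-by-gathering : ∀ {x y z} → x ∈ C → z ∈ C → x ≺[ π ] y → y ≺[ π ] z → y ∈ C
  contiguous-by-gathering {x} {y} {z} x∈ z∈ x≺y y≺z = go (y ∈? C)
   where
   go : Dec (y ∈ C) → y ∈ C
   go (yes y∈) = y∈
   go (no y∉)  = contradiction (minLA ρ) (ℕ.<⇒≱ (arrangementCost-< G π ρ
     (λ {a} {b} e → subst₂ ℕ._≤_ (sym (distance≡spans ρ a b)) (sym (distance≡spans π a b))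
       (sum-mono (spans (clique-closed cC e , clique-closed cC (sym-E G e)))))
     (complete cC x∈ z∈ λ x≡z → ≺-irrefl π x≡z (ℕ.<-trans x≺y y≺z))
     (subst₂ ℕ._<_ (sym (distance≡spans ρ x z)) (sym (distance≡spans π x z))
       (sum-mono-< (spans ((λ _ → z∈) , (λ _ → x∈))) y strict))))
     where
     strict : 𝟙 (spans? ρ x z y) ℕ.< 𝟙 (spans? π x z y)
     strict = subst₂ ℕ._<_
       (sym (𝟙-no (spans? ρ x z y) [ (λ (_ , y≺z) → ≺-asym ρ (apart z∈ y∉) y≺z)
                                   , (λ (_ , y≺x) → ≺-asym ρ (apart x∈ y∉) y≺x) ]′))
       (sym (𝟙-yes (spans? π x z y) (inj₁ (≺-asym π x≺y , y≺z)))) (s≤s z≤n)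

-- Gathering C at the left end lengthens no edge, and shortens an edge of
-- C that spans a node outside C.
minLA-contiguous : ∀ {G : Graph n} {π C} → IsMinLA G π → IsCliqueOf G C → Contiguous π C
minLA-contiguous {G = G} {π} {C} minLA cC with ρ , apart , alike ← gather π C =
  contiguous-by-gathering {G = G} {π} {C} minLA cC ρ apart alike

-- The expected cost of Rand

ringℚ : AlmostCommutativeRing 0ℓ 0ℓ
ringℚ = fromCommutativeRing ℚ.+-*-commutativeRing λ q → dec⇒maybe (0ℚ ℚ.≟ q)

fromℕ-+ : ∀ a b → fromℕ (a ℕ.+ b) ≡ fromℕ a ℚ.+ fromℕ b
fromℕ-+ a b = sym (trans (fromℚᵘ-homo-+ (ℚᵘ.mkℚᵘ (+ a) 0) (ℚᵘ.mkℚᵘ (+ b) 0))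
  (ℚ.fromℚᵘ-cong {ℚᵘ.mkℚᵘ (+ a) 0 ℚᵘ.+ ℚᵘ.mkℚᵘ (+ b) 0} {ℚᵘ.mkℚᵘ (+ (a ℕ.+ b)) 0}
    (ℚᵘ.*≡* (cong (ℤ._* + 1) (cong₂ ℤ._+_ (ℤ.*-identityʳ (+ a)) (ℤ.*-identityʳ (+ b)))))))

fromℕ-* : ∀ a b → fromℕ (a ℕ.* b) ≡ fromℕ a ℚ.* fromℕ b
fromℕ-* a b = sym (trans (fromℚᵘ-homo-* (ℚᵘ.mkℚᵘ (+ a) 0) (ℚᵘ.mkℚᵘ (+ b) 0))
  (ℚ.fromℚᵘ-cong {ℚᵘ.mkℚᵘ (+ a) 0 ℚᵘ.* ℚᵘ.mkℚᵘ (+ b) 0} {ℚᵘ.mkℚᵘ (+ (a ℕ.* b)) 0}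
    (ℚᵘ.*≡* (cong (ℤ._* + 1) (sym (ℤ.pos-* a b))))))

fromℕ-nonNeg : ∀ a → 0ℚ ℚ.≤ fromℕ a
fromℕ-nonNeg a = ℚ.nonNegative⁻¹ (fromℕ a) {{ℚ.normalize-nonNeg a 1}}

fromℕ-mono : ∀ {a b} → a ℕ.≤ b → fromℕ a ℚ.≤ fromℕ b
fromℕ-mono {a} {b} a≤b = begin
  fromℕ a                         ≡⟨ ℚ.+-identityʳ _ ⟨
  fromℕ a ℚ.+ 0ℚ                  ≤⟨ ℚ.+-monoʳ-≤ (fromℕ a) (fromℕ-nonNeg (b ℕ.∸ a)) ⟩
  fromℕ a ℚ.+ fromℕ (b ℕ.∸ a)     ≡⟨ fromℕ-+ a (b ℕ.∸ a) ⟨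
  fromℕ (a ℕ.+ (b ℕ.∸ a))         ≡⟨ cong fromℕ (ℕ.m+[n∸m]≡n a≤b) ⟩
  fromℕ b                         ∎
  where open ℚ.≤-Reasoning

fromℕ-sum : ∀ (f : Fin n → ℕ) → fromℕ (sum f) ≡ ∑ℚ.sum (λ a → fromℕ (f a))
fromℕ-sum {zero}  f = refl
fromℕ-sum {suc n} f = trans (fromℕ-+ (f zero) (sum (f ∘ suc))) (cong (fromℕ (f zero) ℚ.+_) (fromℕ-sum (f ∘ suc)))

-- Total, with the junk value 0 at 0; every use is at a positive argument.
recip : ℕ → ℚ
recip zero    = 0ℚ
recip (suc a) = + 1 ℚ./ suc a

recip-nonNeg : ∀ a → 0ℚ ℚ.≤ recip a
recip-nonNeg zero    = ℚ.≤-refl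
recip-nonNeg (suc a) = ℚ.nonNegative⁻¹ (recip (suc a)) {{ℚ.normalize-nonNeg 1 (suc a)}}

/≡*recip : ∀ a d .{{_ : NonZero d}} → + a ℚ./ d ≡ fromℕ a ℚ.* recip d
/≡*recip a (suc d) = sym (trans (fromℚᵘ-homo-* (ℚᵘ.mkℚᵘ (+ a) 0) (ℚᵘ.mkℚᵘ (+ 1) d))
  (ℚ.fromℚᵘ-cong {ℚᵘ.mkℚᵘ (+ a) 0 ℚᵘ.* ℚᵘ.mkℚᵘ (+ 1) d} {ℚᵘ.mkℚᵘ (+ a) d}
    (ℚᵘ.*≡* (cong₂ ℤ._*_ (ℤ.*-identityʳ (+ a)) (cong (λ e → + suc e) (sym (ℕ.+-identityʳ d)))))))

*-recip : ∀ d .{{_ : NonZero d}} → fromℕ d ℚ.* recip d ≡ 1ℚ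
*-recip d@(suc d-1) = trans (fromℚᵘ-homo-* (ℚᵘ.mkℚᵘ (+ d) 0) (ℚᵘ.mkℚᵘ (+ 1) d-1))
  (ℚ.fromℚᵘ-cong {ℚᵘ.mkℚᵘ (+ d) 0 ℚᵘ.* ℚᵘ.mkℚᵘ (+ 1) d-1} {ℚᵘ.mkℚᵘ (+ 1) 0}
    (ℚᵘ.*≡* (trans (ℤ.*-identityʳ _) (trans (ℤ.*-identityʳ (+ d))
      (cong +_ (sym (trans (ℕ.+-identityʳ _) (cong suc (ℕ.+-identityʳ d-1)))))))))

*-mono-≤ˡ : ∀ {p q} r → 0ℚ ℚ.≤ r → p ℚ.≤ q → r ℚ.* p ℚ.≤ r ℚ.* q
*-mono-≤ˡ r 0≤r = ℚ.*-monoˡ-≤-nonNeg r {{ℚ.nonNegative 0≤r}}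

*-nonNeg : ∀ {p q} → 0ℚ ℚ.≤ p → 0ℚ ℚ.≤ q → 0ℚ ℚ.≤ p ℚ.* q
*-nonNeg {p} {q} 0≤p 0≤q = subst (ℚ._≤ p ℚ.* q) (ℚ.*-zeroʳ p) (*-mono-≤ˡ p 0≤p 0≤q)

sumℚ-mono : {f g : Fin n → ℚ} → (∀ i → f i ℚ.≤ g i) → ∑ℚ.sum f ℚ.≤ ∑ℚ.sum g
sumℚ-mono {zero}  le = ℚ.≤-refl
sumℚ-mono {suc n} le = ℚ.+-mono-≤ (le zero) (sumℚ-mono (le ∘ suc))

𝔼-++ : ∀ (μ ν : Dist O) f → 𝔼 (μ ++ ν) f ≡ 𝔼 μ f ℚ.+ 𝔼 ν f
𝔼-++ []            ν f = sym (ℚ.+-identityˡ _)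
𝔼-++ ((p , a) ∷ μ) ν f = trans (cong (p ℚ.* f a ℚ.+_) (𝔼-++ μ ν f)) (sym (ℚ.+-assoc (p ℚ.* f a) _ _))

𝔼-scale : ∀ p (ν : Dist O) f → 𝔼 (List.map (λ (q , b) → p ℚ.* q , b) ν) f ≡ p ℚ.* 𝔼 ν f
𝔼-scale p []            f = sym (ℚ.*-zeroʳ p)
𝔼-scale p ((q , b) ∷ ν) f = trans (cong₂ ℚ._+_ (ℚ.*-assoc p q (f b)) (𝔼-scale p ν f)) (sym (ℚ.*-distribˡ-+ p _ _))

𝔼->>= : ∀ (μ : Dist O) (g : O → Dist O′) f → 𝔼 (μ >>= g) f ≡ 𝔼 μ (λ a → 𝔼 (g a) f)
𝔼->>= []            g f = refl
𝔼->>= ((p , a) ∷ μ) g f = trans (𝔼-++ (List.map (λ (q , b) → p ℚ.* q , b) (g a)) (μ >>= g) f)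
  (cong₂ ℚ._+_ (𝔼-scale p (g a) f) (𝔼->>= μ g f))

𝔼-cong : ∀ (μ : Dist O) {f g : O → ℚ} → (∀ a → f a ≡ g a) → 𝔼 μ f ≡ 𝔼 μ g
𝔼-cong []            e = refl
𝔼-cong ((p , a) ∷ μ) e = cong₂ (λ x y → p ℚ.* x ℚ.+ y) (e a) (𝔼-cong μ e)

𝔼-return : ∀ (a : O) (f : O → ℚ) → 𝔼 (return a) f ≡ f a
𝔼-return a f = trans (ℚ.+-identityʳ _) (ℚ.*-identityˡ (f a))

𝔼-+ : ∀ (μ : Dist O) f g → 𝔼 μ (λ a → f a ℚ.+ g a) ≡ 𝔼 μ f ℚ.+ 𝔼 μ g
𝔼-+ []            f g = sym (ℚ.+-identityˡ 0ℚ)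
𝔼-+ ((p , a) ∷ μ) f g = trans (cong (p ℚ.* (f a ℚ.+ g a) ℚ.+_) (𝔼-+ μ f g)) (regroup p (f a) (g a) (𝔼 μ f) (𝔼 μ g))
  where
  regroup : ∀ p x y s t → p ℚ.* (x ℚ.+ y) ℚ.+ (s ℚ.+ t) ≡ (p ℚ.* x ℚ.+ s) ℚ.+ (p ℚ.* y ℚ.+ t)
  regroup = solve-∀ ringℚ

size-nonZero : ∀ {G : Graph n} {X} → IsCliqueOf G X → ∀ s → NonZero (∣ X ∣ ℕ.+ s)
size-nonZero {X = X} cX s = ℕ.>-nonZero (ℕ.<-≤-trans
  (ℕ.>-nonZero⁻¹ ∣ X ∣ {{nonempty⇒nonZero (nonempty cX)}}) (ℕ.m≤m+n ∣ X ∣ s))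

-- The coin of `Rand`, crosswise: `share` is the probability that `Z` moves, `shareʳ` the
-- probability that `X` moves. Both are products with `recip`, which suits ring reasoning.
share : Subset n → Subset n → ℚ
share X Z = fromℕ ∣ X ∣ ℚ.* recip (∣ X ∣ ℕ.+ ∣ Z ∣)

shareʳ : Subset n → Subset n → ℚ
shareʳ X Z = fromℕ ∣ Z ∣ ℚ.* recip (∣ X ∣ ℕ.+ ∣ Z ∣)

share-nonNeg : ∀ (X Z : Subset n) → 0ℚ ℚ.≤ share X Z
share-nonNeg X Z = *-nonNeg (fromℕ-nonNeg ∣ X ∣) (recip-nonNeg (∣ X ∣ ℕ.+ ∣ Z ∣))

shareʳ-nonNeg : ∀ (X Z : Subset n) → 0ℚ ℚ.≤ shareʳ X Z
shareʳ-nonNeg X Z = *-nonNeg (fromℕ-nonNeg ∣ Z ∣) (recip-nonNeg (∣ X ∣ ℕ.+ ∣ Z ∣))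

𝔼-Rand : ∀ (π : Permutation′ n) {G : Graph n} X Z (cX : IsCliqueOf G X) (cZ : IsCliqueOf G Z) X≢Z
  (σ : Merges (mergeCliques G X Z) k) f →
  𝔼 (Rand π (reveal X Z cX cZ X≢Z σ)) f ≡
  shareʳ X Z ℚ.* 𝔼 (Rand (moveTowards X Z π) σ) (λ πs → f (moveTowards X Z π ∷ πs)) ℚ.+
  share X Z ℚ.* 𝔼 (Rand (moveTowards Z X π) σ) (λ πs → f (moveTowards Z X π ∷ πs))
𝔼-Rand π X Z cX cZ X≢Z σ f = trans (𝔼->>= coin (λ π′ → Rand π′ σ >>= λ πs → return (π′ ∷ πs)) f) (cong₂ ℚ._+_
  (cong₂ ℚ._*_ (/≡*recip ∣ Z ∣ (∣ X ∣ ℕ.+ ∣ Z ∣)) (continue (moveTowards X Z π)))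
  (trans (ℚ.+-identityʳ _)
    (cong₂ ℚ._*_ (/≡*recip ∣ X ∣ (∣ X ∣ ℕ.+ ∣ Z ∣)) (continue (moveTowards Z X π)))))
  where
  instance
    total : NonZero (∣ X ∣ ℕ.+ ∣ Z ∣)
    total = size-nonZero cX ∣ Z ∣
  coin = (+ ∣ Z ∣ ℚ./ (∣ X ∣ ℕ.+ ∣ Z ∣) , moveTowards X Z π)
       ∷ (+ ∣ X ∣ ℚ./ (∣ X ∣ ℕ.+ ∣ Z ∣) , moveTowards Z X π)
       ∷ []
  continue : ∀ π′ → 𝔼 (Rand π′ σ >>= λ πs → return (π′ ∷ πs)) f ≡ 𝔼 (Rand π′ σ) (λ πs → f (π′ ∷ πs))
  continue π′ = trans (𝔼->>= (Rand π′ σ) (λ πs → return (π′ ∷ πs)) f)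
    (𝔼-cong (Rand π′ σ) λ πs → 𝔼-return (π′ ∷ πs) f)

shares-sum : ∀ {G : Graph n} {X} Z → IsCliqueOf G X → shareʳ X Z ℚ.+ share X Z ≡ 1ℚ
shares-sum {X = X} Z cX = begin
  shareʳ X Z ℚ.+ share X Z                            ≡⟨ ℚ.+-comm (shareʳ X Z) (share X Z) ⟩
  share X Z ℚ.+ shareʳ X Z                            ≡⟨ ℚ.*-distribʳ-+ (recip s) (fromℕ ∣ X ∣) (fromℕ ∣ Z ∣) ⟨
  (fromℕ ∣ X ∣ ℚ.+ fromℕ ∣ Z ∣) ℚ.* recip s           ≡⟨ cong (ℚ._* recip s) (fromℕ-+ ∣ X ∣ ∣ Z ∣) ⟨
  fromℕ s ℚ.* recip s                                 ≡⟨ *-recip s {{size-nonZero cX ∣ Z ∣}} ⟩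
  1ℚ                                                  ∎
  where
  open ≡-Reasoning
  s = ∣ X ∣ ℕ.+ ∣ Z ∣

-- Total probability one, needed to take the cost of the move just made out of the expectation over
-- the later ones.
𝔼-Rand-const : ∀ (π : Permutation′ n) {G : Graph n} (σ : Merges G k) c → 𝔼 (Rand π σ) (λ _ → c) ≡ c
𝔼-Rand-const {n = n} π [] c = 𝔼-return {Vec (Permutation′ n) 0} [] (λ _ → c)
𝔼-Rand-const π (reveal X Z cX cZ X≢Z σ) c = begin
  𝔼 (Rand π (reveal X Z cX cZ X≢Z σ)) (λ _ → c)
    ≡⟨ 𝔼-Rand π X Z cX cZ X≢Z σ (λ _ → c) ⟩
  shareʳ X Z ℚ.* 𝔼 (Rand (moveTowards X Z π) σ) (λ _ → c) ℚ.+ share X Z ℚ.* 𝔼 (Rand (moveTowards Z X π) σ) (λ _ → c)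
    ≡⟨ cong₂ (λ x y → shareʳ X Z ℚ.* x ℚ.+ share X Z ℚ.* y) (𝔼-Rand-const _ σ c) (𝔼-Rand-const _ σ c) ⟩
  shareʳ X Z ℚ.* c ℚ.+ share X Z ℚ.* c
    ≡⟨ ℚ.*-distribʳ-+ c (shareʳ X Z) (share X Z) ⟨
  (shareʳ X Z ℚ.+ share X Z) ℚ.* c
    ≡⟨ cong (ℚ._* c) (shares-sum Z cX) ⟩
  1ℚ ℚ.* c
    ≡⟨ ℚ.*-identityˡ c ⟩
  c ∎
  where open ≡-Reasoning

randCost : Permutation′ n → {G : Graph n} → Merges G k → ℚ
randCost π σ = 𝔼 (Rand π σ) (λ πs → fromℕ (cost π πs))

randCost-reveal : ∀ (π : Permutation′ n) {G : Graph n} X Z (cX : IsCliqueOf G X) (cZ : IsCliqueOf G Z) X≢Z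
  (σ : Merges (mergeCliques G X Z) k) →
  let π′ = moveTowards X Z π ; π″ = moveTowards Z X π in
  randCost π (reveal X Z cX cZ X≢Z σ) ≡
  shareʳ X Z ℚ.* (fromℕ (kendallTau π π′) ℚ.+ randCost π′ σ) ℚ.+
  share X Z ℚ.* (fromℕ (kendallTau π π″) ℚ.+ randCost π″ σ)
randCost-reveal π X Z cX cZ X≢Z σ = trans (𝔼-Rand π X Z cX cZ X≢Z σ (λ πs → fromℕ (cost π πs)))
  (cong₂ (λ x y → shareʳ X Z ℚ.* x ℚ.+ share X Z ℚ.* y) (step (moveTowards X Z π)) (step (moveTowards Z X π)))
  where
  step : ∀ π′ → 𝔼 (Rand π′ σ) (λ πs → fromℕ (kendallTau π π′ ℕ.+ cost π′ πs)) ≡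
         fromℕ (kendallTau π π′) ℚ.+ randCost π′ σ
  step π′ = trans (𝔼-cong (Rand π′ σ) λ πs → fromℕ-+ (kendallTau π π′) (cost π′ πs))
    (trans (𝔼-+ (Rand π′ σ) (λ _ → fromℕ (kendallTau π π′)) (λ πs → fromℕ (cost π′ πs)))
      (cong (ℚ._+ randCost π′ σ) (𝔼-Rand-const π′ σ (fromℕ (kendallTau π π′)))))

-- The separations are all counted in the one permutation π, although Rand
-- moves on: its moves preserve their number in expectation.
potential : Permutation′ n → {G : Graph n} → Merges G k → ℚ
potential π []                       = 0ℚ
potential π (reveal X Z _ _ _ σ) =
  fromℕ 2 ℚ.* fromℕ (separations π X Z) ℚ.* recip (∣ X ∣ ℕ.+ ∣ Z ∣) ℚ.+ potential π σ

-- This passes to all later graphs, since merging only adds edges; it is how later cliques are known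
-- to be unsplit.
Joined : Subset n → Subset n → Graph n → Set
Joined X Z G = ∀ {v w} → v ∈ X ⊎ v ∈ Z → w ∈ X ⊎ w ∈ Z → v ≢ w → Edge G v w

joined-unsplit : ∀ {G : Graph n} {X Z A} → Joined X Z G → IsCliqueOf G A → Unsplit X Z A
joined-unsplit {A = A} joined cA {v} {w} v∈ w∈ v∈A with w ∈? A
... | yes w∈A = w∈A
... | no w∉A  = contradiction (joined v∈ w∈ (∈∉⇒≢ v∈A w∉A)) (isolated cA v∈A w∉A)

module _ {X Z : Subset n} {π π′ π″ : Permutation′ n}
  (disj : Disjoint X Z) (contigX : Contiguous π X) (contigZ : Contiguous π Z)
  (moved′ : Moved X Z π π′) (moved″ : Moved Z X π π″)
  {x₀ z₀} (x₀∈ : x₀ ∈ X) (z₀∈ : z₀ ∈ Z) .{{_ : NonZero (∣ X ∣ ℕ.+ ∣ Z ∣)}} where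

  -- The one coin for `X` and `Z` is averaged against each later merge in turn. The permutations
  -- stay fixed during the induction, while the graph grows.
  average-potential : ∀ {G : Graph n} (σ : Merges G k) → Joined X Z G →
    shareʳ X Z ℚ.* potential π′ σ ℚ.+ share X Z ℚ.* potential π″ σ ≡ potential π σ
  average-potential [] joined = trans (cong₂ ℚ._+_ (ℚ.*-zeroʳ (shareʳ X Z)) (ℚ.*-zeroʳ (share X Z))) (ℚ.+-identityʳ 0ℚ)
  average-potential {G = G} (reveal A C cA cC A≢C σ) joined = begin
    shareʳ X Z ℚ.* (fromℕ 2 ℚ.* t′ ℚ.* c ℚ.+ potential π′ σ) ℚ.+ share X Z ℚ.* (fromℕ 2 ℚ.* t″ ℚ.* c ℚ.+ potential π″ σ)
      ≡⟨ regroup (fromℕ ∣ Z ∣) (fromℕ ∣ X ∣) (recip s) (fromℕ 2) t′ t″ c (potential π′ σ) (potential π″ σ) ⟩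
    fromℕ 2 ℚ.* ((fromℕ ∣ Z ∣ ℚ.* t′ ℚ.+ fromℕ ∣ X ∣ ℚ.* t″) ℚ.* recip s) ℚ.* c ℚ.+
      (shareʳ X Z ℚ.* potential π′ σ ℚ.+ share X Z ℚ.* potential π″ σ)
      ≡⟨ cong₂ (λ x y → fromℕ 2 ℚ.* x ℚ.* c ℚ.+ y) average
           (average-potential {G = mergeCliques G A C} σ λ v∈ w∈ v≢w → inj₁ (joined v∈ w∈ v≢w)) ⟩
    fromℕ 2 ℚ.* t ℚ.* c ℚ.+ potential π σ ∎
    where
    open ≡-Reasoning
    s = ∣ X ∣ ℕ.+ ∣ Z ∣
    c = recip (∣ A ∣ ℕ.+ ∣ C ∣)
    t = fromℕ (separations π A C)
    t′ = fromℕ (separations π′ A C)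
    t″ = fromℕ (separations π″ A C)
    regroup : ∀ z x r b t′ t″ c u v →
      z ℚ.* r ℚ.* (b ℚ.* t′ ℚ.* c ℚ.+ u) ℚ.+ x ℚ.* r ℚ.* (b ℚ.* t″ ℚ.* c ℚ.+ v) ≡
      b ℚ.* ((z ℚ.* t′ ℚ.+ x ℚ.* t″) ℚ.* r) ℚ.* c ℚ.+ (z ℚ.* r ℚ.* u ℚ.+ x ℚ.* r ℚ.* v)
    regroup = solve-∀ ringℚ
    commute : ∀ s t r → s ℚ.* t ℚ.* r ≡ s ℚ.* r ℚ.* t
    commute = solve-∀ ringℚ
    open Averaging disj contigX contigZ moved′ moved″ x₀∈ z₀∈
    average : (fromℕ ∣ Z ∣ ℚ.* t′ ℚ.+ fromℕ ∣ X ∣ ℚ.* t″) ℚ.* recip s ≡ t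
    average = begin
      (fromℕ ∣ Z ∣ ℚ.* t′ ℚ.+ fromℕ ∣ X ∣ ℚ.* t″) ℚ.* recip s
        ≡⟨ cong (ℚ._* recip s) (cong₂ ℚ._+_ (fromℕ-* ∣ Z ∣ (separations π′ A C)) (fromℕ-* ∣ X ∣ (separations π″ A C))) ⟨
      (fromℕ (∣ Z ∣ ℕ.* separations π′ A C) ℚ.+ fromℕ (∣ X ∣ ℕ.* separations π″ A C)) ℚ.* recip s
        ≡⟨ cong (ℚ._* recip s) (fromℕ-+ (∣ Z ∣ ℕ.* separations π′ A C) (∣ X ∣ ℕ.* separations π″ A C)) ⟨
      fromℕ (∣ Z ∣ ℕ.* separations π′ A C ℕ.+ ∣ X ∣ ℕ.* separations π″ A C) ℚ.* recip s
        ≡⟨ cong (λ m → fromℕ m ℚ.* recip s) (average-separations {A} {C}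
             (joined-unsplit {G = G} joined cA) (joined-unsplit {G = G} joined cC) (cliques-disjoint cA cC A≢C)) ⟩
      fromℕ (s ℕ.* separations π A C) ℚ.* recip s
        ≡⟨ cong (ℚ._* recip s) (fromℕ-* s (separations π A C)) ⟩
      fromℕ s ℚ.* t ℚ.* recip s
        ≡⟨ commute (fromℕ s) t (recip s) ⟩
      fromℕ s ℚ.* recip s ℚ.* t
        ≡⟨ cong (ℚ._* t) (*-recip s) ⟩
      1ℚ ℚ.* t
        ≡⟨ ℚ.*-identityˡ t ⟩
      t ∎

merge-joined : ∀ {G : Graph n} {X Z} → Joined X Z (mergeCliques G X Z)
merge-joined v∈ w∈ v≢w = inj₂ (v≢w , x∈p∪q⁺ v∈ , x∈p∪q⁺ w∈)

-- The induction hypothesis is used in both moved permutations, and `average-potential` brings the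
-- two resulting potentials back to π.
randCost≤potential : ∀ {π : Permutation′ n} {G : Graph n} → EdgesContiguous π G → (σ : Merges G k) →
                     randCost π σ ℚ.≤ potential π σ
randCost≤potential {n = n} contig [] = ℚ.≤-reflexive (𝔼-return {Vec (Permutation′ n) 0} [] (λ πs → fromℕ 0))
randCost≤potential {n = n} {π = π} {G} contig (reveal X Z cX cZ X≢Z σ) = begin
  randCost π (reveal X Z cX cZ X≢Z σ)
    ≡⟨ randCost-reveal π X Z cX cZ X≢Z σ ⟩
  shareʳ X Z ℚ.* (d′ ℚ.+ randCost π′ σ) ℚ.+ share X Z ℚ.* (d″ ℚ.+ randCost π″ σ)
    ≤⟨ ℚ.+-mono-≤
         (*-mono-≤ˡ (shareʳ X Z) (shareʳ-nonNeg X Z) (ℚ.+-monoʳ-≤ d′ (randCost≤potential contig′ σ)))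
         (*-mono-≤ˡ (share X Z) (share-nonNeg X Z) (ℚ.+-monoʳ-≤ d″ (randCost≤potential contig″ σ))) ⟩
  shareʳ X Z ℚ.* (d′ ℚ.+ potential π′ σ) ℚ.+ share X Z ℚ.* (d″ ℚ.+ potential π″ σ)
    ≡⟨ regroup (fromℕ ∣ Z ∣) (fromℕ ∣ X ∣) r d′ d″ (potential π′ σ) (potential π″ σ) ⟩
  (r ℚ.* (fromℕ ∣ Z ∣ ℚ.* d′) ℚ.+ r ℚ.* (fromℕ ∣ X ∣ ℚ.* d″)) ℚ.+
    (shareʳ X Z ℚ.* potential π′ σ ℚ.+ share X Z ℚ.* potential π″ σ)
    ≤⟨ ℚ.+-mono-≤ (ℚ.+-mono-≤
           (*-mono-≤ˡ r (recip-nonNeg (∣ X ∣ ℕ.+ ∣ Z ∣)) move′)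
           (*-mono-≤ˡ r (recip-nonNeg (∣ X ∣ ℕ.+ ∣ Z ∣)) move″))
         (ℚ.≤-reflexive (average-potential disj contigX contigZ moved′ moved″
           (proj₂ (nonempty cX)) (proj₂ (nonempty cZ)) {{size-nonZero cX ∣ Z ∣}} σ (merge-joined {G = G}))) ⟩
  (r ℚ.* t ℚ.+ r ℚ.* t) ℚ.+ potential π σ
    ≡⟨ cong (ℚ._+ potential π σ) (trans (double r t) (cong (λ b → b ℚ.* t ℚ.* r) (sym (fromℕ-+ 1 1)))) ⟩
  fromℕ 2 ℚ.* t ℚ.* r ℚ.+ potential π σ ∎
  where
  open ℚ.≤-Reasoning
  π′ = moveTowards X Z π
  π″ = moveTowards Z X π
  d′ = fromℕ (kendallTau π π′)
  d″ = fromℕ (kendallTau π π″)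
  r = recip (∣ X ∣ ℕ.+ ∣ Z ∣)
  t = fromℕ (separations π X Z)
  disj : Disjoint X Z
  disj = cliques-disjoint cX cZ X≢Z
  contigX : Contiguous π X
  contigX = clique-contiguous {π = π} contig cX
  contigZ : Contiguous π Z
  contigZ = clique-contiguous {π = π} contig cZ
  moved′ : Moved X Z π π′
  moved′ = moveTowards-moved π X Z disj contigX contigZ
  moved″ : Moved Z X π π″
  moved″ = moveTowards-moved π Z X (Disjoint-sym disj) contigZ contigX
  contig′ : EdgesContiguous π′ (mergeCliques G X Z)
  contig′ = merged-contiguous cX cZ X≢Z contig moved′
  contig″ : EdgesContiguous π″ (mergeCliques G X Z)
  -- For the other move the roles of `X` and `Z` are exchanged, so contiguity comes out for the
  -- merge in the opposite order.
  contig″ e lt gt = merge-comm {G = G} (merged-contiguous cZ cX (X≢Z ∘ sym) contig moved″ (merge-comm {G = G} e) lt gt)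
  regroup : ∀ z x r d′ d″ u v → z ℚ.* r ℚ.* (d′ ℚ.+ u) ℚ.+ x ℚ.* r ℚ.* (d″ ℚ.+ v) ≡
    (r ℚ.* (z ℚ.* d′) ℚ.+ r ℚ.* (x ℚ.* d″)) ℚ.+ (z ℚ.* r ℚ.* u ℚ.+ x ℚ.* r ℚ.* v)
  regroup = solve-∀ ringℚ
  double : ∀ r t → r ℚ.* t ℚ.+ r ℚ.* t ≡ (1ℚ ℚ.+ 1ℚ) ℚ.* t ℚ.* r
  double = solve-∀ ringℚ
  move′ : fromℕ ∣ Z ∣ ℚ.* d′ ℚ.≤ t
  move′ = ℚ.≤-trans (ℚ.≤-reflexive (sym (fromℕ-* ∣ Z ∣ (kendallTau π π′)))) (fromℕ-mono
    (ℕ.≤-trans (ℕ.*-monoʳ-≤ ∣ Z ∣ (kendallTau≤inversions π π′)) (inversions-moveTowards moved′ disj contigZ)))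
  move″ : fromℕ ∣ X ∣ ℚ.* d″ ℚ.≤ t
  move″ = ℚ.≤-trans (ℚ.≤-reflexive (sym (fromℕ-* ∣ X ∣ (kendallTau π π″)))) (fromℕ-mono
    (ℕ.≤-trans (ℕ.*-monoʳ-≤ ∣ X ∣ (kendallTau≤inversions π π″))
      (ℕ.≤-trans (inversions-moveTowards moved″ (Disjoint-sym disj) contigX)
        (ℕ.≤-reflexive (separations-sym π Z X)))))

-- The cost of a feasible solution

merged-clique : ∀ {G : Graph n} {X Z} → IsCliqueOf G X → IsCliqueOf G Z → IsCliqueOf (mergeCliques G X Z) (X ∪ Z)
merged-clique {X = X} {Z} cX cZ = record
  { nonempty = proj₁ (nonempty cX) , x∈p∪q⁺ (inj₁ (proj₂ (nonempty cX)))
  ; complete = λ x∈ y∈ x≢y → inj₂ (x≢y , x∈ , y∈)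
  ; isolated = λ where
      x∈ y∉ (inj₁ e) → [ (λ x∈X → isolated cX x∈X (y∉ ∘ x∈p∪q⁺ ∘ inj₁) e)
                       , (λ x∈Z → isolated cZ x∈Z (y∉ ∘ x∈p∪q⁺ ∘ inj₂) e) ]′ (x∈p∪q⁻ X Z x∈)
      x∈ y∉ (inj₂ (_ , _ , y∈)) → y∉ y∈
  }

unmerged-clique : ∀ {G : Graph n} {X Z C a} → IsCliqueOf G X → IsCliqueOf G Z → IsCliqueOf G C →
                  a ∈ C → a ∉ X → a ∉ Z → IsCliqueOf (mergeCliques G X Z) C
unmerged-clique {X = X} {Z} cX cZ cC a∈C a∉X a∉Z = record
  { nonempty = nonempty cC
  ; complete = λ x∈ y∈ x≢y → inj₁ (complete cC x∈ y∈ x≢y)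
  ; isolated = λ where
      x∈ y∉ (inj₁ e) → isolated cC x∈ y∉ e
      x∈ y∉ (inj₂ (_ , x∈XZ , _)) → [ (λ x∈X → a∉X (clique-⊆ cC cX x∈ x∈X a∈C))
                                    , (λ x∈Z → a∉Z (clique-⊆ cC cZ x∈ x∈Z a∈C)) ]′ (x∈p∪q⁻ X Z x∈XZ)
  }

∣∪∣-disjoint : ∀ {X Z : Subset n} → Disjoint X Z → ∣ X ∪ Z ∣ ≡ ∣ X ∣ ℕ.+ ∣ Z ∣
∣∪∣-disjoint {X = X} {Z} disj = begin
  ∣ X ∪ Z ∣                                             ≡⟨ card≡sum (X ∪ Z) ⟩
  (sum λ a → 𝟙 (a ∈? X ∪ Z))                            ≡⟨ sum-cong-≗ (λ a → pointwise a (a ∈? X) (a ∈? Z)) ⟩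
  (sum λ a → 𝟙 (a ∈? X) ℕ.+ 𝟙 (a ∈? Z))                 ≡⟨ ∑-distrib-+ (λ a → 𝟙 (a ∈? X)) (λ a → 𝟙 (a ∈? Z)) ⟩
  (sum λ a → 𝟙 (a ∈? X)) ℕ.+ (sum λ a → 𝟙 (a ∈? Z))     ≡⟨ cong₂ ℕ._+_ (card≡sum X) (card≡sum Z) ⟨
  ∣ X ∣ ℕ.+ ∣ Z ∣                                       ∎
  where
  open ≡-Reasoning
  pointwise : ∀ a (dX : Dec (a ∈ X)) (dZ : Dec (a ∈ Z)) → 𝟙 (a ∈? X ∪ Z) ≡ 𝟙 dX ℕ.+ 𝟙 dZ
  pointwise a (yes a∈X) (yes a∈Z) = contradiction a∈Z (disj a∈X)
  pointwise a (yes a∈X) (no _)    = 𝟙-yes (a ∈? X ∪ Z) (x∈p∪q⁺ (inj₁ a∈X))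
  pointwise a (no _)    (yes a∈Z) = 𝟙-yes (a ∈? X ∪ Z) (x∈p∪q⁺ (inj₂ a∈Z))
  pointwise a (no a∉X)  (no a∉Z)  = 𝟙-no (a ∈? X ∪ Z) ([ a∉X , a∉Z ]′ ∘ x∈p∪q⁻ X Z)

-- For disjoint blocks, the number of nodes that join the clique of `a` in this merge: 0 if that
-- clique does not take part.
partners : Subset n → Subset n → Fin n → ℕ
partners X Z a = 𝟙 (a ∈? X) ℕ.* ∣ Z ∣ ℕ.+ 𝟙 (a ∈? Z) ℕ.* ∣ X ∣

flipsAt : (Fin n → Fin n → ℕ) → Fin n → ℕ
flipsAt F a = sum λ u → F a u ℕ.+ F u a

-- If X ∪ Z is contiguous in π, a node that separates x and z in π₀ is
-- flipped with one of them; the flip with x is counted for every z ∈ Z.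
separations-flips : ∀ (π₀ π : Permutation′ n) {X Z} (F : Fin n → Fin n → ℕ) → Contiguous π (X ∪ Z) →
  (∀ a b → flips π₀ π a b ℕ.≤ F a b) → separations π₀ X Z ℕ.≤ sum λ a → partners X Z a ℕ.* flipsAt F a
separations-flips {n} π₀ π {X} {Z} F contig F≥ = begin
  separations π₀ X Z
    ≤⟨ (sum-mono λ u → sum-mono λ x → sum-mono λ z → pointwise u x z) ⟩
  (sum λ u → sum λ x → sum λ z → 𝟙 (z ∈? Z) ℕ.* (𝟙 (x ∈? X) ℕ.* g x u) ℕ.+ 𝟙 (x ∈? X) ℕ.* (𝟙 (z ∈? Z) ℕ.* g z u))
    ≡⟨ distribute (λ u x z → 𝟙 (z ∈? Z) ℕ.* (𝟙 (x ∈? X) ℕ.* g x u)) (λ u x z → 𝟙 (x ∈? X) ℕ.* (𝟙 (z ∈? Z) ℕ.* g z u)) ⟩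
  (sum λ u → sum λ x → sum λ z → 𝟙 (z ∈? Z) ℕ.* (𝟙 (x ∈? X) ℕ.* g x u)) ℕ.+
  (sum λ u → sum λ x → sum λ z → 𝟙 (x ∈? X) ℕ.* (𝟙 (z ∈? Z) ℕ.* g z u))
    ≡⟨ cong ((sum λ u → sum λ x → sum λ z → 𝟙 (z ∈? Z) ℕ.* (𝟙 (x ∈? X) ℕ.* g x u)) ℕ.+_)
         (sum-cong-≗ λ u → ∑-comm λ x z → 𝟙 (x ∈? X) ℕ.* (𝟙 (z ∈? Z) ℕ.* g z u)) ⟩
  (sum λ u → sum λ x → sum λ z → 𝟙 (z ∈? Z) ℕ.* (𝟙 (x ∈? X) ℕ.* g x u)) ℕ.+
  (sum λ u → sum λ z → sum λ x → 𝟙 (x ∈? X) ℕ.* (𝟙 (z ∈? Z) ℕ.* g z u))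
    ≡⟨ cong₂ ℕ._+_ (collect X Z) (collect Z X) ⟩
  (sum λ a → 𝟙 (a ∈? X) ℕ.* ∣ Z ∣ ℕ.* flipsAt F a) ℕ.+ (sum λ a → 𝟙 (a ∈? Z) ℕ.* ∣ X ∣ ℕ.* flipsAt F a)
    ≡⟨ ∑-distrib-+ (λ a → 𝟙 (a ∈? X) ℕ.* ∣ Z ∣ ℕ.* flipsAt F a) (λ a → 𝟙 (a ∈? Z) ℕ.* ∣ X ∣ ℕ.* flipsAt F a) ⟨
  (sum λ a → 𝟙 (a ∈? X) ℕ.* ∣ Z ∣ ℕ.* flipsAt F a ℕ.+ 𝟙 (a ∈? Z) ℕ.* ∣ X ∣ ℕ.* flipsAt F a)
    ≡⟨ sum-cong-≗ (λ a → ℕ.*-distribʳ-+ (flipsAt F a) (𝟙 (a ∈? X) ℕ.* ∣ Z ∣) (𝟙 (a ∈? Z) ℕ.* ∣ X ∣)) ⟨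
  (sum λ a → partners X Z a ℕ.* flipsAt F a) ∎
  where
  open ℕ.≤-Reasoning
  g : Fin n → Fin n → ℕ
  g a u = F a u ℕ.+ F u a

  distribute : ∀ (A B : Fin n → Fin n → Fin n → ℕ) →
    (sum λ u → sum λ x → sum λ z → A u x z ℕ.+ B u x z) ≡
    (sum λ u → sum λ x → sum λ z → A u x z) ℕ.+ (sum λ u → sum λ x → sum λ z → B u x z)
  distribute A B = trans
    (sum-cong-≗ λ u → trans (sum-cong-≗ λ x → ∑-distrib-+ (A u x) (B u x))
      (∑-distrib-+ (λ x → sum (A u x)) (λ x → sum (B u x))))
    (∑-distrib-+ (λ u → sum λ x → sum (A u x)) (λ u → sum λ x → sum (B u x)))

  collect : ∀ Y W → (sum λ u → sum λ a → sum λ b → 𝟙 (b ∈? W) ℕ.* (𝟙 (a ∈? Y) ℕ.* g a u)) ≡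
            sum λ a → 𝟙 (a ∈? Y) ℕ.* ∣ W ∣ ℕ.* flipsAt F a
  collect Y W = trans (∑-comm λ u a → sum λ b → 𝟙 (b ∈? W) ℕ.* (𝟙 (a ∈? Y) ℕ.* g a u))
    (sum-cong-≗ λ a → trans
      (sum-cong-≗ λ u → trans (sym (*-distribʳ-sum (𝟙 (a ∈? Y) ℕ.* g a u) (λ b → 𝟙 (b ∈? W))))
        (trans (cong (ℕ._* (𝟙 (a ∈? Y) ℕ.* g a u)) (sym (card≡sum W))) (reorder ∣ W ∣ (𝟙 (a ∈? Y)) (g a u))))
      (sym (*-distribˡ-sum (𝟙 (a ∈? Y) ℕ.* ∣ W ∣) (g a))))
    where
    reorder : ∀ w y h → w ℕ.* (y ℕ.* h) ≡ y ℕ.* w ℕ.* h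
    reorder = ℕ-Solver.solve-∀

  unordered : ∀ {a b} → Flipped π₀ π a b ⊎ Flipped π₀ π b a → 1 ℕ.≤ g a b
  unordered {a} {b} (inj₁ f) = ℕ.≤-trans (ℕ.≤-reflexive (sym (𝟙-yes (flipped? π₀ π a b) f)))
    (ℕ.≤-trans (F≥ a b) (ℕ.m≤m+n (F a b) (F b a)))
  unordered {a} {b} (inj₂ f) = ℕ.≤-trans (ℕ.≤-reflexive (sym (𝟙-yes (flipped? π₀ π b a) f)))
    (ℕ.≤-trans (F≥ b a) (ℕ.m≤n+m (F b a) (F a b)))

  flipped : ∀ {u v w} → v ∈ X ∪ Z → w ∈ X ∪ Z → u ∉ X ∪ Z → v ≺[ π₀ ] u → u ≺[ π₀ ] w →
            Flipped π₀ π v u ⊎ Flipped π₀ π u w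
  flipped v∈ w∈ u∉ v≺u u≺w with ≺-connex π (∈∉⇒≢ v∈ u∉)
  ... | inj₂ u≺′v = inj₁ (v≺u , u≺′v)
  ... | inj₁ v≺′u = inj₂ (u≺w , [ id , (λ u≺′w → contradiction (contig v∈ w∈ v≺′u u≺′w) u∉) ]′
                                  (≺-connex π (∈∉⇒≢ w∈ u∉)))

  separates⇒ : ∀ {u x z} → Separates π₀ X Z u x z → 1 ℕ.≤ g x u ℕ.+ g z u
  separates⇒ {u} {x} {z} (x∈ , z∈ , u∉X , u∉Z , b) = via b
    where
    u∉ : u ∉ X ∪ Z
    u∉ = [ u∉X , u∉Z ]′ ∘ x∈p∪q⁻ X Z
    at-x : Flipped π₀ π x u ⊎ Flipped π₀ π u x → 1 ℕ.≤ g x u ℕ.+ g z u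
    at-x f = ℕ.≤-trans (unordered f) (ℕ.m≤m+n (g x u) (g z u))
    at-z : Flipped π₀ π z u ⊎ Flipped π₀ π u z → 1 ℕ.≤ g x u ℕ.+ g z u
    at-z f = ℕ.≤-trans (unordered f) (ℕ.m≤n+m (g z u) (g x u))
    via : Between π₀ x u z → 1 ℕ.≤ g x u ℕ.+ g z u
    via (inj₁ (x≺u , u≺z)) = [ at-x ∘ inj₁ , at-z ∘ inj₂ ]′
      (flipped (x∈p∪q⁺ (inj₁ x∈)) (x∈p∪q⁺ (inj₂ z∈)) u∉ x≺u u≺z)
    via (inj₂ (z≺u , u≺x)) = [ at-z ∘ inj₁ , at-x ∘ inj₂ ]′
      (flipped (x∈p∪q⁺ (inj₂ z∈)) (x∈p∪q⁺ (inj₁ x∈)) u∉ z≺u u≺x)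

  pointwise : ∀ u x z → 𝟙 (separates? π₀ X Z u x z) ℕ.≤
    𝟙 (z ∈? Z) ℕ.* (𝟙 (x ∈? X) ℕ.* g x u) ℕ.+ 𝟙 (x ∈? X) ℕ.* (𝟙 (z ∈? Z) ℕ.* g z u)
  pointwise u x z = 𝟙-≤ (separates? π₀ X Z u x z) λ s → ℕ.≤-trans (separates⇒ s) (ℕ.≤-reflexive (sym
    (trans (cong₂ (λ i j → j ℕ.* (i ℕ.* g x u) ℕ.+ i ℕ.* (j ℕ.* g z u))
      (𝟙-yes (x ∈? X) (proj₁ s)) (𝟙-yes (z ∈? Z) (proj₁ (proj₂ s)))) (unit (g x u) (g z u)))))
    where
    unit : ∀ a b → 1 ℕ.* (1 ℕ.* a) ℕ.+ 1 ℕ.* (1 ℕ.* b) ≡ a ℕ.+ b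
    unit = ℕ-Solver.solve-∀

-- Flips along the whole path, including those undone later. So it dominates the flips between the
-- first permutation and each later one simultaneously, and still sums to at most the cost.
totalFlips : Permutation′ n → Vec (Permutation′ n) k → Fin n → Fin n → ℕ
totalFlips π []       a b = 0
totalFlips π (ρ ∷ πs) a b = flips π ρ a b ℕ.+ totalFlips ρ πs a b

totalFlips≤cost : ∀ (π : Permutation′ n) (πs : Vec (Permutation′ n) k) →
                  (sum λ a → sum λ b → totalFlips π πs a b) ℕ.≤ cost π πs
totalFlips≤cost {n} π []   = ℕ.≤-reflexive (sum-zero λ (a : Fin n) → sum-zero λ (b : Fin n) → refl)
totalFlips≤cost π (ρ ∷ πs) = begin
  (sum λ a → sum λ b → flips π ρ a b ℕ.+ totalFlips ρ πs a b)
    ≡⟨ (sum-cong-≗ λ a → ∑-distrib-+ (flips π ρ a) (totalFlips ρ πs a)) ⟩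
  (sum λ a → sum (flips π ρ a) ℕ.+ sum (totalFlips ρ πs a))
    ≡⟨ ∑-distrib-+ (λ a → sum (flips π ρ a)) (λ a → sum (totalFlips ρ πs a)) ⟩
  inversions π ρ ℕ.+ (sum λ a → sum λ b → totalFlips ρ πs a b)
    ≤⟨ ℕ.+-mono-≤ (inversions≤kendallTau π ρ) (totalFlips≤cost ρ πs) ⟩
  kendallTau π ρ ℕ.+ cost ρ πs ∎
  where open ℕ.≤-Reasoning

growth : {G : Graph n} → Merges G k → Fin n → ℚ
growth []                     a = 0ℚ
growth (reveal X Z _ _ _ σ) a = fromℕ (partners X Z a) ℚ.* recip (∣ X ∣ ℕ.+ ∣ Z ∣) ℚ.+ growth σ a

-- `ρ` is where the feasible solution currently stands. `F` has to cover the flips from π₀ to `ρ`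
-- plus those still to come; the triangle inequality shifts one step from the second part to the
-- first, so a single `F` serves all merges.
potential≤growth : ∀ (π₀ : Permutation′ n) (F : Fin n → Fin n → ℕ) {G : Graph n} (σ : Merges G k) ρ πs →
  Feasible σ πs → (∀ a b → flips π₀ ρ a b ℕ.+ totalFlips ρ πs a b ℕ.≤ F a b) →
  potential π₀ σ ℚ.≤ ∑ℚ.sum λ a → fromℕ 2 ℚ.* fromℕ (flipsAt F a) ℚ.* growth σ a
potential≤growth {n} π₀ F [] ρ [] _ _ = ℚ.≤-reflexive (sym (trans
  (∑ℚ.sum-cong-≗ λ a → ℚ.*-zeroʳ (fromℕ 2 ℚ.* fromℕ (flipsAt F a))) (∑ℚ.sum-replicate-zero n)))
potential≤growth {n} π₀ F {G} (reveal X Z cX cZ X≢Z σ) ρ (π ∷ πs) (minLA , feasible) F≥ = begin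
  fromℕ 2 ℚ.* fromℕ (separations π₀ X Z) ℚ.* r ℚ.+ potential π₀ σ
    ≤⟨ ℚ.+-mono-≤
         (ℚ.*-monoʳ-≤-nonNeg r {{ℚ.nonNegative (recip-nonNeg s)}} (*-mono-≤ˡ (fromℕ 2) (fromℕ-nonNeg 2)
           (fromℕ-mono (separations-flips π₀ π F
             (minLA-contiguous {G = mergeCliques G X Z} {π} minLA (merged-clique cX cZ)) λ a b →
               ℕ.≤-trans (ℕ.m≤m+n _ (totalFlips π πs a b)) (F≥′ a b)))))
         (potential≤growth π₀ F σ π πs feasible F≥′) ⟩
  fromℕ 2 ℚ.* fromℕ (sum λ a → partners X Z a ℕ.* flipsAt F a) ℚ.* r ℚ.+ ∑ℚ.sum tail
    ≡⟨ cong (λ q → fromℕ 2 ℚ.* q ℚ.* r ℚ.+ ∑ℚ.sum tail) (fromℕ-sum λ a → partners X Z a ℕ.* flipsAt F a) ⟩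
  fromℕ 2 ℚ.* ∑ℚ.sum (λ a → fromℕ (partners X Z a ℕ.* flipsAt F a)) ℚ.* r ℚ.+ ∑ℚ.sum tail
    ≡⟨ cong (ℚ._+ ∑ℚ.sum tail) (trans
         (cong (ℚ._* r) (*∑ℚ.*-distribˡ-sum (fromℕ 2) (λ a → fromℕ (partners X Z a ℕ.* flipsAt F a))))
         (*∑ℚ.*-distribʳ-sum r (λ a → fromℕ 2 ℚ.* fromℕ (partners X Z a ℕ.* flipsAt F a)))) ⟩
  ∑ℚ.sum (λ a → fromℕ 2 ℚ.* fromℕ (partners X Z a ℕ.* flipsAt F a) ℚ.* r) ℚ.+ ∑ℚ.sum tail
    ≡⟨ ∑ℚ.∑-distrib-+ (λ a → fromℕ 2 ℚ.* fromℕ (partners X Z a ℕ.* flipsAt F a) ℚ.* r) tail ⟨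
  ∑ℚ.sum (λ a → fromℕ 2 ℚ.* fromℕ (partners X Z a ℕ.* flipsAt F a) ℚ.* r ℚ.+ tail a)
    ≡⟨ ∑ℚ.sum-cong-≗ (λ a → trans
         (cong (λ q → fromℕ 2 ℚ.* q ℚ.* r ℚ.+ tail a) (fromℕ-* (partners X Z a) (flipsAt F a)))
         (factor (fromℕ 2) (fromℕ (partners X Z a)) (fromℕ (flipsAt F a)) r (growth σ a))) ⟩
  ∑ℚ.sum (λ a → fromℕ 2 ℚ.* fromℕ (flipsAt F a) ℚ.* growth (reveal X Z cX cZ X≢Z σ) a) ∎
  where
  open ℚ.≤-Reasoning
  s = ∣ X ∣ ℕ.+ ∣ Z ∣
  r = recip s
  tail : Fin n → ℚ
  tail a = fromℕ 2 ℚ.* fromℕ (flipsAt F a) ℚ.* growth σ a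
  F≥′ : ∀ a b → flips π₀ π a b ℕ.+ totalFlips π πs a b ℕ.≤ F a b
  F≥′ a b = ℕ.≤-trans (ℕ.+-monoˡ-≤ (totalFlips π πs a b) (flips-triangle π₀ ρ π a b))
    (ℕ.≤-trans (ℕ.≤-reflexive (ℕ.+-assoc (flips π₀ ρ a b) (flips ρ π a b) _)) (F≥ a b))
  factor : ∀ b p f r g → b ℚ.* (p ℚ.* f) ℚ.* r ℚ.+ b ℚ.* f ℚ.* g ≡ b ℚ.* f ℚ.* (p ℚ.* r ℚ.+ g)
  factor = solve-∀ ringℚ

-- Harmonic numbers and the logarithm

harmonic : ℕ → ℚ
harmonic m = ∑< m λ i → + 1 ℚ./ suc i

-- The two harmonic numbers differ by `b` terms, each at least 1/(a + b).
harmonic-grows : ∀ a b .{{_ : NonZero (a ℕ.+ b)}} →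
                 fromℕ b ℚ.* recip (a ℕ.+ b) ℚ.+ harmonic a ℚ.≤ harmonic (a ℕ.+ b)
harmonic-grows a b = begin
  fromℕ b ℚ.* recip (a ℕ.+ b) ℚ.+ harmonic a
    ≡⟨ ℚ.+-comm _ (harmonic a) ⟩
  harmonic a ℚ.+ fromℕ b ℚ.* recip (a ℕ.+ b)
    ≡⟨ cong (λ q → harmonic a ℚ.+ fromℕ b ℚ.* q) (trans (/≡*recip 1 (a ℕ.+ b)) (ℚ.*-identityˡ _)) ⟨
  harmonic a ℚ.+ fromℕ b ℚ.* (+ 1 ℚ./ (a ℕ.+ b))
    ≡⟨ cong (harmonic a ℚ.+_) (∑<-const b _) ⟨
  harmonic a ℚ.+ ∑< b (λ _ → + 1 ℚ./ (a ℕ.+ b))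
    ≤⟨ ℚ.+-monoʳ-≤ (harmonic a) (∑<-mono b λ i i<b → 1/-anti (suc (i ℕ.+ a)) (a ℕ.+ b)
         (ℕ.≤-trans (ℕ.+-monoˡ-≤ a i<b) (ℕ.≤-reflexive (ℕ.+-comm b a)))) ⟩
  harmonic a ℚ.+ ∑< b (λ i → + 1 ℚ./ suc (i ℕ.+ a))
    ≡⟨ ∑<-+ a b (λ i → + 1 ℚ./ suc i) ⟨
  harmonic (b ℕ.+ a)
    ≡⟨ cong harmonic (ℕ.+-comm b a) ⟩
  harmonic (a ℕ.+ b) ∎
  where open ℚ.≤-Reasoning

harmonic-mono : ∀ {a b} → a ℕ.≤ b → harmonic a ℚ.≤ harmonic b
harmonic-mono {zero}  {zero}  _ = ℚ.≤-refl
harmonic-mono {zero}  {suc b} _ = ∑<-nonNeg (suc b)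
  where
  ∑<-nonNeg : ∀ m → 0ℚ ℚ.≤ harmonic m
  ∑<-nonNeg zero    = ℚ.≤-refl
  ∑<-nonNeg (suc m) = ℚ.+-mono-≤ (∑<-nonNeg m) (recip-nonNeg (suc m))
harmonic-mono {suc a} {suc b} a≤b = begin
  harmonic (suc a)                                                ≡⟨ ℚ.+-identityˡ _ ⟨
  0ℚ ℚ.+ harmonic (suc a)                                         ≤⟨ ℚ.+-monoˡ-≤ (harmonic (suc a))
                                                                       (*-nonNeg (fromℕ-nonNeg d) (recip-nonNeg (suc a ℕ.+ d))) ⟩
  fromℕ d ℚ.* recip (suc a ℕ.+ d) ℚ.+ harmonic (suc a)            ≤⟨ harmonic-grows (suc a) d ⟩
  harmonic (suc a ℕ.+ d)                                          ≡⟨ cong harmonic (ℕ.m+[n∸m]≡n a≤b) ⟩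
  harmonic (suc b)                                                ∎
  where
  open ℚ.≤-Reasoning
  d = suc b ℕ.∸ suc a

-- A telescoping sum: when the clique of `a` merges, its growth term is absorbed by the increase of
-- `harmonic` at its size, and no clique ever has more than `n` nodes.
growth+harmonic≤ : ∀ {G : Graph n} (σ : Merges G k) {C a} → IsCliqueOf G C → a ∈ C →
                   growth σ a ℚ.+ harmonic ∣ C ∣ ℚ.≤ harmonic n
growth+harmonic≤ [] {C} cC a∈ = ℚ.≤-trans (ℚ.≤-reflexive (ℚ.+-identityˡ _)) (harmonic-mono (∣p∣≤n C))
growth+harmonic≤ {n} {G = G} (reveal X Z cX cZ X≢Z σ) {C} {a} cC a∈C = go (a ∈? X) (a ∈? Z)
  where
  open ℚ.≤-Reasoning
  disj : Disjoint X Z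
  disj = cliques-disjoint cX cZ X≢Z
  r = recip (∣ X ∣ ℕ.+ ∣ Z ∣)
  Goal = fromℕ (partners X Z a) ℚ.* r ℚ.+ growth σ a ℚ.+ harmonic ∣ C ∣ ℚ.≤ harmonic n
  regroup : ∀ p g h → p ℚ.+ g ℚ.+ h ≡ g ℚ.+ (p ℚ.+ h)
  regroup = solve-∀ ringℚ
  partners≡ : ∀ {i j} → 𝟙 (a ∈? X) ≡ i → 𝟙 (a ∈? Z) ≡ j → partners X Z a ≡ i ℕ.* ∣ Z ∣ ℕ.+ j ℕ.* ∣ X ∣
  partners≡ = cong₂ λ i j → i ℕ.* ∣ Z ∣ ℕ.+ j ℕ.* ∣ X ∣
  one-zero : ∀ z x → 1 ℕ.* z ℕ.+ 0 ℕ.* x ≡ z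
  one-zero = ℕ-Solver.solve-∀
  zero-one : ∀ z x → 0 ℕ.* z ℕ.+ 1 ℕ.* x ≡ x
  zero-one = ℕ-Solver.solve-∀
  -- Common to both blocks: `Y` is the one that contains `a`, and `b` the size of the other.
  merged : ∀ {Y b} → C ≡ Y → partners X Z a ≡ b → fromℕ b ℚ.* r ℚ.+ harmonic ∣ Y ∣ ℚ.≤ harmonic (∣ X ∣ ℕ.+ ∣ Z ∣) →
           a ∈ X ∪ Z → Goal
  merged {b = b} refl refl grows a∈ = begin
    fromℕ b ℚ.* r ℚ.+ growth σ a ℚ.+ harmonic ∣ C ∣
      ≡⟨ regroup (fromℕ b ℚ.* r) (growth σ a) (harmonic ∣ C ∣) ⟩
    growth σ a ℚ.+ (fromℕ b ℚ.* r ℚ.+ harmonic ∣ C ∣)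
      ≤⟨ ℚ.+-monoʳ-≤ (growth σ a) grows ⟩
    growth σ a ℚ.+ harmonic (∣ X ∣ ℕ.+ ∣ Z ∣)
      ≡⟨ cong (λ m → growth σ a ℚ.+ harmonic m) (∣∪∣-disjoint disj) ⟨
    growth σ a ℚ.+ harmonic ∣ X ∪ Z ∣
      ≤⟨ growth+harmonic≤ σ (merged-clique cX cZ) a∈ ⟩
    harmonic n ∎
  same : ∀ {Y} → IsCliqueOf G Y → a ∈ Y → C ≡ Y
  same cY a∈Y = ⊆-antisym (clique-⊆ cC cY a∈C a∈Y) (clique-⊆ cY cC a∈Y a∈C)
  go : Dec (a ∈ X) → Dec (a ∈ Z) → Goal
  go (yes a∈X) _ = merged (same cX a∈X)
    (trans (partners≡ (𝟙-yes (a ∈? X) a∈X) (𝟙-no (a ∈? Z) (disj a∈X))) (one-zero ∣ Z ∣ ∣ X ∣))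
    (harmonic-grows ∣ X ∣ ∣ Z ∣ {{size-nonZero cX ∣ Z ∣}}) (x∈p∪q⁺ (inj₁ a∈X))
  go (no a∉X) (yes a∈Z) = merged (same cZ a∈Z)
    (trans (partners≡ (𝟙-no (a ∈? X) a∉X) (𝟙-yes (a ∈? Z) a∈Z)) (zero-one ∣ Z ∣ ∣ X ∣))
    (subst (λ m → fromℕ ∣ X ∣ ℚ.* recip m ℚ.+ harmonic ∣ Z ∣ ℚ.≤ harmonic m) (ℕ.+-comm ∣ Z ∣ ∣ X ∣)
      (harmonic-grows ∣ Z ∣ ∣ X ∣ {{size-nonZero cZ ∣ X ∣}})) (x∈p∪q⁺ (inj₂ a∈Z))
  go (no a∉X) (no a∉Z) = begin
    fromℕ (partners X Z a) ℚ.* r ℚ.+ growth σ a ℚ.+ harmonic ∣ C ∣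
      ≡⟨ cong (λ m → fromℕ m ℚ.* r ℚ.+ growth σ a ℚ.+ harmonic ∣ C ∣)
           (partners≡ (𝟙-no (a ∈? X) a∉X) (𝟙-no (a ∈? Z) a∉Z)) ⟩
    0ℚ ℚ.* r ℚ.+ growth σ a ℚ.+ harmonic ∣ C ∣
      ≡⟨ cong (λ q → q ℚ.+ harmonic ∣ C ∣) (trans (cong (ℚ._+ growth σ a) (ℚ.*-zeroˡ r)) (ℚ.+-identityˡ (growth σ a))) ⟩
    growth σ a ℚ.+ harmonic ∣ C ∣
      ≤⟨ growth+harmonic≤ σ (unmerged-clique cX cZ cC a∈C a∉X a∉Z) a∈C ⟩
    harmonic n ∎

-- At mesh 1 the lower Riemann sum is 1/2 + ⋯ + 1/n.
harmonic≡1+lnApprox : ∀ n .{{_ : NonZero n}} → harmonic n ≡ lnApprox n 0 ℚ.+ harmonic 1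
harmonic≡1+lnApprox (suc p) = begin
  harmonic (suc p)                                              ≡⟨ ∑<-shift p (λ i → + 1 ℚ./ suc i) ⟩
  1ℚ ℚ.+ ∑< p (λ i → + 1 ℚ./ suc (suc i))                       ≡⟨ cong (λ N → 1ℚ ℚ.+ ∑< N (λ i → + 1 ℚ./ suc (suc i))) (ℕ.*-identityʳ p) ⟨
  1ℚ ℚ.+ lnApprox (suc p) 0                                     ≡⟨ ℚ.+-comm 1ℚ (lnApprox (suc p) 0) ⟩
  lnApprox (suc p) 0 ℚ.+ 1ℚ                                     ∎
  where open ≡-Reasoning

-- The mesh 1/(m + 1) refines the mesh 1, and refinement only raises a lower sum.
lnApprox₀≤ : ∀ n m → lnApprox n 0 ℚ.≤ lnApprox n m
lnApprox₀≤ n m = ℚ.≤-trans (lnApprox-refineˡ n 0 m) (ℚ.≤-reflexive (cong₂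
  (λ N d → ∑< (N ℕ.* suc m) λ j → + 1 ℚ./ suc (d ℕ.+ suc j)) (ℕ.*-identityʳ (n ℕ.∸ 1)) (ℕ.+-identityʳ m)))

-- The clique of `a` has a node from the start, and the `harmonic 1` due to it cancels the leading 1
-- of `harmonic n`. This leaves ln n instead of 1 + ln n.
growth≤lnApprox : ∀ .{{_ : NonZero n}} (σ : Merges (emptyGraph {n}) k) a m → growth σ a ℚ.≤ lnApprox n m
growth≤lnApprox {n} σ a m with C , a∈C , cC ← emptyGraph-isDisjointUnionOfCliques a = begin
  growth σ a                                            ≡⟨ cancel (growth σ a) (harmonic 1) ⟩
  growth σ a ℚ.+ harmonic 1 ℚ.- harmonic 1              ≤⟨ ℚ.+-monoˡ-≤ (ℚ.- harmonic 1) (ℚ.+-monoʳ-≤ (growth σ a) (harmonic-mono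
                                                             (ℕ.>-nonZero⁻¹ ∣ C ∣ {{nonempty⇒nonZero (nonempty cC)}}))) ⟩
  growth σ a ℚ.+ harmonic ∣ C ∣ ℚ.- harmonic 1          ≤⟨ ℚ.+-monoˡ-≤ (ℚ.- harmonic 1) (growth+harmonic≤ σ cC a∈C) ⟩
  harmonic n ℚ.- harmonic 1                             ≡⟨ cong (ℚ._- harmonic 1) (harmonic≡1+lnApprox n) ⟩
  lnApprox n 0 ℚ.+ harmonic 1 ℚ.- harmonic 1            ≡⟨ cancel (lnApprox n 0) (harmonic 1) ⟨
  lnApprox n 0                                          ≤⟨ lnApprox₀≤ n m ⟩
  lnApprox n m                                          ∎
  where
  open ℚ.≤-Reasoning
  cancel : ∀ p q → p ≡ p ℚ.+ q ℚ.- q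
  cancel = solve-∀ ringℚ

lnApprox-nonNeg : ∀ n m → 0ℚ ℚ.≤ lnApprox n m
lnApprox-nonNeg n m = go ((n ℕ.∸ 1) ℕ.* suc m)
  where
  go : ∀ N → 0ℚ ℚ.≤ ∑< N λ i → + 1 ℚ./ (suc m ℕ.+ suc i)
  go zero    = ℚ.≤-refl
  go (suc N) = ℚ.+-mono-≤ (go N) (recip-nonNeg (suc m ℕ.+ suc N))

-- Each flip is charged at both of its nodes. This is one factor 2 of the constant 4; the other,
-- already in `potential`, comes from the two outcomes of the coin.
sum-flipsAt : ∀ (F : Fin n → Fin n → ℕ) → sum (flipsAt F) ≡ 2 ℕ.* (sum λ a → sum λ b → F a b)
sum-flipsAt F = begin
  sum (flipsAt F)
    ≡⟨ (sum-cong-≗ λ a → ∑-distrib-+ (F a) (λ b → F b a)) ⟩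
  (sum λ a → sum (F a) ℕ.+ sum λ b → F b a)
    ≡⟨ ∑-distrib-+ (λ a → sum (F a)) (λ a → sum λ b → F b a) ⟩
  (sum λ a → sum (F a)) ℕ.+ (sum λ a → sum λ b → F b a)
    ≡⟨ cong ((sum λ a → sum (F a)) ℕ.+_) (∑-comm λ a b → F b a) ⟩
  (sum λ a → sum (F a)) ℕ.+ (sum λ a → sum (F a))
    ≡⟨ double (sum λ a → sum (F a)) ⟩
  2 ℕ.* (sum λ a → sum (F a)) ∎
  where
  open ≡-Reasoning
  double : ∀ s → s ℕ.+ s ≡ 2 ℕ.* s
  double = ℕ-Solver.solve-∀

-- Stated for every approximation of ln n separately, so that the whole estimate stays within the
-- rationals.
expectedCost≤ : ∀ .{{_ : NonZero n}} (σ : CliqueInstance n) πs → Feasible (merges σ) πs → ∀ m →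
                expectedCost σ ℚ.≤ fromℕ (cost (π₀ σ) πs) ℚ.* (fromℕ 4 ℚ.* lnApprox n m)
expectedCost≤ {n} σ πs feasible m = begin
  expectedCost σ
    ≤⟨ randCost≤potential (λ ()) (merges σ) ⟩
  potential (π₀ σ) (merges σ)
    ≤⟨ potential≤growth (π₀ σ) F (merges σ) (π₀ σ) πs feasible (λ a b →
         ℕ.≤-reflexive (cong (ℕ._+ F a b) (flips-self (π₀ σ) (π₀ σ) (λ _ → refl) a b))) ⟩
  ∑ℚ.sum (λ a → fromℕ 2 ℚ.* fromℕ (flipsAt F a) ℚ.* growth (merges σ) a)
    ≤⟨ sumℚ-mono (λ a → *-mono-≤ˡ (fromℕ 2 ℚ.* fromℕ (flipsAt F a))
         (*-nonNeg (fromℕ-nonNeg 2) (fromℕ-nonNeg (flipsAt F a))) (growth≤lnApprox (merges σ) a m)) ⟩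
  ∑ℚ.sum (λ a → fromℕ 2 ℚ.* fromℕ (flipsAt F a) ℚ.* L)
    ≡⟨ *∑ℚ.*-distribʳ-sum L (λ a → fromℕ 2 ℚ.* fromℕ (flipsAt F a)) ⟨
  ∑ℚ.sum (λ a → fromℕ 2 ℚ.* fromℕ (flipsAt F a)) ℚ.* L
    ≡⟨ cong (ℚ._* L) (*∑ℚ.*-distribˡ-sum (fromℕ 2) (λ a → fromℕ (flipsAt F a))) ⟨
  fromℕ 2 ℚ.* ∑ℚ.sum (λ a → fromℕ (flipsAt F a)) ℚ.* L
    ≡⟨ cong (λ q → fromℕ 2 ℚ.* q ℚ.* L) (fromℕ-sum (flipsAt F)) ⟨
  fromℕ 2 ℚ.* fromℕ (sum (flipsAt F)) ℚ.* L
    ≡⟨ cong (λ s → fromℕ 2 ℚ.* fromℕ s ℚ.* L) (sum-flipsAt F) ⟩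
  fromℕ 2 ℚ.* fromℕ (2 ℕ.* (sum λ a → sum λ b → F a b)) ℚ.* L
    ≤⟨ ℚ.*-monoʳ-≤-nonNeg L {{ℚ.nonNegative (lnApprox-nonNeg n m)}} (*-mono-≤ˡ (fromℕ 2) (fromℕ-nonNeg 2)
         (fromℕ-mono (ℕ.*-monoʳ-≤ 2 (totalFlips≤cost (π₀ σ) πs)))) ⟩
  fromℕ 2 ℚ.* fromℕ (2 ℕ.* c) ℚ.* L
    ≡⟨ cong (λ q → fromℕ 2 ℚ.* q ℚ.* L) (fromℕ-* 2 c) ⟩
  fromℕ 2 ℚ.* (fromℕ 2 ℚ.* fromℕ c) ℚ.* L
    ≡⟨ regroup (fromℕ 2) (fromℕ c) L ⟩
  fromℕ c ℚ.* (fromℕ 2 ℚ.* fromℕ 2 ℚ.* L)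
    ≡⟨ cong (λ q → fromℕ c ℚ.* (q ℚ.* L)) (fromℕ-* 2 2) ⟨
  fromℕ c ℚ.* (fromℕ 4 ℚ.* L) ∎
  where
  open ℚ.≤-Reasoning
  F = totalFlips (π₀ σ) πs
  L = lnApprox n m
  c = cost (π₀ σ) πs
  regroup : ∀ b c l → b ℚ.* (b ℚ.* c) ℚ.* l ≡ c ℚ.* (b ℚ.* b ℚ.* l)
  regroup = solve-∀ ringℚ

theorem2 : ∀ (n : ℕ) .{{_ : NonZero n}} (σ : CliqueInstance n) (opt : ℕ) → IsOpt σ opt →
    fromℚ (expectedCost σ) ≤ᴿ opt · (4 · ln n)
-- The rational inequality holds at every index, so 0 is a valid threshold for every ε.
theorem2 n σ opt ((πs , feasible , refl) , _) ε 0<ε = 0 , λ m _ → ℚ.≤-trans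
  (ℚ.≤-trans (expectedCost≤ σ πs feasible m) (ℚ.≤-reflexive (sym (ℚ.+-identityʳ (bound m)))))
  (ℚ.+-monoʳ-≤ (bound m) (ℚ.<⇒≤ 0<ε))
  where
  bound : ℕ → ℚ
  bound m = fromℕ (cost (π₀ σ) πs) ℚ.* (fromℕ 4 ℚ.* lnApprox n m)
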